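{- For every real $k\in(0,1)$, $$\sum_{n=0}^\infty \frac{(\frac14)_n(\frac34)_n}{n!^2}\,P_n\!\left(\frac{(1+k)(1-4k+7k^2)}{(1-3k)(1+3k^2)}\right)\left(\frac{(1+k)(1-3k)(1+3k^2)}{(1+3k)^2}\right)^n\bigl(C_3n^3+C_2n^2+C_1n+C_0\bigr)=\frac{3\sqrt2\,(1+3k)^{5/2}(1+3k^2)}{(1+k)\pi},$$ where $$C_3=\frac{16(k-1)^2k^2}{(1+k)^2}(8+15k+9k^2)^2,$$ $$C_2=48(k-1)k(8-15k+27k^2+27k^3+81k^4),$$ $$C_1=(4-33k+45k^2)(4-17k+17k^2-3k^3+63k^4),$$ $$C_0=3(1-3k)^4(1+k+2k^2).$$ At the single value $k=\tfrac13$, the product $P_n(\cdot)\,(\cdot)^n$ in each summand is understood as its limit as $k\to\tfrac13$.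
   Context: $P_n$ denotes the $n$-th Legendre polynomial, $P_n(x)={}_2F_1\bigl(-n,n+1;1;\tfrac{1-x}{2}\bigr)$, evaluated at any real $x$ (possibly $|x|>1$). $(a)_n=a(a+1)\cdots(a+n-1)$, $(a)_0=1$, is the Pochhammer symbol. -}

module Defs where

open import Data.Empty using (⊥-elim)
open import Data.Integer.Base as ℤ using (ℤ; +_; +0; +[1+_]; -[1+_])
import Data.Integer.Properties as ℤ
open import Data.Nat.Base as ℕ using (ℕ; zero; suc; _!)
import Data.Nat.Properties as ℕ
import Data.Nat.Solver as ℕSolver
open import Data.Product using (∃; _×_; _,_; proj₁; proj₂)
open import Data.Rational.Base as ℚ using (ℚ; 0ℚ; 1ℚ; ½; mkℚ)
import Data.Rational.Properties as ℚ
import Data.Rational.Solver as ℚSolver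
import Data.Rational.Unnormalised.Base as ℚᵘ
import Data.Rational.Unnormalised.Properties as ℚᵘ
open import Data.Sum using (_⊎_; inj₁; inj₂)
open import Data.Unit.Base using (⊤; tt)
open import Relation.Binary.PropositionalEquality
  using (_≡_; refl; sym; trans; cong; cong₂; subst; subst₂)
open import Relation.Nullary using (¬_; yes; no)

module Rational where
  open import Data.Rational.Base using (_+_; _*_; _-_; -_; ∣_∣; _<_; _≤_; Positive; NonNegative)
  open ℚSolver.+-*-Solver using (solve; _:+_; _:*_; _:-_; :-_; _:=_; con)

  halve : ∀ p → p * ½ + p * ½ ≡ p
  halve = solve 1 (λ p → p :* con ½ :+ p :* con ½ := p) refl

  *-pos : ∀ {p q} → 0ℚ < p → 0ℚ < q → 0ℚ < p * q
  *-pos {p} {q} 0<p 0<q = ℚ.positive⁻¹ (p * q)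
    {{ℚ.pos*pos⇒pos p {{ℚ.positive 0<p}} q {{ℚ.positive 0<q}}}}

  *-nonNeg : ∀ {p q} → 0ℚ ≤ p → 0ℚ ≤ q → 0ℚ ≤ p * q
  *-nonNeg {p} {q} 0≤p 0≤q = ℚ.nonNegative⁻¹ (p * q)
    {{ℚ.nonNeg*nonNeg⇒nonNeg p {{ℚ.nonNegative 0≤p}} q {{ℚ.nonNegative 0≤q}}}}

  half-pos : ∀ {ε} → 0ℚ < ε → 0ℚ < ε * ½
  half-pos 0<ε = *-pos 0<ε (ℚ.positive⁻¹ ½)

  *-mono : ∀ {p q r s} → 0ℚ ≤ r → 0ℚ ≤ q → p ≤ q → r ≤ s → p * r ≤ q * s
  *-mono {q = q} {r} 0≤r 0≤q p≤q r≤s = ℚ.≤-trans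
    (ℚ.*-monoʳ-≤-nonNeg r {{ℚ.nonNegative 0≤r}} p≤q)
    (ℚ.*-monoˡ-≤-nonNeg q {{ℚ.nonNegative 0≤q}} r≤s)

  *-monoʳ-< : ∀ {p q r} → 0ℚ < r → p < q → p * r < q * r
  *-monoʳ-< {r = r} 0<r = ℚ.*-monoˡ-<-pos r {{ℚ.positive 0<r}}

  p≤q⇒0≤q-p : ∀ {p q} → p ≤ q → 0ℚ ≤ q - p
  p≤q⇒0≤q-p {p} {q} p≤q = subst (_≤ q - p) (ℚ.+-inverseʳ p) (ℚ.+-monoˡ-≤ (- p) p≤q)

  ∣∣-< : ∀ {p ε} → p < ε → - p < ε → ∣ p ∣ < ε
  ∣∣-< {p} p<ε -p<ε with ℚ.∣p∣≡p∨∣p∣≡-p p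
  ... | inj₁ eq = subst (_< _) (sym eq) p<ε
  ... | inj₂ eq = subst (_< _) (sym eq) -p<ε

  p≤∣p∣ : ∀ p → p ≤ ∣ p ∣
  p≤∣p∣ p with ℚ.≤-total 0ℚ p
  ... | inj₁ 0≤p = ℚ.≤-reflexive (sym (ℚ.0≤p⇒∣p∣≡p 0≤p))
  ... | inj₂ p≤0 = ℚ.≤-trans p≤0 (ℚ.0≤∣p∣ p)

  ∣p-q∣≡∣q-p∣ : ∀ p q → ∣ p - q ∣ ≡ ∣ q - p ∣
  ∣p-q∣≡∣q-p∣ p q = trans (sym (ℚ.∣-p∣≡∣p∣ (p - q)))
    (cong ∣_∣ (solve 2 (λ a b → :- (a :- b) := b :- a) refl p q))

  ∣p∣≤∣q∣+∣p-q∣ : ∀ p q → ∣ p ∣ ≤ ∣ q ∣ + ∣ p - q ∣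
  ∣p∣≤∣q∣+∣p-q∣ p q = subst (λ r → ∣ r ∣ ≤ ∣ q ∣ + ∣ p - q ∣)
    (solve 2 (λ a b → b :+ (a :- b) := a) refl p q)
    (ℚ.∣p+q∣≤∣p∣+∣q∣ q (p - q))

  ∣p∣-∣q∣≤∣p-q∣ : ∀ p q → ∣ p ∣ - ∣ q ∣ ≤ ∣ p - q ∣
  ∣p∣-∣q∣≤∣p-q∣ p q = subst (∣ p ∣ - ∣ q ∣ ≤_)
    (solve 2 (λ a b → (a :+ b) :- a := b) refl ∣ q ∣ ∣ p - q ∣)
    (ℚ.+-monoˡ-≤ (- ∣ q ∣) (∣p∣≤∣q∣+∣p-q∣ p q))

  square-mono-< : ∀ {p q} → 0ℚ ≤ p → q * q < p * p → q < p
  square-mono-< {p} {q} 0≤p q²<p² with q ℚ.<? p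
  ... | yes q<p = q<p
  ... | no q≮p = ⊥-elim (ℚ.<-irrefl refl (ℚ.<-≤-trans q²<p²
          (*-mono 0≤p (ℚ.≤-trans 0≤p (ℚ.≮⇒≥ q≮p)) (ℚ.≮⇒≥ q≮p) (ℚ.≮⇒≥ q≮p))))

  /-mono-≤ : ∀ a b c d → a ℕ.* suc d ℕ.≤ c ℕ.* suc b → + a ℚ./ suc b ≤ + c ℚ./ suc d
  /-mono-≤ a b c d ineq = ℚ.toℚᵘ-cancel-≤
    (ℚᵘ.≤-respˡ-≃ (ℚᵘ.≃-sym (ℚ.toℚᵘ-fromℚᵘ (ℚᵘ.mkℚᵘ (+ a) b)))
    (ℚᵘ.≤-respʳ-≃ (ℚᵘ.≃-sym (ℚ.toℚᵘ-fromℚᵘ (ℚᵘ.mkℚᵘ (+ c) d)))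
    (ℚᵘ.*≤* (subst₂ ℤ._≤_ (ℤ.pos-* a (suc d)) (ℤ.pos-* c (suc b)) (ℤ.+≤+ ineq)))))

  /-mono-< : ∀ a b c d → a ℕ.* suc d ℕ.< c ℕ.* suc b → + a ℚ./ suc b < + c ℚ./ suc d
  /-mono-< a b c d ineq = ℚ.toℚᵘ-cancel-<
    (ℚᵘ.<-respˡ-≃ (ℚᵘ.≃-sym (ℚ.toℚᵘ-fromℚᵘ (ℚᵘ.mkℚᵘ (+ a) b)))
    (ℚᵘ.<-respʳ-≃ (ℚᵘ.≃-sym (ℚ.toℚᵘ-fromℚᵘ (ℚᵘ.mkℚᵘ (+ c) d)))
    (ℚᵘ.*<* (subst₂ ℤ._<_ (ℤ.pos-* a (suc d)) (ℤ.pos-* c (suc b)) (ℤ.+<+ ineq)))))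

  /-homo-* : ∀ a b c d →
    (+ a ℚ./ suc b) * (+ c ℚ./ suc d) ≡ + (a ℕ.* c) ℚ./ (suc b ℕ.* suc d)
  /-homo-* a b c d = ℚ.toℚᵘ-injective
    (ℚᵘ.≃-trans (ℚ.toℚᵘ-homo-* (+ a ℚ./ suc b) (+ c ℚ./ suc d))
    (ℚᵘ.≃-trans (ℚᵘ.*-cong (ℚ.toℚᵘ-fromℚᵘ (ℚᵘ.mkℚᵘ (+ a) b)) (ℚ.toℚᵘ-fromℚᵘ (ℚᵘ.mkℚᵘ (+ c) d)))
    (ℚᵘ.≃-trans (ℚᵘ.*≡* (cong (ℤ._* + (suc b ℕ.* suc d)) (sym (ℤ.pos-* a c))))
    (ℚᵘ.≃-sym (ℚ.toℚᵘ-fromℚᵘ (ℚᵘ.mkℚᵘ (+ (a ℕ.* c)) (d ℕ.+ b ℕ.* suc d)))))))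

  /-homo-+ : ∀ a b c d →
    (+ a ℚ./ suc b) + (+ c ℚ./ suc d) ≡ + (a ℕ.* suc d ℕ.+ c ℕ.* suc b) ℚ./ (suc b ℕ.* suc d)
  /-homo-+ a b c d = ℚ.toℚᵘ-injective
    (ℚᵘ.≃-trans (ℚ.toℚᵘ-homo-+ (+ a ℚ./ suc b) (+ c ℚ./ suc d))
    (ℚᵘ.≃-trans (ℚᵘ.+-cong (ℚ.toℚᵘ-fromℚᵘ (ℚᵘ.mkℚᵘ (+ a) b)) (ℚ.toℚᵘ-fromℚᵘ (ℚᵘ.mkℚᵘ (+ c) d)))
    (ℚᵘ.≃-trans (ℚᵘ.*≡* (cong (ℤ._* + (suc b ℕ.* suc d))
        (cong₂ ℤ._+_ (sym (ℤ.pos-* a (suc d))) (sym (ℤ.pos-* c (suc b))))))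
    (ℚᵘ.≃-sym (ℚ.toℚᵘ-fromℚᵘ
      (ℚᵘ.mkℚᵘ (+ (a ℕ.* suc d ℕ.+ c ℕ.* suc b)) (d ℕ.+ b ℕ.* suc d)))))))

  0≤/ : ∀ a b → 0ℚ ≤ + a ℚ./ suc b
  0≤/ a b = /-mono-≤ 0 0 a b ℕ.z≤n

  /-archimedean : ∀ a {ε} → 0ℚ < ε →
    ∃ λ N → ∀ n → N ℕ.≤ n → + a ℚ./ suc n < ε
  /-archimedean a {mkℚ +[1+ c ] d cop} 0<ε = a ℕ.* suc d , λ n N≤n →
    subst (+ a ℚ./ suc n <_) (ℚ.↥p/↧p≡p (mkℚ +[1+ c ] d cop))
      (/-mono-< a n (suc c) d (ℕ.<-≤-trans (ℕ.s≤s N≤n) (ℕ.m≤m+n (suc n) _)))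
  /-archimedean a {mkℚ +0 d _} (ℚ.*<* (ℤ.+<+ ()))
  /-archimedean a {mkℚ -[1+ c ] d _} (ℚ.*<* ())

open Rational

Eventually : (ℕ → Set) → Set
Eventually P = ∃ λ N → ∀ n → N ℕ.≤ n → P n

both : ∀ {P Q} → Eventually P → Eventually Q → Eventually (λ n → P n × Q n)
both (M , p) (N , q) = M ℕ.⊔ N , λ n le →
  p n (ℕ.≤-trans (ℕ.m≤m⊔n M N) le) , q n (ℕ.≤-trans (ℕ.m≤n⊔m M N) le)

IsCauchy : (ℕ → ℚ) → Set
IsCauchy a = ∀ ε → 0ℚ ℚ.< ε →
  ∃ λ N → ∀ m n → N ℕ.≤ m → N ℕ.≤ n → ℚ.∣ a m ℚ.- a n ∣ ℚ.< ε

-- The reals are Cauchy sequences of rationals, with _≈_ as equality.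
record ℝ : Set where
  no-eta-equality
  constructor mkℝ
  field
    seq    : ℕ → ℚ
    cauchy : IsCauchy seq

open ℝ public

infix 4 _≈_ _<_ _#_

record _≈_ (x y : ℝ) : Set where
  constructor mk≈
  field
    close : ∀ ε → 0ℚ ℚ.< ε → Eventually λ n → ℚ.∣ seq x n ℚ.- seq y n ∣ ℚ.< ε

record _<_ (x y : ℝ) : Set where
  constructor mk<
  field
    gap        : ℚ
    gap-pos    : 0ℚ ℚ.< gap
    eventually : Eventually λ n → gap ℚ.≤ seq y n ℚ.- seq x n

-- Apartness: the positive form of x ≉ y, needed to divide constructively.
_#_ : ℝ → ℝ → Set
x # y = x < y ⊎ y < x

fromℚ : ℚ → ℝ
seq (fromℚ q) _ = q
cauchy (fromℚ q) ε 0<ε =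
  0 , λ _ _ _ _ → subst (ℚ._< ε) (cong ℚ.∣_∣ (sym (ℚ.+-inverseʳ q))) 0<ε

fromℕ : ℕ → ℝ
fromℕ n = fromℚ (+ n ℚ./ 1)

0ℝ 1ℝ : ℝ
0ℝ = fromℚ 0ℚ
1ℝ = fromℚ 1ℚ

infix  8 -_
infixr 8 _^_
infixl 7 _*_ _/_[_]
infixl 6 _+_ _-_

module Arithmetic where
  open ℚSolver.+-*-Solver using (solve; _:+_; _:*_; _:-_; :-_; _:=_)
  open ℚ.≤-Reasoning

  +-cauchy : ∀ x y → IsCauchy (λ n → seq x n ℚ.+ seq y n)
  +-cauchy x y ε 0<ε
    with cauchy x (ε ℚ.* ½) (half-pos 0<ε) | cauchy y (ε ℚ.* ½) (half-pos 0<ε)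
  ... | M , p | N , q = M ℕ.⊔ N , λ m n le le′ → begin-strict
    ℚ.∣ (seq x m ℚ.+ seq y m) ℚ.- (seq x n ℚ.+ seq y n) ∣
      ≡⟨ cong ℚ.∣_∣ (solve 4 (λ a b c d → (a :+ b) :- (c :+ d) := (a :- c) :+ (b :- d))
           refl (seq x m) (seq y m) (seq x n) (seq y n)) ⟩
    ℚ.∣ (seq x m ℚ.- seq x n) ℚ.+ (seq y m ℚ.- seq y n) ∣
      ≤⟨ ℚ.∣p+q∣≤∣p∣+∣q∣ (seq x m ℚ.- seq x n) (seq y m ℚ.- seq y n) ⟩
    ℚ.∣ seq x m ℚ.- seq x n ∣ ℚ.+ ℚ.∣ seq y m ℚ.- seq y n ∣
      <⟨ ℚ.+-mono-<
           (p m n (ℕ.≤-trans (ℕ.m≤m⊔n M N) le) (ℕ.≤-trans (ℕ.m≤m⊔n M N) le′))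
           (q m n (ℕ.≤-trans (ℕ.m≤n⊔m M N) le) (ℕ.≤-trans (ℕ.m≤n⊔m M N) le′)) ⟩
    ε ℚ.* ½ ℚ.+ ε ℚ.* ½
      ≡⟨ halve ε ⟩
    ε ∎

  neg-cauchy : ∀ x → IsCauchy (λ n → ℚ.- seq x n)
  neg-cauchy x ε 0<ε with cauchy x ε 0<ε
  ... | N , p = N , λ m n le le′ → subst (ℚ._< ε)
    (trans (∣p-q∣≡∣q-p∣ (seq x m) (seq x n))
      (cong ℚ.∣_∣ (solve 2 (λ a b → b :- a := (:- a) :- (:- b)) refl (seq x m) (seq x n))))
    (p m n le le′)

  abs-cauchy : ∀ x → IsCauchy (λ n → ℚ.∣ seq x n ∣)
  abs-cauchy x ε 0<ε with cauchy x ε 0<ε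
  ... | N , p = N , λ m n le le′ → ∣∣-<
    (ℚ.≤-<-trans (∣p∣-∣q∣≤∣p-q∣ (seq x m) (seq x n)) (p m n le le′))
    (subst (ℚ._< ε)
      (solve 2 (λ a b → b :- a := :- (a :- b)) refl ℚ.∣ seq x m ∣ ℚ.∣ seq x n ∣)
      (ℚ.≤-<-trans (∣p∣-∣q∣≤∣p-q∣ (seq x n) (seq x m)) (p n m le′ le)))

  bounded : ∀ x → ∃ λ K → 0ℚ ℚ.< K × Eventually λ n → ℚ.∣ seq x n ∣ ℚ.≤ K
  bounded x with cauchy x 1ℚ (ℚ.positive⁻¹ 1ℚ)
  ... | N , p = ℚ.∣ seq x N ∣ ℚ.+ 1ℚ
    , ℚ.+-mono-≤-< (ℚ.0≤∣p∣ (seq x N)) (ℚ.positive⁻¹ 1ℚ)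
    , N , λ n le → ℚ.≤-trans (∣p∣≤∣q∣+∣p-q∣ (seq x n) (seq x N))
        (ℚ.+-monoʳ-≤ ℚ.∣ seq x N ∣ (ℚ.<⇒≤ (p n N le ℕ.≤-refl)))

  scaled : ∀ {ε} K → 0ℚ ℚ.< ε → 0ℚ ℚ.< K → ∃ λ δ → 0ℚ ℚ.< δ × δ ℚ.* K ≡ ε
  scaled {ε} K 0<ε 0<K = ε ℚ.* 1/K
    , *-pos 0<ε (ℚ.positive⁻¹ 1/K {{ℚ.1/pos⇒pos K {{ℚ.positive 0<K}}}})
    , trans (ℚ.*-assoc ε 1/K K)
        (trans (cong (ε ℚ.*_) (ℚ.*-inverseˡ K {{ℚ.>-nonZero 0<K}})) (ℚ.*-identityʳ ε))
    where
      1/K : ℚ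
      1/K = ℚ.1/_ K {{ℚ.>-nonZero 0<K}}

  product-difference : ∀ a b c d →
    a ℚ.* b ℚ.- c ℚ.* d ≡ (a ℚ.- c) ℚ.* b ℚ.+ (b ℚ.- d) ℚ.* c
  product-difference = solve 4
    (λ a b c d → a :* b :- c :* d := (a :- c) :* b :+ (b :- d) :* c) refl

  product-close : ∀ a b c d {K L δ η} → 0ℚ ℚ.< K → 0ℚ ℚ.< L →
    ℚ.∣ c ∣ ℚ.≤ K → ℚ.∣ b ∣ ℚ.≤ L → ℚ.∣ a ℚ.- c ∣ ℚ.< δ → ℚ.∣ b ℚ.- d ∣ ℚ.< η →
    ℚ.∣ a ℚ.* b ℚ.- c ℚ.* d ∣ ℚ.< δ ℚ.* L ℚ.+ η ℚ.* K
  product-close a b c d {K} {L} {δ} {η} 0<K 0<L c≤K b≤L a-c< b-d< = begin-strict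
    ℚ.∣ a ℚ.* b ℚ.- c ℚ.* d ∣
      ≡⟨ cong ℚ.∣_∣ (product-difference a b c d) ⟩
    ℚ.∣ (a ℚ.- c) ℚ.* b ℚ.+ (b ℚ.- d) ℚ.* c ∣
      ≤⟨ ℚ.∣p+q∣≤∣p∣+∣q∣ ((a ℚ.- c) ℚ.* b) ((b ℚ.- d) ℚ.* c) ⟩
    ℚ.∣ (a ℚ.- c) ℚ.* b ∣ ℚ.+ ℚ.∣ (b ℚ.- d) ℚ.* c ∣
      ≡⟨ cong₂ ℚ._+_ (ℚ.∣p*q∣≡∣p∣*∣q∣ (a ℚ.- c) b) (ℚ.∣p*q∣≡∣p∣*∣q∣ (b ℚ.- d) c) ⟩
    ℚ.∣ a ℚ.- c ∣ ℚ.* ℚ.∣ b ∣ ℚ.+ ℚ.∣ b ℚ.- d ∣ ℚ.* ℚ.∣ c ∣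
      ≤⟨ ℚ.+-mono-≤
           (*-mono (ℚ.0≤∣p∣ b) (ℚ.0≤∣p∣ (a ℚ.- c)) ℚ.≤-refl b≤L)
           (*-mono (ℚ.0≤∣p∣ c) (ℚ.0≤∣p∣ (b ℚ.- d)) ℚ.≤-refl c≤K) ⟩
    ℚ.∣ a ℚ.- c ∣ ℚ.* L ℚ.+ ℚ.∣ b ℚ.- d ∣ ℚ.* K
      <⟨ ℚ.+-mono-< (*-monoʳ-< 0<L a-c<) (*-monoʳ-< 0<K b-d<) ⟩
    δ ℚ.* L ℚ.+ η ℚ.* K ∎

  *-cauchy : ∀ x y → IsCauchy (λ n → seq x n ℚ.* seq y n)
  *-cauchy x y ε 0<ε =
    let K , 0<K , P , bx   = bounded x
        L , 0<L , Q , by   = bounded y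
        δ , 0<δ , δL≡      = scaled L (half-pos 0<ε) 0<L
        η , 0<η , ηK≡      = scaled K (half-pos 0<ε) 0<K
        M , p              = cauchy x δ 0<δ
        N , q              = cauchy y η 0<η
    in (P ℕ.⊔ Q) ℕ.⊔ (M ℕ.⊔ N) , λ m n le le′ →
    subst (ℚ.∣ seq x m ℚ.* seq y m ℚ.- seq x n ℚ.* seq y n ∣ ℚ.<_)
      (trans (cong₂ ℚ._+_ δL≡ ηK≡) (halve ε))
      (product-close (seq x m) (seq y m) (seq x n) (seq y n) 0<K 0<L
        (bx n (ℕ.m⊔n≤o⇒m≤o P Q (ℕ.m⊔n≤o⇒m≤o (P ℕ.⊔ Q) (M ℕ.⊔ N) le′)))
        (by m (ℕ.m⊔n≤o⇒n≤o P Q (ℕ.m⊔n≤o⇒m≤o (P ℕ.⊔ Q) (M ℕ.⊔ N) le)))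
        (p m n (ℕ.m⊔n≤o⇒m≤o M N (ℕ.m⊔n≤o⇒n≤o (P ℕ.⊔ Q) (M ℕ.⊔ N) le))
               (ℕ.m⊔n≤o⇒m≤o M N (ℕ.m⊔n≤o⇒n≤o (P ℕ.⊔ Q) (M ℕ.⊔ N) le′)))
        (q m n (ℕ.m⊔n≤o⇒n≤o M N (ℕ.m⊔n≤o⇒n≤o (P ℕ.⊔ Q) (M ℕ.⊔ N) le))
               (ℕ.m⊔n≤o⇒n≤o M N (ℕ.m⊔n≤o⇒n≤o (P ℕ.⊔ Q) (M ℕ.⊔ N) le′))))

open Arithmetic

_+_ : ℝ → ℝ → ℝ
seq (x + y) n = seq x n ℚ.+ seq y n
cauchy (x + y) = +-cauchy x y

-_ : ℝ → ℝ
seq (- x) n = ℚ.- seq x n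
cauchy (- x) = neg-cauchy x

_-_ : ℝ → ℝ → ℝ
x - y = x + (- y)

_*_ : ℝ → ℝ → ℝ
seq (x * y) n = seq x n ℚ.* seq y n
cauchy (x * y) = *-cauchy x y

∣_∣ : ℝ → ℝ
seq ∣ x ∣ n = ℚ.∣ seq x n ∣
cauchy ∣ x ∣ = abs-cauchy x

_^_ : ℝ → ℕ → ℝ
x ^ zero  = 1ℝ
x ^ suc n = x * x ^ n

-- Total inversion on ℚ with the junk value 0 at 0; a real apart from 0 has
-- only finitely many zero terms, so the junk value does not affect the limit.
invℚ : ℚ → ℚ
invℚ q with q ℚ.≟ 0ℚ
... | yes _  = 0ℚ
... | no q≢0 = ℚ.1/_ q {{ℚ.≢-nonZero q≢0}}

module Inversion where
  open ℚSolver.+-*-Solver using (solve; _:+_; _:*_; _:-_; :-_; _:=_; con)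
  open ℚ.≤-Reasoning

  separated : ∀ x → x # 0ℝ → ∃ λ ε → 0ℚ ℚ.< ε × Eventually λ n → ε ℚ.≤ ℚ.∣ seq x n ∣
  separated x (inj₁ (mk< ε 0<ε (N , p))) = ε , 0<ε , N , λ n le → begin
    ε                     ≤⟨ p n le ⟩
    0ℚ ℚ.- seq x n        ≡⟨ ℚ.+-identityˡ (ℚ.- seq x n) ⟩
    ℚ.- seq x n           ≤⟨ p≤∣p∣ (ℚ.- seq x n) ⟩
    ℚ.∣ ℚ.- seq x n ∣     ≡⟨ ℚ.∣-p∣≡∣p∣ (seq x n) ⟩
    ℚ.∣ seq x n ∣         ∎
  separated x (inj₂ (mk< ε 0<ε (N , p))) = ε , 0<ε , N , λ n le → begin
    ε                     ≤⟨ p n le ⟩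
    seq x n ℚ.- 0ℚ        ≡⟨ ℚ.+-identityʳ (seq x n) ⟩
    seq x n               ≤⟨ p≤∣p∣ (seq x n) ⟩
    ℚ.∣ seq x n ∣         ∎

  invℚ-inverse : ∀ {ε} q → 0ℚ ℚ.< ε → ε ℚ.≤ ℚ.∣ q ∣ → q ℚ.* invℚ q ≡ 1ℚ
  invℚ-inverse q 0<ε ε≤ with q ℚ.≟ 0ℚ
  ... | yes refl = ⊥-elim (ℚ.<-irrefl refl (ℚ.<-≤-trans 0<ε ε≤))
  ... | no q≢0   = ℚ.*-inverseʳ q {{ℚ.≢-nonZero q≢0}}

  inv-cauchy : ∀ x → x # 0ℝ → IsCauchy (λ n → invℚ (seq x n))
  inv-cauchy x x#0 ε 0<ε with separated x x#0
  ... | γ , 0<γ , M , sep with cauchy x (ε ℚ.* (γ ℚ.* γ)) (*-pos 0<ε (*-pos 0<γ 0<γ))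
  ... | N , p = M ℕ.⊔ N , λ m n le le′ →
    bound (seq x m) (seq x n)
      (sep m (ℕ.≤-trans (ℕ.m≤m⊔n M N) le)) (sep n (ℕ.≤-trans (ℕ.m≤m⊔n M N) le′))
      (p m n (ℕ.≤-trans (ℕ.m≤n⊔m M N) le) (ℕ.≤-trans (ℕ.m≤n⊔m M N) le′))
    where
      bound : ∀ a b → γ ℚ.≤ ℚ.∣ a ∣ → γ ℚ.≤ ℚ.∣ b ∣ →
        ℚ.∣ a ℚ.- b ∣ ℚ.< ε ℚ.* (γ ℚ.* γ) → ℚ.∣ invℚ a ℚ.- invℚ b ∣ ℚ.< ε
      bound a b γ≤a γ≤b a-b< =
        ℚ.*-cancelʳ-<-nonNeg (γ ℚ.* γ) {{ℚ.nonNegative (ℚ.<⇒≤ (*-pos 0<γ 0<γ))}}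
        (begin-strict
        ℚ.∣ a′ ℚ.- b′ ∣ ℚ.* (γ ℚ.* γ)
          ≤⟨ *-mono (ℚ.<⇒≤ (*-pos 0<γ 0<γ)) (ℚ.0≤∣p∣ (a′ ℚ.- b′)) ℚ.≤-refl
               (*-mono (ℚ.<⇒≤ 0<γ) (ℚ.0≤∣p∣ a) γ≤a γ≤b) ⟩
        ℚ.∣ a′ ℚ.- b′ ∣ ℚ.* (ℚ.∣ a ∣ ℚ.* ℚ.∣ b ∣)
          ≡⟨ cong (ℚ.∣ a′ ℚ.- b′ ∣ ℚ.*_) (sym (ℚ.∣p*q∣≡∣p∣*∣q∣ a b)) ⟩
        ℚ.∣ a′ ℚ.- b′ ∣ ℚ.* ℚ.∣ a ℚ.* b ∣
          ≡⟨ sym (ℚ.∣p*q∣≡∣p∣*∣q∣ (a′ ℚ.- b′) (a ℚ.* b)) ⟩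
        ℚ.∣ (a′ ℚ.- b′) ℚ.* (a ℚ.* b) ∣
          ≡⟨ cong ℚ.∣_∣ (solve 4
               (λ a b c d → (c :- d) :* (a :* b) := (a :* c) :* b :- (b :* d) :* a)
               refl a b a′ b′) ⟩
        ℚ.∣ (a ℚ.* a′) ℚ.* b ℚ.- (b ℚ.* b′) ℚ.* a ∣
          ≡⟨ cong₂ (λ s t → ℚ.∣ s ℚ.* b ℚ.- t ℚ.* a ∣)
               (invℚ-inverse a 0<γ γ≤a) (invℚ-inverse b 0<γ γ≤b) ⟩
        ℚ.∣ 1ℚ ℚ.* b ℚ.- 1ℚ ℚ.* a ∣
          ≡⟨ cong₂ (λ s t → ℚ.∣ s ℚ.- t ∣) (ℚ.*-identityˡ b) (ℚ.*-identityˡ a) ⟩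
        ℚ.∣ b ℚ.- a ∣
          ≡⟨ ∣p-q∣≡∣q-p∣ b a ⟩
        ℚ.∣ a ℚ.- b ∣
          <⟨ a-b< ⟩
        ε ℚ.* (γ ℚ.* γ) ∎)
        where
          a′ b′ : ℚ
          a′ = invℚ a
          b′ = invℚ b

open Inversion

inv : (x : ℝ) → x # 0ℝ → ℝ
seq (inv x x#0) n = invℚ (seq x n)
cauchy (inv x x#0) = inv-cauchy x x#0

_/_[_] : (x y : ℝ) → y # 0ℝ → ℝ
x / y [ y#0 ] = x * inv y y#0

isqrt-step : ℕ → ℕ → ℕ
isqrt-step s n with suc s ℕ.* suc s ℕ.≤? n
... | yes _ = suc s
... | no  _ = s

isqrt : ℕ → ℕ
isqrt zero    = zero
isqrt (suc n) = isqrt-step (isqrt n) (suc n)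

-- √(a/b) = √(ab)/b is approximated by a multiple of 1/(b(n+1)).
√approx : ℚ → ℕ → ℚ
√approx (mkℚ p b-1 _) n =
  + isqrt ((ℤ.∣ p ∣ ℕ.* suc b-1) ℕ.* (suc n ℕ.* suc n)) ℚ./ (suc b-1 ℕ.* suc n)

module Root where
  open ℚSolver.+-*-Solver using (solve; _:+_; _:*_; _:-_; :-_; _:=_; con)
  open ℕSolver.+-*-Solver using ()
    renaming (solve to nsolve; _:+_ to _⊕_; _:*_ to _⊗_; _:=_ to _≐_; con to ncon)

  isqrt-lower : ∀ n → isqrt n ℕ.* isqrt n ℕ.≤ n
  isqrt-lower zero = ℕ.z≤n
  isqrt-lower (suc n) with suc (isqrt n) ℕ.* suc (isqrt n) ℕ.≤? suc n
  ... | yes le = le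
  ... | no  _  = ℕ.m≤n⇒m≤1+n (isqrt-lower n)

  isqrt-upper : ∀ n → n ℕ.< suc (isqrt n) ℕ.* suc (isqrt n)
  isqrt-upper zero = ℕ.s≤s ℕ.z≤n
  isqrt-upper (suc n) with suc (isqrt n) ℕ.* suc (isqrt n) ℕ.≤? suc n
  ... | yes _  = ℕ.≤-<-trans (isqrt-upper n)
                   (ℕ.*-mono-< (ℕ.n<1+n (suc (isqrt n))) (ℕ.n<1+n (suc (isqrt n))))
  ... | no ≰ = ℕ.≰⇒> ≰

  √approx-nonNeg : ∀ q n → 0ℚ ℚ.≤ √approx q n
  √approx-nonNeg (mkℚ p b-1 _) n =
    0≤/ (isqrt ((ℤ.∣ p ∣ ℕ.* suc b-1) ℕ.* (suc n ℕ.* suc n))) (n ℕ.+ b-1 ℕ.* suc n)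

  √approx-lower : ∀ q n → √approx q n ℚ.* √approx q n ℚ.≤ ℚ.∣ q ∣
  √approx-lower (mkℚ p b-1 cop) n =
    subst₂ ℚ._≤_ (sym (/-homo-* i (n ℕ.+ b-1 ℕ.* suc n) i (n ℕ.+ b-1 ℕ.* suc n)))
      (ℚ.↥p/↧p≡p (mkℚ (+ a) b-1 cop))
      (/-mono-≤ (i ℕ.* i) _ a b-1 (ℕ.≤-trans
        (ℕ.*-monoˡ-≤ b (isqrt-lower ((a ℕ.* b) ℕ.* (d ℕ.* d))))
        (ℕ.≤-reflexive (nsolve 3
          (λ a b d → ((a ⊗ b) ⊗ (d ⊗ d)) ⊗ b ≐ a ⊗ ((b ⊗ d) ⊗ (b ⊗ d)))
          refl a b d))))
    where
      a b d i : ℕ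
      a = ℤ.∣ p ∣
      b = suc b-1
      d = suc n
      i = isqrt ((a ℕ.* b) ℕ.* (d ℕ.* d))

  √approx-upper : ∀ q n → let s = √approx q n ℚ.+ + 1 ℚ./ suc n in ℚ.∣ q ∣ ℚ.< s ℚ.* s
  √approx-upper (mkℚ p b-1 cop) n =
    subst₂ ℚ._<_ (ℚ.↥p/↧p≡p (mkℚ (+ a) b-1 cop))
      (trans (sym (/-homo-* j c j c)) (cong₂ ℚ._*_ (sym split) (sym split)))
      (/-mono-< a b-1 (j ℕ.* j) _ ineq)
    where
      a b d i j c : ℕ
      a = ℤ.∣ p ∣
      b = suc b-1
      d = suc n
      i = isqrt ((a ℕ.* b) ℕ.* (d ℕ.* d))
      j = i ℕ.* d ℕ.+ 1 ℕ.* (b ℕ.* d)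
      c = n ℕ.+ (n ℕ.+ b-1 ℕ.* suc n) ℕ.* suc n

      split : + i ℚ./ (b ℕ.* d) ℚ.+ + 1 ℚ./ d ≡ + j ℚ./ suc c
      split = /-homo-+ i (n ℕ.+ b-1 ℕ.* suc n) 1 n

      step : (a ℕ.* b) ℕ.* (d ℕ.* d) ℕ.< (i ℕ.+ b) ℕ.* (i ℕ.+ b)
      step = ℕ.<-≤-trans (isqrt-upper ((a ℕ.* b) ℕ.* (d ℕ.* d)))
        (ℕ.*-mono-≤ 1+i≤i+b 1+i≤i+b)
        where
          1+i≤i+b : suc i ℕ.≤ i ℕ.+ b
          1+i≤i+b = ℕ.≤-trans (ℕ.≤-reflexive (ℕ.+-comm 1 i)) (ℕ.+-monoʳ-≤ i (ℕ.s≤s ℕ.z≤n))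

      ineq : a ℕ.* (suc c ℕ.* suc c) ℕ.< (j ℕ.* j) ℕ.* b
      ineq = subst₂ ℕ._<_
        (nsolve 3 (λ a b d → ((a ⊗ b) ⊗ (d ⊗ d)) ⊗ (b ⊗ (d ⊗ d))
          ≐ a ⊗ (((b ⊗ d) ⊗ d) ⊗ ((b ⊗ d) ⊗ d))) refl a b d)
        (nsolve 3 (λ i b d → ((i ⊕ b) ⊗ (i ⊕ b)) ⊗ (b ⊗ (d ⊗ d))
          ≐ ((i ⊗ d ⊕ ncon 1 ⊗ (b ⊗ d)) ⊗ (i ⊗ d ⊕ ncon 1 ⊗ (b ⊗ d))) ⊗ b) refl i b d)
        (ℕ.*-monoˡ-< (b ℕ.* (d ℕ.* d)) step)

  √approx-close : ∀ {h} p q m n → 0ℚ ℚ.< h →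
    ℚ.∣ p ℚ.- q ∣ ℚ.< h ℚ.* h → + 1 ℚ./ suc n ℚ.< h →
    √approx p m ℚ.- √approx q n ℚ.< h ℚ.+ h
  √approx-close {h} p q m n 0<h p-q< δ<h = begin-strict
    r ℚ.- t                        <⟨ ℚ.+-monoˡ-< (ℚ.- t) r<s+h ⟩
    ((t ℚ.+ δ) ℚ.+ h) ℚ.- t        ≡⟨ solve 3 (λ t d h → ((t :+ d) :+ h) :- t := d :+ h) refl t δ h ⟩
    δ ℚ.+ h                        <⟨ ℚ.+-monoˡ-< h δ<h ⟩
    h ℚ.+ h                        ∎
    where
      open ℚ.≤-Reasoning
      r t δ s : ℚ
      r = √approx p m
      t = √approx q n
      δ = + 1 ℚ./ suc n
      s = t ℚ.+ δ

      0≤s : 0ℚ ℚ.≤ s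
      0≤s = ℚ.+-mono-≤ (√approx-nonNeg q n) (0≤/ 1 n)

      r<s+h : r ℚ.< s ℚ.+ h
      r<s+h = square-mono-< (ℚ.+-mono-≤ 0≤s (ℚ.<⇒≤ 0<h)) (begin-strict
        r ℚ.* r
          ≤⟨ √approx-lower p m ⟩
        ℚ.∣ p ∣
          ≤⟨ ∣p∣≤∣q∣+∣p-q∣ p q ⟩
        ℚ.∣ q ∣ ℚ.+ ℚ.∣ p ℚ.- q ∣
          <⟨ ℚ.+-mono-< (√approx-upper q n) p-q< ⟩
        s ℚ.* s ℚ.+ h ℚ.* h
          ≡⟨ sym (ℚ.+-identityʳ _) ⟩
        (s ℚ.* s ℚ.+ h ℚ.* h) ℚ.+ 0ℚ
          ≤⟨ ℚ.+-monoʳ-≤ (s ℚ.* s ℚ.+ h ℚ.* h)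
               (ℚ.+-mono-≤ (*-nonNeg 0≤s (ℚ.<⇒≤ 0<h)) (*-nonNeg 0≤s (ℚ.<⇒≤ 0<h))) ⟩
        (s ℚ.* s ℚ.+ h ℚ.* h) ℚ.+ (s ℚ.* h ℚ.+ s ℚ.* h)
          ≡⟨ solve 2 (λ s h → (s :* s :+ h :* h) :+ (s :* h :+ s :* h) := (s :+ h) :* (s :+ h))
               refl s h ⟩
        (s ℚ.+ h) ℚ.* (s ℚ.+ h) ∎)

  √-cauchy : ∀ x → IsCauchy (λ n → √approx (seq x n) n)
  √-cauchy x ε 0<ε
    with cauchy x (ε ℚ.* ½ ℚ.* (ε ℚ.* ½)) (*-pos (half-pos 0<ε) (half-pos 0<ε))
       | /-archimedean 1 (half-pos 0<ε)
  ... | M , p | N , q = M ℕ.⊔ N , λ m n le le′ → ∣∣-<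
    (close m n le le′)
    (subst (ℚ._< ε)
      (solve 2 (λ a b → b :- a := :- (a :- b)) refl
        (√approx (seq x m) m) (√approx (seq x n) n))
      (close n m le′ le))
    where
      close : ∀ m n → M ℕ.⊔ N ℕ.≤ m → M ℕ.⊔ N ℕ.≤ n →
        √approx (seq x m) m ℚ.- √approx (seq x n) n ℚ.< ε
      close m n le le′ = subst (√approx (seq x m) m ℚ.- √approx (seq x n) n ℚ.<_) (halve ε)
        (√approx-close (seq x m) (seq x n) m n (half-pos 0<ε)
          (p m n (ℕ.≤-trans (ℕ.m≤m⊔n M N) le) (ℕ.≤-trans (ℕ.m≤m⊔n M N) le′))
          (q n (ℕ.≤-trans (ℕ.m≤n⊔m M N) le′)))

open Root

-- Defined as √∣x∣ so as to be total; only used for x ≥ 0.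
√ : ℝ → ℝ
seq (√ x) n = √approx (seq x n) n
cauchy (√ x) = √-cauchy x

-- Leibniz's series 4 (1 - 1/3 + 1/5 - 1/7 + ⋯) with consecutive terms
-- paired: 4 (1/(4j+1) - 1/(4j+3)) = 8/((4j+1)(4j+3)).
πterm : ℕ → ℚ
πterm j = + 8 ℚ./ (suc (4 ℕ.* j) ℕ.* suc (2 ℕ.+ 4 ℕ.* j))

πsum : ℕ → ℚ
πsum zero    = 0ℚ
πsum (suc n) = πsum n ℚ.+ πterm n

module Pi where
  open ℚSolver.+-*-Solver using (solve; _:+_; _:*_; _:-_; :-_; _:=_; con)
  open ℕSolver.+-*-Solver using ()
    renaming (solve to nsolve; _:+_ to _⊕_; _:*_ to _⊗_; _:=_ to _≐_; con to ncon)
  open ℚ.≤-Reasoning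

  tail : ℕ → ℚ
  tail n = + 6 ℚ./ suc n

  0≤πterm : ∀ n → 0ℚ ℚ.≤ πterm n
  0≤πterm n = 0≤/ 8 ((2 ℕ.+ 4 ℕ.* n) ℕ.+ (4 ℕ.* n) ℕ.* suc (2 ℕ.+ 4 ℕ.* n))

  πterm+tail : ∀ j → πterm j ℚ.+ tail (suc j) ℚ.≤ tail j
  πterm+tail j = subst (ℚ._≤ tail j) (sym (/-homo-+ 8 m-1 6 (suc j)))
    (/-mono-≤ (8 ℕ.* suc (suc j) ℕ.+ 6 ℕ.* suc m-1) (suc j ℕ.+ m-1 ℕ.* suc (suc j)) 6 j
      (ℕ.≤-trans (ℕ.m≤m+n _ (88 ℕ.* (j ℕ.* j) ℕ.+ 72 ℕ.* j ℕ.+ 2)) (ℕ.≤-reflexive (identity j))))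
    where
      m-1 : ℕ
      m-1 = (2 ℕ.+ 4 ℕ.* j) ℕ.+ (4 ℕ.* j) ℕ.* suc (2 ℕ.+ 4 ℕ.* j)

      identity : ∀ j → let m = suc (4 ℕ.* j) ℕ.* suc (2 ℕ.+ 4 ℕ.* j) in
        (8 ℕ.* suc (suc j) ℕ.+ 6 ℕ.* m) ℕ.* suc j ℕ.+ (88 ℕ.* (j ℕ.* j) ℕ.+ 72 ℕ.* j ℕ.+ 2)
          ≡ 6 ℕ.* (m ℕ.* suc (suc j))
      identity = nsolve 1 (λ j →
        let m = (ncon 1 ⊕ ncon 4 ⊗ j) ⊗ (ncon 1 ⊕ (ncon 2 ⊕ ncon 4 ⊗ j)) in
        (ncon 8 ⊗ (ncon 2 ⊕ j) ⊕ ncon 6 ⊗ m) ⊗ (ncon 1 ⊕ j)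
          ⊕ (ncon 88 ⊗ (j ⊗ j) ⊕ ncon 72 ⊗ j ⊕ ncon 2)
        ≐ ncon 6 ⊗ (m ⊗ (ncon 2 ⊕ j))) refl

  πsum-mono : ∀ n k → πsum n ℚ.≤ πsum (k ℕ.+ n)
  πsum-mono n zero    = ℚ.≤-refl
  πsum-mono n (suc k) = ℚ.≤-trans (πsum-mono n k)
    (subst (ℚ._≤ πsum (k ℕ.+ n) ℚ.+ πterm (k ℕ.+ n)) (ℚ.+-identityʳ (πsum (k ℕ.+ n)))
      (ℚ.+-monoʳ-≤ (πsum (k ℕ.+ n)) (0≤πterm (k ℕ.+ n))))

  πsum+tail : ∀ n k → πsum (k ℕ.+ n) ℚ.+ tail (k ℕ.+ n) ℚ.≤ πsum n ℚ.+ tail n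
  πsum+tail n zero    = ℚ.≤-refl
  πsum+tail n (suc k) = ℚ.≤-trans
    (subst (ℚ._≤ πsum (k ℕ.+ n) ℚ.+ tail (k ℕ.+ n))
      (sym (ℚ.+-assoc (πsum (k ℕ.+ n)) (πterm (k ℕ.+ n)) (tail (suc k ℕ.+ n))))
      (ℚ.+-monoʳ-≤ (πsum (k ℕ.+ n)) (πterm+tail (k ℕ.+ n))))
    (πsum+tail n k)

  πsum-close : ∀ n k → ℚ.∣ πsum (k ℕ.+ n) ℚ.- πsum n ∣ ℚ.≤ tail n
  πsum-close n k = begin
    ℚ.∣ πsum (k ℕ.+ n) ℚ.- πsum n ∣
      ≡⟨ ℚ.0≤p⇒∣p∣≡p (p≤q⇒0≤q-p (πsum-mono n k)) ⟩
    πsum (k ℕ.+ n) ℚ.- πsum n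
      ≤⟨ ℚ.+-monoˡ-≤ (ℚ.- πsum n) (begin
           πsum (k ℕ.+ n)
             ≡⟨ sym (ℚ.+-identityʳ (πsum (k ℕ.+ n))) ⟩
           πsum (k ℕ.+ n) ℚ.+ 0ℚ
             ≤⟨ ℚ.+-monoʳ-≤ (πsum (k ℕ.+ n)) (0≤/ 6 (k ℕ.+ n)) ⟩
           πsum (k ℕ.+ n) ℚ.+ tail (k ℕ.+ n)
             ≤⟨ πsum+tail n k ⟩
           πsum n ℚ.+ tail n ∎) ⟩
    (πsum n ℚ.+ tail n) ℚ.- πsum n
      ≡⟨ solve 2 (λ a b → (a :+ b) :- a := b) refl (πsum n) (tail n) ⟩
    tail n ∎

  πsum-cauchy : IsCauchy πsum
  πsum-cauchy ε 0<ε with /-archimedean 6 0<ε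
  ... | N , p = N , close
    where
      ordered : ∀ m n → N ℕ.≤ n → n ℕ.≤ m → ℚ.∣ πsum m ℚ.- πsum n ∣ ℚ.< ε
      ordered m n N≤n n≤m = ℚ.≤-<-trans
        (subst (λ k → ℚ.∣ πsum k ℚ.- πsum n ∣ ℚ.≤ tail n) (ℕ.m∸n+n≡m n≤m) (πsum-close n (m ℕ.∸ n)))
        (p n N≤n)

      close : ∀ m n → N ℕ.≤ m → N ℕ.≤ n → ℚ.∣ πsum m ℚ.- πsum n ∣ ℚ.< ε
      close m n N≤m N≤n with ℕ.≤-total n m
      ... | inj₁ n≤m = ordered m n N≤n n≤m
      ... | inj₂ m≤n = subst (ℚ._< ε) (∣p-q∣≡∣q-p∣ (πsum n) (πsum m)) (ordered n m N≤m m≤n)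

open Pi

π : ℝ
seq π = πsum
cauchy π = πsum-cauchy

∑< : ℕ → (ℕ → ℝ) → ℝ
∑< zero    f = 0ℝ
∑< (suc n) f = ∑< n f + f n

HasSum : (ℕ → ℝ) → ℝ → Set
HasSum f s = ∀ ε → 0ℝ < ε → Eventually λ n → ∣ ∑< n f - s ∣ < ε

-- D is the domain of f; a need not belong to it.
HasLimit : (D : ℝ → Set) → (∀ x → D x → ℝ) → ℝ → ℝ → Set
HasLimit D f a l = ∀ ε → 0ℝ < ε → ∃ λ δ → 0ℝ < δ ×
  (∀ x (x∈D : D x) → ∣ x - a ∣ < δ → ∣ f x x∈D - l ∣ < ε)

module Positivity where
  open ℚSolver.+-*-Solver using (solve; _:+_; _:*_; _:-_; :-_; _:=_; con)
  open ℚ.≤-Reasoning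

  lower : ∀ x → 0ℝ < x → ∃ λ ε → 0ℚ ℚ.< ε × Eventually λ n → ε ℚ.≤ seq x n
  lower x (mk< ε 0<ε (N , p)) =
    ε , 0<ε , N , λ n le → subst (ε ℚ.≤_) (ℚ.+-identityʳ (seq x n)) (p n le)

  fromLower : ∀ x ε → 0ℚ ℚ.< ε → Eventually (λ n → ε ℚ.≤ seq x n) → 0ℝ < x
  fromLower x ε 0<ε (N , p) =
    mk< ε 0<ε (N , λ n le → subst (ε ℚ.≤_) (sym (ℚ.+-identityʳ (seq x n))) (p n le))

  0<fromℚ : ∀ {q} → 0ℚ ℚ.< q → 0ℝ < fromℚ q
  0<fromℚ {q} 0<q = fromLower (fromℚ q) q 0<q (0 , λ _ _ → ℚ.≤-refl)

  0<fromℕ : ∀ n → 0ℝ < fromℕ (suc n)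
  0<fromℕ n = 0<fromℚ (/-mono-< 0 0 (suc n) 0 (ℕ.s≤s ℕ.z≤n))

  0<+ : ∀ {x y} → 0ℝ < x → 0ℝ < y → 0ℝ < x + y
  0<+ {x} {y} 0<x 0<y =
    let ε , 0<ε , p = lower x 0<x
        δ , 0<δ , q = lower y 0<y
        N , r = both p q
    in fromLower (x + y) (ε ℚ.+ δ) (ℚ.+-mono-< 0<ε 0<δ)
         (N , λ n le → ℚ.+-mono-≤ (proj₁ (r n le)) (proj₂ (r n le)))

  0<* : ∀ {x y} → 0ℝ < x → 0ℝ < y → 0ℝ < x * y
  0<* {x} {y} 0<x 0<y =
    let ε , 0<ε , p = lower x 0<x
        δ , 0<δ , q = lower y 0<y
        N , r = both p q
    in fromLower (x * y) (ε ℚ.* δ) (*-pos 0<ε 0<δ)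
         (N , λ n le → *-mono (ℚ.<⇒≤ 0<δ) (ℚ.≤-trans (ℚ.<⇒≤ 0<ε) (proj₁ (r n le)))
            (proj₁ (r n le)) (proj₂ (r n le)))

  0<^ : ∀ {x} n → 0ℝ < x → 0ℝ < x ^ n
  0<^ zero    0<x = 0<fromℚ (ℚ.positive⁻¹ 1ℚ)
  0<^ (suc n) 0<x = 0<* 0<x (0<^ n 0<x)

  pos⇒#0 : ∀ {x} → 0ℝ < x → x # 0ℝ
  pos⇒#0 = inj₂

  neg-pos : ∀ x → x < 0ℝ → 0ℝ < - x
  neg-pos x (mk< ε 0<ε (N , p)) = fromLower (- x) ε 0<ε
    (N , λ n le → subst (ε ℚ.≤_) (ℚ.+-identityˡ (ℚ.- seq x n)) (p n le))

  neg-* : ∀ {x y} → x < 0ℝ → 0ℝ < y → x * y < 0ℝ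
  neg-* {x} {y} x<0 0<y =
    let mk< ε 0<ε (N , p) = 0<* { - x} {y} (neg-pos x x<0) 0<y
    in mk< ε 0<ε (N , λ n le → subst (ε ℚ.≤_)
         (solve 2 (λ a b → (:- a) :* b :- con 0ℚ := con 0ℚ :- a :* b) refl (seq x n) (seq y n))
         (p n le))

  #-*-pos : ∀ {x y} → x # 0ℝ → 0ℝ < y → x * y # 0ℝ
  #-*-pos (inj₁ x<0) 0<y = inj₁ (neg-* x<0 0<y)
  #-*-pos (inj₂ 0<x) 0<y = inj₂ (0<* 0<x 0<y)

  0<π : 0ℝ < π
  0<π = fromLower π (πsum 1) (ℚ.positive⁻¹ (πsum 1)) (1 , λ n 1≤n →
    subst (λ m → πsum 1 ℚ.≤ πsum m) (ℕ.m∸n+n≡m 1≤n) (πsum-mono 1 (n ℕ.∸ 1)))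

open Positivity

⅓ : ℝ
⅓ = fromℚ (+ 1 ℚ./ 3)

module Denominators (k : ℝ) where
  open ℚSolver.+-*-Solver using (solve; _:*_; _:-_; _:=_; con)

  module _ (0<k : 0ℝ < k) where
    0<1+k : 0ℝ < fromℕ 1 + k
    0<1+k = 0<+ (0<fromℕ 0) 0<k

    0<1+3k : 0ℝ < fromℕ 1 + fromℕ 3 * k
    0<1+3k = 0<+ (0<fromℕ 0) (0<* (0<fromℕ 2) 0<k)

    0<1+3k² : 0ℝ < fromℕ 1 + fromℕ 3 * k ^ 2
    0<1+3k² = 0<+ (0<fromℕ 0) (0<* (0<fromℕ 2) (0<^ 2 0<k))

  3ℚ : ℚ
  3ℚ = + 3 ℚ./ 1

  1-3k#0 : k # ⅓ → fromℕ 1 - fromℕ 3 * k # 0ℝ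
  1-3k#0 (inj₁ (mk< ε 0<ε (N , p))) =
    inj₂ (mk< (3ℚ ℚ.* ε) (*-pos (ℚ.positive⁻¹ 3ℚ) 0<ε) (N , λ n le →
      subst (3ℚ ℚ.* ε ℚ.≤_)
        (solve 1 (λ x → con 3ℚ :* (con (+ 1 ℚ./ 3) :- x) := (con 1ℚ :- con 3ℚ :* x) :- con 0ℚ)
          refl (seq k n))
        (ℚ.*-monoˡ-≤-nonNeg 3ℚ (p n le))))
  1-3k#0 (inj₂ (mk< ε 0<ε (N , p))) =
    inj₁ (mk< (3ℚ ℚ.* ε) (*-pos (ℚ.positive⁻¹ 3ℚ) 0<ε) (N , λ n le →
      subst (3ℚ ℚ.* ε ℚ.≤_)
        (solve 1 (λ x → con 3ℚ :* (x :- con (+ 1 ℚ./ 3)) := con 0ℚ :- (con 1ℚ :- con 3ℚ :* x))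
          refl (seq k n))
        (ℚ.*-monoˡ-≤-nonNeg 3ℚ (p n le))))

open Denominators

open import Agda.Builtin.FromNat using (Number; fromNat)
import Data.Nat.Literals as ℕLiterals

instance
  number-ℕ : Number ℕ
  number-ℕ = ℕLiterals.number

  number-ℝ : Number ℝ
  number-ℝ = record { Constraint = λ _ → ⊤ ; fromNat = λ n → fromℕ n }

poch : ℚ → ℕ → ℚ
poch a zero    = 1ℚ
poch a (suc n) = poch a n ℚ.* (a ℚ.+ + n ℚ./ 1)

1/!² : ℕ → ℚ
1/!² n = ℚ._/_ (+ 1) (n ! ℕ.* n !) {{ℕ.m*n≢0 (n !) (n !) {{n ℕ.!≢0}} {{n ℕ.!≢0}}}}

-- ₂F₁(-n, n+1; 1; (1-x)/2): its terms vanish from index n+1 on, and the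
-- denominator (1)ⱼ j! of the j-th term is j!².
legendre : ℕ → ℝ → ℝ
legendre n x = ∑< (suc n) λ j →
  fromℚ (poch (ℚ.- (+ n ℚ./ 1)) j ℚ.* poch (+ suc n ℚ./ 1) j ℚ.* 1/!² j)
    * ((1 - x) * fromℚ ½) ^ j

_^[5/2] : ℝ → ℝ
x ^[5/2] = √ (x ^ 5)

argument : (k : ℝ) → 0ℝ < k → k # ⅓ → ℝ
argument k 0<k k#⅓ =
  ((1 + k) * (1 - 4 * k + 7 * k ^ 2)) / ((1 - 3 * k) * (1 + 3 * k ^ 2))
    [ #-*-pos (1-3k#0 k k#⅓) (0<1+3k² k 0<k) ]

base : (k : ℝ) → 0ℝ < k → ℝ
base k 0<k =
  ((1 + k) * (1 - 3 * k) * (1 + 3 * k ^ 2)) / ((1 + 3 * k) ^ 2)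
    [ pos⇒#0 (0<^ 2 (0<1+3k k 0<k)) ]

product : ℕ → (k : ℝ) → 0ℝ < k → k # ⅓ → ℝ
product n k 0<k k#⅓ = legendre n (argument k 0<k k#⅓) * base k 0<k ^ n

-- t is the product above if k # ⅓, and its limit at ⅓ if k ≈ ⅓.  Since _#_ is
-- tight, t is determined up to _≈_ even where the two cases cannot be decided.
IsProduct : ℕ → (k : ℝ) → 0ℝ < k → ℝ → Set
IsProduct n k 0<k t =
  (∀ (k#⅓ : k # ⅓) → t ≈ product n k 0<k k#⅓) ×
  (k ≈ ⅓ → HasLimit (λ h → 0ℝ < h × h < 1ℝ × h # ⅓)
                    (λ h (0<h , _ , h#⅓) → product n h 0<h h#⅓) ⅓ t)

coefficient : ℕ → ℝ
coefficient n = fromℚ (poch (+ 1 ℚ./ 4) n ℚ.* poch (+ 3 ℚ./ 4) n ℚ.* 1/!² n)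

C₃ : (k : ℝ) → 0ℝ < k → ℝ
C₃ k 0<k =
  (16 * (k - 1) ^ 2 * k ^ 2) / ((1 + k) ^ 2) [ pos⇒#0 (0<^ 2 (0<1+k k 0<k)) ]
    * (8 + 15 * k + 9 * k ^ 2) ^ 2

C₂ C₁ C₀ : ℝ → ℝ
C₂ k = 48 * (k - 1) * k * (8 - 15 * k + 27 * k ^ 2 + 27 * k ^ 3 + 81 * k ^ 4)
C₁ k = (4 - 33 * k + 45 * k ^ 2) * (4 - 17 * k + 17 * k ^ 2 - 3 * k ^ 3 + 63 * k ^ 4)
C₀ k = 3 * (1 - 3 * k) ^ 4 * (1 + k + 2 * k ^ 2)

value : (k : ℝ) → 0ℝ < k → ℝ
value k 0<k =
  (3 * √ 2 * (1 + 3 * k) ^[5/2] * (1 + 3 * k ^ 2)) / ((1 + k) * π)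
    [ pos⇒#0 (0<* (0<1+k k 0<k) 0<π) ]

-- Put q = k(1 - k)/(1 + 3k) and θ = (1 + k)/√(1 + 3k), so that q = 1 - θ².  For the
-- argument x and the base z, both xz = (1 - q)(1 - 7q) =: σ and z² =
-- (1 - 9q)(1 - q)(1 - 3q)² are polynomials in q, hence so is pₙ = Pₙ(x) zⁿ, also at k = ⅓.
-- With cₙ = (1/4)ₙ(3/4)ₙ/n!², telescoping in n turns the cubic sum into
-- 3 (1 + 3k)² (1 + 3k²) Ψ, where Ψ = Σ cₙ ((n(1 + 12q) + 3q) pₙ - n(1 - 9q)(1 - 3q) pₙ₋₁).
-- The θ-derivative of a partial sum of θΨ telescopes as well and leaves the single term
-- -16(2 - 3q) N² c_N p_{N-1}.  Since σᴺ ≤ p_N ≤ (1 - 4q)ᴺ, with p_N - σᴺ of third order in q,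
-- this is the derivative of -2N c_N θ σᴺ up to an error whose integral is O(1/N).
-- Everything vanishes at θ = 1, so θΨ = lim 2N c_N by integration from there.
-- That limit is √2/π by Wallis' product, which a Wilf–Zeilberger pair ties to Leibniz's
-- series: Σⱼ F(l, j) does not depend on l, F(0, j) is the j-th (paired) term of the series,
-- and the term j = 0 dominates as l → ∞.

module Submission where

open import Agda.Builtin.FromNat using (Number; fromNat)
open import Data.Empty using (⊥-elim)
import Data.Integer.Base as ℤ
open import Data.List.Base using (_∷_; [])
open import Data.Maybe.Base using (Maybe; just; nothing)
open import Data.Nat.Base as ℕ using (ℕ; zero; suc; _!)
import Data.Nat.Properties as ℕ
open import Data.Product using (∃; _×_; _,_; proj₁; proj₂)
open import Data.Rational.Base as ℚ using (ℚ; 0ℚ; 1ℚ; ½)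
import Data.Rational.Properties as ℚ
open import Data.Sum using (inj₁; inj₂)
open import Data.Unit.Base using (⊤; tt)
open import Relation.Binary.Definitions using (tri<; tri≈; tri>)
open import Relation.Binary.PropositionalEquality
  using (_≡_; refl; sym; trans; cong; cong₂; subst; subst₂; module ≡-Reasoning)
open import Relation.Nullary using (yes; no)
open import Relation.Nullary.Decidable using (True; toWitness)
open import Tactic.RingSolver using (solve-∀; solve)
open import Tactic.RingSolver.Core.AlmostCommutativeRing
  using (AlmostCommutativeRing; fromCommutativeRing)
open import Defs using
  (number-ℕ; invℚ; poch; 1/!²; Eventually; πterm; πsum; module Rational; module Inversion; module Pi)

-- Reals are Cauchy sequences, and all analysis is done on their rational terms: the estimates are
-- explicit, uniform in q or θ, and valid at the rational approximants themselves. The index N can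
-- thus be chosen before the approximant. With θ as the variable, θΨ(1 - θ²) is a polynomial that is
-- differentiated symbolically, and the only calculus left is a mean value inequality for rational
-- polynomials.
--
-- Pₙ has the parity of n, so Pₙ(x) zⁿ is a combination of (xz)ⁿ⁻²ⁱ (z²)ⁱ. This removes the pole of
-- x and the sign change of z at k = 1/3. The map k ↦ q folds there: 1 - 9q = (1 - 3k)²/(1 + 3k), so
-- 0 < q ≤ 1/9 on both sides.
--
-- The single term left by the θ-derivative is not small: it is a bump of height about N and width
-- about 1/N at q = 0, and its mass gives the constant √2/π. Comparison with an exact derivative
-- captures this mass; the rest is at most a multiple of θ²ᴺ, and only its rate matters.

-- Ordered-field arithmetic over ℚ, powers and finite sums.

module RationalArithmetic where

  open import Data.Rational.Base using (_+_; _*_; _-_; -_; _≤_; _<_; ∣_∣)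
  open Rational using (/-mono-<; /-homo-+; /-homo-*; 0≤/; *-nonNeg; *-pos; *-mono)

  ring : AlmostCommutativeRing _ _
  ring = fromCommutativeRing ℚ.+-*-commutativeRing 0≟
    where
    0≟ : ∀ x → Maybe (0ℚ ≡ x)
    0≟ x with 0ℚ ℚ.≟ x
    ... | yes 0≡x = just 0≡x
    ... | no _    = nothing

  instance
    number-ℚ : Number ℚ
    number-ℚ = record { Constraint = λ _ → ⊤ ; fromNat = λ n → ℤ.+ n ℚ./ 1 }

  ι : ℕ → ℚ
  ι n = ℤ.+ n ℚ./ 1

  ι-suc : ∀ n → ι (suc n) ≡ ι n + 1
  ι-suc n = sym (trans (/-homo-+ n 0 1 0)
    (cong ι (trans (cong (ℕ._+ 1) (ℕ.*-identityʳ n)) (ℕ.+-comm n 1))))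

  ι-+ : ∀ m n → ι (m ℕ.+ n) ≡ ι m + ι n
  ι-+ m n = sym (trans (/-homo-+ m 0 n 0)
    (cong ι (cong₂ ℕ._+_ (ℕ.*-identityʳ m) (ℕ.*-identityʳ n))))

  ι-* : ∀ m n → ι (m ℕ.* n) ≡ ι m * ι n
  ι-* m n = sym (/-homo-* m 0 n 0)

  /-ι : ∀ a n → ι (suc n) * (ℤ.+ a ℚ./ suc n) ≡ ι a
  /-ι a n = trans (/-homo-* (suc n) 0 a n) (ℚ.≤-antisym
    (Rational./-mono-≤ (suc n ℕ.* a) (n ℕ.+ 0) a 0 (ℕ.≤-reflexive eq))
    (Rational./-mono-≤ a 0 (suc n ℕ.* a) (n ℕ.+ 0) (ℕ.≤-reflexive (sym eq))))
    where
    eq : suc n ℕ.* a ℕ.* 1 ≡ a ℕ.* suc (n ℕ.+ 0)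
    eq = trans (ℕ.*-identityʳ (suc n ℕ.* a)) (trans (ℕ.*-comm (suc n) a)
      (cong (λ m → a ℕ.* suc m) (sym (ℕ.+-identityʳ n))))

  0≤ι : ∀ n → 0 ≤ ι n
  0≤ι n = 0≤/ n 0

  0<ι-suc : ∀ n → 0 < ι (suc n)
  0<ι-suc n = /-mono-< 0 0 (suc n) 0 (ℕ.s≤s ℕ.z≤n)

  0<ι : ∀ n {{_ : ℕ.NonZero n}} → 0 < ι n
  0<ι (suc n) = 0<ι-suc n

  ι-mono : ∀ {m n} → m ℕ.≤ n → ι m ≤ ι n
  ι-mono {m} {n} m≤n = Rational./-mono-≤ m 0 n 0 (ℕ.*-monoˡ-≤ 1 m≤n)

  lit< : ∀ {p q} {p<q : True (p ℚ.<? q)} → p < q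
  lit< {p<q = p<q} = toWitness p<q

  lit≤ : ∀ {p q} {p≤q : True (p ℚ.≤? q)} → p ≤ q
  lit≤ {p≤q = p≤q} = toWitness p≤q

  infixl 6 _⊹_
  _⊹_ : ∀ {p q} → 0 ≤ p → 0 ≤ q → 0 ≤ p + q
  _⊹_ = ℚ.+-mono-≤

  infixl 7 _⊛_
  _⊛_ : ∀ {p q} → 0 ≤ p → 0 ≤ q → 0 ≤ p * q
  _⊛_ = *-nonNeg

  +-pos-nonNeg : ∀ {p q} → 0 < p → 0 ≤ q → 0 < p + q
  +-pos-nonNeg = ℚ.+-mono-<-≤

  -- Inequalities are certified: `e` is the difference rewritten so that its sign is visible, the
  -- ring solver checks the identity (possibly modulo hypotheses), and the proof of `0 ≤ e` repeats
  -- the shape of `e` with `_⊹_` and `_⊛_` in place of sum and product.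
  ≤-by : ∀ {x y} e → 0 ≤ e → y - x ≡ e → x ≤ y
  ≤-by {x} {y} e 0≤e eq =
    subst₂ _≤_ (ℚ.+-identityˡ x) (trans (cong (_+ x) (sym eq)) (lemma x y)) (ℚ.+-monoˡ-≤ x 0≤e)
    where
    lemma : ∀ x y → (y - x) + x ≡ y
    lemma = solve-∀ ring

  <-by : ∀ {x y} e → 0 < e → y - x ≡ e → x < y
  <-by {x} {y} e 0<e eq =
    subst₂ _<_ (ℚ.+-identityˡ x) (trans (cong (_+ x) (sym eq)) (lemma x y)) (ℚ.+-monoˡ-< x 0<e)
    where
    lemma : ∀ x y → (y - x) + x ≡ y
    lemma = solve-∀ ring

  0≤-diff : ∀ {x y} → x ≤ y → 0 ≤ y - x
  0≤-diff = Rational.p≤q⇒0≤q-p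

  0<-diff : ∀ {x y} → x < y → 0 < y - x
  0<-diff {x} {y} x<y = subst (_< y - x) (ℚ.+-inverseʳ x) (ℚ.+-monoˡ-< (- x) x<y)

  -‿0⇒≡ : ∀ {x y} → x - y ≡ 0 → x ≡ y
  -‿0⇒≡ {x} {y} eq = trans (lemma x y) (trans (cong (_+ y) eq) (ℚ.+-identityˡ y))
    where
    lemma : ∀ x y → x ≡ (x - y) + y
    lemma = solve-∀ ring

  *-cancel-pos : ∀ a {x y} → 0 < a → a * x ≡ a * y → x ≡ y
  *-cancel-pos a 0<a eq = ℚ.≤-antisym (cancel (ℚ.≤-reflexive eq)) (cancel (ℚ.≤-reflexive (sym eq)))
    where
    cancel : ∀ {x y} → a * x ≤ a * y → x ≤ y
    cancel = ℚ.*-cancelˡ-≤-pos a {{ℚ.positive 0<a}}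

  *-cancel-≤ : ∀ a {x y} → 0 < a → a * x ≤ a * y → x ≤ y
  *-cancel-≤ a 0<a = ℚ.*-cancelˡ-≤-pos a {{ℚ.positive 0<a}}

  *-monoˡ : ∀ a {x y} → 0 ≤ a → x ≤ y → a * x ≤ a * y
  *-monoˡ a 0≤a = ℚ.*-monoˡ-≤-nonNeg a {{ℚ.nonNegative 0≤a}}

  *-monoʳ : ∀ a {x y} → 0 ≤ a → x ≤ y → x * a ≤ y * a
  *-monoʳ a 0≤a = ℚ.*-monoʳ-≤-nonNeg a {{ℚ.nonNegative 0≤a}}

  -- Equations enter as combinations of hypotheses l ≡ r, so that a single
  -- ring identity remains.
  vanishes : ∀ {l r} a → l ≡ r → a * (l - r) ≡ 0
  vanishes {r = r} a refl = trans (cong (a *_) (ℚ.+-inverseʳ r)) (ℚ.*-zeroʳ a)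

  by-1 : ∀ {x y l r} a → l ≡ r → x - y ≡ a * (l - r) → x ≡ y
  by-1 a h eq = -‿0⇒≡ (trans eq (vanishes a h))

  by-2 : ∀ {x y l₁ r₁ l₂ r₂} a b → l₁ ≡ r₁ → l₂ ≡ r₂ → x - y ≡ a * (l₁ - r₁) + b * (l₂ - r₂) → x ≡ y
  by-2 a b h₁ h₂ eq = -‿0⇒≡ (trans eq (cong₂ _+_ (vanishes a h₁) (vanishes b h₂)))

  by-3 : ∀ {x y l₁ r₁ l₂ r₂ l₃ r₃} a b c → l₁ ≡ r₁ → l₂ ≡ r₂ → l₃ ≡ r₃ →
    x - y ≡ a * (l₁ - r₁) + b * (l₂ - r₂) + c * (l₃ - r₃) → x ≡ y
  by-3 a b c h₁ h₂ h₃ eq = -‿0⇒≡ (trans eq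
    (cong₂ _+_ (cong₂ _+_ (vanishes a h₁) (vanishes b h₂)) (vanishes c h₃)))

  by-4 : ∀ {x y l₁ r₁ l₂ r₂ l₃ r₃ l₄ r₄} a b c d → l₁ ≡ r₁ → l₂ ≡ r₂ → l₃ ≡ r₃ → l₄ ≡ r₄ →
    x - y ≡ a * (l₁ - r₁) + b * (l₂ - r₂) + c * (l₃ - r₃) + d * (l₄ - r₄) → x ≡ y
  by-4 a b c d h₁ h₂ h₃ h₄ eq = -‿0⇒≡ (trans eq
    (cong₂ _+_ (cong₂ _+_ (cong₂ _+_ (vanishes a h₁) (vanishes b h₂)) (vanishes c h₃)) (vanishes d h₄)))

  by-5 : ∀ {x y l₁ r₁ l₂ r₂ l₃ r₃ l₄ r₄ l₅ r₅} a b c d e →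
    l₁ ≡ r₁ → l₂ ≡ r₂ → l₃ ≡ r₃ → l₄ ≡ r₄ → l₅ ≡ r₅ →
    x - y ≡ a * (l₁ - r₁) + b * (l₂ - r₂) + c * (l₃ - r₃) + d * (l₄ - r₄) + e * (l₅ - r₅) → x ≡ y
  by-5 a b c d e h₁ h₂ h₃ h₄ h₅ eq = -‿0⇒≡ (trans eq (cong₂ _+_ (cong₂ _+_ (cong₂ _+_
    (cong₂ _+_ (vanishes a h₁) (vanishes b h₂)) (vanishes c h₃)) (vanishes d h₄)) (vanishes e h₅)))

  0≤-square : ∀ x → 0 ≤ x * x
  0≤-square x with ℚ.≤-total 0 x
  ... | inj₁ 0≤x = *-nonNeg 0≤x 0≤x
  ... | inj₂ x≤0 = subst (0 ≤_) (lemma x) (*-nonNeg (ℚ.neg-antimono-≤ x≤0) (ℚ.neg-antimono-≤ x≤0))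
    where
    lemma : ∀ x → (- x) * (- x) ≡ x * x
    lemma = solve-∀ ring

  square-cancel-≤ : ∀ {x y} → 0 ≤ y → x * x ≤ y * y → x ≤ y
  square-cancel-≤ {x} {y} 0≤y x²≤y² = ℚ.≮⇒≥ λ y<x → ℚ.<-irrefl refl (ℚ.<-≤-trans
    (<-by ((x - y) * (x + y))
      (*-pos (0<-diff y<x) (+-pos-nonNeg (ℚ.≤-<-trans 0≤y y<x) 0≤y)) (lemma x y)) x²≤y²)
    where
    lemma : ∀ x y → x * x - y * y ≡ (x - y) * (x + y)
    lemma = solve-∀ ring

  ∣∣-≤ : ∀ {x b} → x ≤ b → - x ≤ b → ∣ x ∣ ≤ b
  ∣∣-≤ {x} x≤b -x≤b with ℚ.∣p∣≡p∨∣p∣≡-p x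
  ... | inj₁ eq = subst (_≤ _) (sym eq) x≤b
  ... | inj₂ eq = subst (_≤ _) (sym eq) -x≤b

  ≤-∣∣ : ∀ {x b} → ∣ x ∣ ≤ b → x ≤ b
  ≤-∣∣ {x} = ℚ.≤-trans (Rational.p≤∣p∣ x)

  -≤-∣∣ : ∀ {x b} → ∣ x ∣ ≤ b → - x ≤ b
  -≤-∣∣ {x} ∣x∣≤b = ℚ.≤-trans (subst (- x ≤_) (ℚ.∣-p∣≡∣p∣ x) (Rational.p≤∣p∣ (- x))) ∣x∣≤b

  invℚ-pos : ∀ {x} → 0 < x → x * invℚ x ≡ 1
  invℚ-pos {x} 0<x = Inversion.invℚ-inverse x 0<x (Rational.p≤∣p∣ x)

  0<invℚ : ∀ {x} → 0 < x → 0 < invℚ x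
  0<invℚ {x} 0<x = ℚ.*-cancelˡ-<-nonNeg x {{ℚ.nonNegative (ℚ.<⇒≤ 0<x)}}
    (subst₂ _<_ (sym (ℚ.*-zeroʳ x)) (sym (invℚ-pos 0<x)) lit<)

  undivide : ∀ {d} a b → 0 < d → d * (a * (b * invℚ d)) ≡ b * a
  undivide {d} a b 0<d = by-1 (a * b) (invℚ-pos 0<d) (lemma d (invℚ d) a b)
    where
    lemma : ∀ d e a b → d * (a * (b * e)) - b * a ≡ a * b * (d * e - 1)
    lemma = solve-∀ ring

  nonNeg+pos : ∀ {p q} → 0 ≤ p → 0 < q → 0 < p + q
  nonNeg+pos = ℚ.+-mono-≤-<

  archimedean : ∀ x → ∃ λ N → x ≤ ι N
  archimedean x with ℚ.<-cmp 0 x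
  ... | tri< 0<x _ _ =
    let N , p = Rational./-archimedean 1 (0<invℚ 0<x)
    in suc N , *-cancel-≤ (invℚ x) (0<invℚ 0<x) (begin
      invℚ x * x  ≡⟨ ℚ.*-comm (invℚ x) x ⟩
      x * invℚ x  ≡⟨ invℚ-pos 0<x ⟩
      1  ≡⟨ sym (/-ι 1 N) ⟩
      ι (suc N) * (ℤ.+ 1 ℚ./ suc N)  ≡⟨ ℚ.*-comm (ι (suc N)) (ℤ.+ 1 ℚ./ suc N) ⟩
      (ℤ.+ 1 ℚ./ suc N) * ι (suc N)  ≤⟨ *-monoʳ (ι (suc N)) (0≤ι (suc N)) (ℚ.<⇒≤ (p N ℕ.≤-refl)) ⟩
      invℚ x * ι (suc N)  ∎)
    where
    open ℚ.≤-Reasoning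
  ... | tri≈ _ 0≡x _ = 0 , ℚ.≤-reflexive (sym 0≡x)
  ... | tri> _ _ x<0 = 0 , ℚ.<⇒≤ x<0

  infixr 8 _↑_
  _↑_ : ℚ → ℕ → ℚ
  x ↑ zero  = 1ℚ
  x ↑ suc n = x * x ↑ n

  ↑-nonNeg : ∀ {x} n → 0 ≤ x → 0 ≤ x ↑ n
  ↑-nonNeg zero    0≤x = lit≤
  ↑-nonNeg (suc n) 0≤x = *-nonNeg 0≤x (↑-nonNeg n 0≤x)

  ↑-mono : ∀ {x y} n → 0 ≤ x → x ≤ y → x ↑ n ≤ y ↑ n
  ↑-mono zero    0≤x x≤y = ℚ.≤-refl
  ↑-mono (suc n) 0≤x x≤y =
    *-mono (↑-nonNeg n 0≤x) (ℚ.≤-trans 0≤x x≤y) x≤y (↑-mono n 0≤x x≤y)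

  ↑-* : ∀ x y n → (x * y) ↑ n ≡ x ↑ n * y ↑ n
  ↑-* x y zero    = refl
  ↑-* x y (suc n) = trans (cong (x * y *_) (↑-* x y n)) (lemma x y (x ↑ n) (y ↑ n))
    where
    lemma : ∀ x y a b → x * y * (a * b) ≡ x * a * (y * b)
    lemma = solve-∀ ring

  ↑≤1 : ∀ {x} n → 0 ≤ x → x ≤ 1 → x ↑ n ≤ 1
  ↑≤1 {x} zero    0≤x x≤1 = ℚ.≤-refl
  ↑≤1 {x} (suc n) 0≤x x≤1 = *-mono (↑-nonNeg n 0≤x) lit≤ x≤1 (↑≤1 n 0≤x x≤1)

  -- The left side decreases in n from the value 1: consecutive values differ by (n + 1) x² (1 -
  -- x)ⁿ. In this division-free form it bounds n x (1 - x)ⁿ, which is how the decay of powers enters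
  -- below.
  bernoulli : ∀ x n → 0 ≤ x → x ≤ 1 → (1 + ι n * x) * (1 - x) ↑ n ≤ 1
  bernoulli x zero 0≤x x≤1 = ℚ.≤-reflexive (lemma x)
    where
    lemma : ∀ x → (1 + 0 * x) * 1 ≡ 1
    lemma = solve-∀ ring
  bernoulli x (suc n) 0≤x x≤1 = ℚ.≤-trans
    (≤-by ((ι n + 1) * x * x * (1 - x) ↑ n)
      ((0≤ι n ⊹ 0≤ι 1) ⊛ 0≤x ⊛ 0≤x ⊛ ↑-nonNeg n (0≤-diff x≤1))
      (trans (cong (λ m → (1 + ι n * x) * (1 - x) ↑ n - (1 + m * x) * ((1 - x) * (1 - x) ↑ n)) (ι-suc n))
        (lemma (ι n) x ((1 - x) ↑ n))))
    (bernoulli x n 0≤x x≤1)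
    where
    lemma : ∀ n x y → (1 + n * x) * y - (1 + (n + 1) * x) * ((1 - x) * y) ≡ (n + 1) * x * x * y
    lemma = solve-∀ ring

  ∑ : ℕ → (ℕ → ℚ) → ℚ
  ∑ zero    f = 0ℚ
  ∑ (suc n) f = ∑ n f + f n

  ∑-cong : ∀ n {f g : ℕ → ℚ} → (∀ i → f i ≡ g i) → ∑ n f ≡ ∑ n g
  ∑-cong zero    f≡g = refl
  ∑-cong (suc n) f≡g = cong₂ _+_ (∑-cong n f≡g) (f≡g n)

  ∑-telescope : ∀ n (f g : ℕ → ℚ) → (∀ i → f i ≡ g (suc i) - g i) → ∑ n f ≡ g n - g 0
  ∑-telescope zero    f g eq = sym (ℚ.+-inverseʳ (g 0))
  ∑-telescope (suc n) f g eq =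
    trans (cong₂ _+_ (∑-telescope n f g eq) (eq n)) (lemma (g n) (g 0) (g (suc n)))
    where
    lemma : ∀ a b c → (a - b) + (c - a) ≡ c - b
    lemma = solve-∀ ring

  ∑-+ : ∀ n (f g : ℕ → ℚ) → ∑ n (λ i → f i + g i) ≡ ∑ n f + ∑ n g
  ∑-+ zero    f g = refl
  ∑-+ (suc n) f g = trans (cong (_+ (f n + g n)) (∑-+ n f g)) (lemma (∑ n f) (∑ n g) (f n) (g n))
    where
    lemma : ∀ a b c d → (a + b) + (c + d) ≡ (a + c) + (b + d)
    lemma = solve-∀ ring

-- Wallis' product from Leibniz's series by a Wilf-Zeilberger pair.

module Wallis where

  open import Data.Rational.Base using (_+_; _*_; _-_; -_; _≤_; _<_; ∣_∣)
  open Rational using (*-nonNeg; *-pos)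
  open RationalArithmetic

  -- w n = (1/2)ₙ / n!
  w : ℕ → ℚ
  w zero    = 1
  w (suc n) = w n * ((2 * ι n + 1) * invℚ (2 * ι n + 2))

  0≤2ι : ∀ n → 0 ≤ 2 * ι n
  0≤2ι n = 0≤ι 2 ⊛ 0≤ι n

  w-suc : ∀ n → (2 * ι n + 2) * w (suc n) ≡ (2 * ι n + 1) * w n
  w-suc n = undivide (w n) (2 * ι n + 1) (nonNeg+pos (0≤2ι n) lit<)

  0<w : ∀ n → 0 < w n
  0<w zero    = lit<
  0<w (suc n) = *-pos (0<w n) (*-pos (nonNeg+pos (0≤2ι n) lit<)
    (0<invℚ (nonNeg+pos (0≤2ι n) lit<)))

  -- Wallis' bracketing of 2/π: `a` increases and `b` decreases to it, and they differ by w².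
  a b : ℕ → ℚ
  a n = 2 * ι n * (w n * w n)
  b n = (2 * ι n + 1) * (w n * w n)

  a≤a-suc : ∀ n → a n ≤ a (suc n)
  a≤a-suc n = *-cancel-≤ (2 * ι n + 2) (nonNeg+pos (0≤2ι n) lit<)
    (≤-by (w n * w n) (0≤-square (w n)) (trans
      (cong (λ m → (2 * ι n + 2) * (2 * m * (w (suc n) * w (suc n))) - (2 * ι n + 2) * a n) (ι-suc n))
      (core (ι n) (w n) (w (suc n)) (w-suc n))))
    where
    core : ∀ n u v → (2 * n + 2) * v ≡ (2 * n + 1) * u →
      (2 * n + 2) * (2 * (n + 1) * (v * v)) - (2 * n + 2) * (2 * n * (u * u)) ≡ u * u
    core n u v h = by-1 ((2 * n + 2) * v + (2 * n + 1) * u) h (solve (n ∷ u ∷ v ∷ []) ring)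

  b-suc≤b : ∀ n → b (suc n) ≤ b n
  b-suc≤b n = *-cancel-≤ ((2 * ι n + 2) * (2 * ι n + 2))
    (*-pos (nonNeg+pos (0≤2ι n) lit<) (nonNeg+pos (0≤2ι n) lit<))
    (≤-by ((2 * ι n + 1) * (w n * w n)) ((0≤2ι n ⊹ 0≤ι 1) ⊛ 0≤-square (w n)) (trans
      (cong (λ m → (2 * ι n + 2) * (2 * ι n + 2) * b n
                   - (2 * ι n + 2) * (2 * ι n + 2) * ((2 * m + 1) * (w (suc n) * w (suc n)))) (ι-suc n))
      (core (ι n) (w n) (w (suc n)) (w-suc n))))
    where
    core : ∀ n u v → (2 * n + 2) * v ≡ (2 * n + 1) * u →
      (2 * n + 2) * (2 * n + 2) * ((2 * n + 1) * (u * u))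
        - (2 * n + 2) * (2 * n + 2) * ((2 * (n + 1) + 1) * (v * v)) ≡ (2 * n + 1) * (u * u)
    core n u v h = by-1 (- ((2 * n + 3) * ((2 * n + 2) * v + (2 * n + 1) * u))) h (solve (n ∷ u ∷ v ∷ []) ring)

  a-mono : ∀ k n → a n ≤ a (k ℕ.+ n)
  a-mono zero    n = ℚ.≤-refl
  a-mono (suc k) n = ℚ.≤-trans (a-mono k n) (a≤a-suc (k ℕ.+ n))

  b-anti : ∀ k n → b (k ℕ.+ n) ≤ b n
  b-anti zero    n = ℚ.≤-refl
  b-anti (suc k) n = ℚ.≤-trans (b-suc≤b (k ℕ.+ n)) (b-anti k n)

  a≤1 : ∀ n → a n ≤ 1
  a≤1 n = ℚ.≤-trans (≤-by (w n * w n) (0≤-square (w n)) (lemma (ι n) (w n)))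
    (subst (λ m → b m ≤ 1) (ℕ.+-identityʳ n) (b-anti n 0))
    where
    lemma : ∀ n w → (2 * n + 1) * (w * w) - 2 * n * (w * w) ≡ w * w
    lemma = solve-∀ ring

  -- The column j = 0 of `F`: a quotient of Gamma values, given by its ratio in l, that tends to π.
  V : ℕ → ℚ
  V zero    = ℤ.+ 8 ℚ./ 3
  V (suc l) = V l * ((256 * (ι l + 1) * (ι l + 1) * (4 * ι l + 3) * (4 * ι l + 5))
    * invℚ ((8 * ι l + 5) * (8 * ι l + 7) * (8 * ι l + 9) * (8 * ι l + 11)))

  -- A hypergeometric term whose sum over j is π for every l. It interpolates between Leibniz's
  -- series at l = 0 and a sum concentrated on j = 0 for large l. Only its first column and its
  -- ratio in j are built in.
  F : ℕ → ℕ → ℚ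
  F l zero    = V l
  F l (suc j) = F l j * (((1 + 2 * ι l + ι j) * (4 * ι j + 1) * (4 * ι j + 3))
    * invℚ ((ι j + 1) * (8 * ι l + 4 * ι j + 5) * (8 * ι l + 4 * ι j + 7)))

  0<k·ι+c : ∀ k c n {k≥0 : True (0 ℚ.≤? k)} {c>0 : True (0 ℚ.<? c)} → 0 < k * ι n + c
  0<k·ι+c k c n {k≥0} {c>0} = nonNeg+pos (*-nonNeg (toWitness k≥0) (0≤ι n)) (toWitness c>0)

  0<8l+4j+ : ∀ c l j {c>0 : True (0 ℚ.<? c)} → 0 < 8 * ι l + 4 * ι j + c
  0<8l+4j+ c l j {c>0} = nonNeg+pos
    (0≤ι 8 ⊛ 0≤ι l ⊹ 0≤ι 4 ⊛ 0≤ι j) (toWitness c>0)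

  0<V-denominator : ∀ l → 0 < (8 * ι l + 5) * (8 * ι l + 7) * (8 * ι l + 9) * (8 * ι l + 11)
  0<V-denominator l = *-pos (*-pos (*-pos (0<k·ι+c 8 5 l) (0<k·ι+c 8 7 l)) (0<k·ι+c 8 9 l)) (0<k·ι+c 8 11 l)

  0<F-denominator : ∀ l j → 0 < (ι j + 1) * (8 * ι l + 4 * ι j + 5) * (8 * ι l + 4 * ι j + 7)
  0<F-denominator l j = *-pos (*-pos (nonNeg+pos (0≤ι j) lit<) (0<8l+4j+ 5 l j)) (0<8l+4j+ 7 l j)

  0<V : ∀ l → 0 < V l
  0<V zero    = lit<
  0<V (suc l) = *-pos (0<V l) (*-pos
    (*-pos (*-pos (*-pos (*-pos (0<ι 256) 0<l+1) 0<l+1) (0<k·ι+c 4 3 l)) (0<k·ι+c 4 5 l))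
    (0<invℚ (0<V-denominator l)))
    where
    0<l+1 : 0 < ι l + 1
    0<l+1 = nonNeg+pos (0≤ι l) lit<

  0<F : ∀ l j → 0 < F l j
  0<F l zero    = 0<V l
  0<F l (suc j) = *-pos (0<F l j) (*-pos
    (*-pos (*-pos (+-pos-nonNeg (+-pos-nonNeg (0<ι 1) (0≤2ι l)) (0≤ι j)) (0<k·ι+c 4 1 j)) (0<k·ι+c 4 3 j))
    (0<invℚ (0<F-denominator l j)))

  V-suc : ∀ l → (8 * ι l + 5) * (8 * ι l + 7) * (8 * ι l + 9) * (8 * ι l + 11) * V (suc l)
    ≡ 256 * (ι l + 1) * (ι l + 1) * (4 * ι l + 3) * (4 * ι l + 5) * V l
  V-suc l = undivide (V l) (256 * (ι l + 1) * (ι l + 1) * (4 * ι l + 3) * (4 * ι l + 5)) (0<V-denominator l)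

  F-suc : ∀ l j → (ι j + 1) * (8 * ι l + 4 * ι j + 5) * (8 * ι l + 4 * ι j + 7) * F l (suc j)
    ≡ (1 + 2 * ι l + ι j) * (4 * ι j + 1) * (4 * ι j + 3) * F l j
  F-suc l j = undivide (F l j) ((1 + 2 * ι l + ι j) * (4 * ι j + 1) * (4 * ι j + 3)) (0<F-denominator l j)

  -- The ratio of `F` in l is rational too, as a Wilf-Zeilberger pair requires. `V-suc` gives it for
  -- j = 0, and the ratios in j at l and at l + 1 carry it from j to j + 1.
  F-contiguous : ∀ l j →
    (8 * ι l + 4 * ι j + 5) * (8 * ι l + 4 * ι j + 7) * (8 * ι l + 4 * ι j + 9) * (8 * ι l + 4 * ι j + 11)
      * (1 + 2 * ι l) * F (suc l) j
    ≡ 128 * (ι l + 1) * (4 * ι l + 3) * (4 * ι l + 5) * (1 + 2 * ι l + ι j) * (2 + 2 * ι l + ι j) * F l j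
  F-contiguous l zero = core (ι l) (V l) (V (suc l)) (V-suc l)
    where
    core : ∀ l v v′ → (8 * l + 5) * (8 * l + 7) * (8 * l + 9) * (8 * l + 11) * v′
        ≡ 256 * (l + 1) * (l + 1) * (4 * l + 3) * (4 * l + 5) * v →
      (8 * l + 4 * 0 + 5) * (8 * l + 4 * 0 + 7) * (8 * l + 4 * 0 + 9) * (8 * l + 4 * 0 + 11) * (1 + 2 * l) * v′
        ≡ 128 * (l + 1) * (4 * l + 3) * (4 * l + 5) * (1 + 2 * l + 0) * (2 + 2 * l + 0) * v
    core l v v′ h = by-1 (1 + 2 * l) h (solve (l ∷ v ∷ v′ ∷ []) ring)
  F-contiguous l (suc j) = subst
    (λ m → (8 * ι l + 4 * m + 5) * (8 * ι l + 4 * m + 7) * (8 * ι l + 4 * m + 9) * (8 * ι l + 4 * m + 11)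
        * (1 + 2 * ι l) * F (suc l) (suc j)
      ≡ 128 * (ι l + 1) * (4 * ι l + 3) * (4 * ι l + 5) * (1 + 2 * ι l + m) * (2 + 2 * ι l + m) * F l (suc j))
    (sym (ι-suc j))
    (*-cancel-pos _ (0<F-denominator l j) (by-3
      ((3 + 2 * ι l + ι j) * (4 * ι j + 1) * (4 * ι j + 3))
      (- (128 * (ι l + 1) * (4 * ι l + 3) * (4 * ι l + 5) * (2 + 2 * ι l + ι j) * (3 + 2 * ι l + ι j)))
      ((8 * ι l + 4 * ι j + 5) * (8 * ι l + 4 * ι j + 7) * (8 * ι l + 4 * ι j + 9) * (8 * ι l + 4 * ι j + 11)
        * (1 + 2 * ι l))
      (F-contiguous l j) (F-suc l j)
      (subst (λ m → (ι j + 1) * (8 * m + 4 * ι j + 5) * (8 * m + 4 * ι j + 7) * F (suc l) (suc j)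
        ≡ (1 + 2 * m + ι j) * (4 * ι j + 1) * (4 * ι j + 3) * F (suc l) j) (ι-suc l) (F-suc (suc l) j))
      (lemma (ι l) (ι j) (F l j) (F l (suc j)) (F (suc l) j) (F (suc l) (suc j)))))
    where
    lemma : ∀ l j f f₁ g g₁ →
      (j + 1) * (8 * l + 4 * j + 5) * (8 * l + 4 * j + 7) *
        ((8 * l + 4 * (j + 1) + 5) * (8 * l + 4 * (j + 1) + 7) * (8 * l + 4 * (j + 1) + 9)
          * (8 * l + 4 * (j + 1) + 11) * (1 + 2 * l) * g₁)
      - (j + 1) * (8 * l + 4 * j + 5) * (8 * l + 4 * j + 7) *
        (128 * (l + 1) * (4 * l + 3) * (4 * l + 5) * (1 + 2 * l + (j + 1)) * (2 + 2 * l + (j + 1)) * f₁)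
      ≡ (3 + 2 * l + j) * (4 * j + 1) * (4 * j + 3) *
        ((8 * l + 4 * j + 5) * (8 * l + 4 * j + 7) * (8 * l + 4 * j + 9) * (8 * l + 4 * j + 11) * (1 + 2 * l) * g
          - 128 * (l + 1) * (4 * l + 3) * (4 * l + 5) * (1 + 2 * l + j) * (2 + 2 * l + j) * f)
      + - (128 * (l + 1) * (4 * l + 3) * (4 * l + 5) * (2 + 2 * l + j) * (3 + 2 * l + j)) *
        ((j + 1) * (8 * l + 4 * j + 5) * (8 * l + 4 * j + 7) * f₁
          - (1 + 2 * l + j) * (4 * j + 1) * (4 * j + 3) * f)
      + (8 * l + 4 * j + 5) * (8 * l + 4 * j + 7) * (8 * l + 4 * j + 9) * (8 * l + 4 * j + 11) * (1 + 2 * l) *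
        ((j + 1) * (8 * (l + 1) + 4 * j + 5) * (8 * (l + 1) + 4 * j + 7) * g₁
          - (1 + 2 * (l + 1) + j) * (4 * j + 1) * (4 * j + 3) * g)
    lemma = solve-∀ ring

  Y : ℚ → ℚ → ℚ
  Y l j = 16 * j * j + 96 * l * j + 64 * j + 128 * l * l + 160 * l + 45

  0<G-denominator : ∀ l j → 0 < (1 + 2 * ι l) * (8 * ι l + 4 * ι j + 5) * (8 * ι l + 4 * ι j + 7)
  0<G-denominator l j = *-pos (*-pos (+-pos-nonNeg (0<ι 1) (0≤2ι l)) (0<8l+4j+ 5 l j)) (0<8l+4j+ 7 l j)

  -- The companion of `F`: G/F is the rational certificate, with numerator j times `Y`. The factor j
  -- makes the lower boundary term vanish.
  G : ℕ → ℕ → ℚ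
  G l j = F l j * (ι j * Y (ι l) (ι j)
    * invℚ ((1 + 2 * ι l) * (8 * ι l + 4 * ι j + 5) * (8 * ι l + 4 * ι j + 7)))

  G-eq : ∀ l j → (1 + 2 * ι l) * (8 * ι l + 4 * ι j + 5) * (8 * ι l + 4 * ι j + 7) * G l j
    ≡ ι j * Y (ι l) (ι j) * F l j
  G-eq l j = undivide (F l j) (ι j * Y (ι l) (ι j)) (0<G-denominator l j)

  -- A Wilf–Zeilberger pair for Dixon's well-poised sum ₃F₂(1+2l, 1/4, 3/4; 7/4+2l, 5/4+2l; 1).
  F-difference : ∀ l j → F (suc l) j - F l j ≡ G l (suc j) - G l j
  F-difference l j = *-cancel-pos _
    (*-pos (*-pos (0<G-denominator l j) (0<8l+4j+ 9 l j)) (0<8l+4j+ 11 l j))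
    (by-4 1
      ((8 * ι l + 4 * ι j + 9) * (8 * ι l + 4 * ι j + 11))
      (- ((8 * ι l + 4 * ι j + 5) * (8 * ι l + 4 * ι j + 7)))
      (- (16 * (ι j + 1) * (ι j + 1) + 96 * ι l * (ι j + 1) + 64 * (ι j + 1)
        + 128 * ι l * ι l + 160 * ι l + 45))
      (F-contiguous l j) (G-eq l j)
      (subst (λ m → (1 + 2 * ι l) * (8 * ι l + 4 * m + 5) * (8 * ι l + 4 * m + 7) * G l (suc j)
        ≡ m * Y (ι l) m * F l (suc j)) (ι-suc j) (G-eq l (suc j)))
      (F-suc l j)
      (lemma (ι l) (ι j) (F l j) (F l (suc j)) (F (suc l) j) (G l j) (G l (suc j))))
    where
    lemma : ∀ l j f f₁ f′ g g₁ →
      (1 + 2 * l) * (8 * l + 4 * j + 5) * (8 * l + 4 * j + 7) * (8 * l + 4 * j + 9) * (8 * l + 4 * j + 11) * (f′ - f)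
      - (1 + 2 * l) * (8 * l + 4 * j + 5) * (8 * l + 4 * j + 7) * (8 * l + 4 * j + 9) * (8 * l + 4 * j + 11) * (g₁ - g)
      ≡ 1 *
        ((8 * l + 4 * j + 5) * (8 * l + 4 * j + 7) * (8 * l + 4 * j + 9) * (8 * l + 4 * j + 11) * (1 + 2 * l) * f′
          - 128 * (l + 1) * (4 * l + 3) * (4 * l + 5) * (1 + 2 * l + j) * (2 + 2 * l + j) * f)
      + (8 * l + 4 * j + 9) * (8 * l + 4 * j + 11) *
        ((1 + 2 * l) * (8 * l + 4 * j + 5) * (8 * l + 4 * j + 7) * g
          - j * (16 * j * j + 96 * l * j + 64 * j + 128 * l * l + 160 * l + 45) * f)
      + - ((8 * l + 4 * j + 5) * (8 * l + 4 * j + 7)) *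
        ((1 + 2 * l) * (8 * l + 4 * (j + 1) + 5) * (8 * l + 4 * (j + 1) + 7) * g₁
          - (j + 1) * (16 * (j + 1) * (j + 1) + 96 * l * (j + 1) + 64 * (j + 1) + 128 * l * l + 160 * l + 45) * f₁)
      + - (16 * (j + 1) * (j + 1) + 96 * l * (j + 1) + 64 * (j + 1) + 128 * l * l + 160 * l + 45) *
        ((j + 1) * (8 * l + 4 * j + 5) * (8 * l + 4 * j + 7) * f₁
          - (1 + 2 * l + j) * (4 * j + 1) * (4 * j + 3) * f)
    lemma = solve-∀ ring

  S : ℕ → ℕ → ℚ
  S l J = ∑ J (F l)

  -- Summing `F-difference` over j telescopes; of the two ends only the upper one survives.
  S-suc : ∀ l J → S (suc l) J ≡ S l J + G l J
  S-suc l J = begin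
    ∑ J (F (suc l))  ≡⟨ ∑-cong J (λ j → lemma (F (suc l) j) (F l j)) ⟩
    ∑ J (λ j → F l j + (F (suc l) j - F l j))  ≡⟨ ∑-+ J (F l) (λ j → F (suc l) j - F l j) ⟩
    S l J + ∑ J (λ j → F (suc l) j - F l j)  ≡⟨ cong (S l J +_) (∑-telescope J _ (G l) (F-difference l)) ⟩
    S l J + (G l J - G l 0)  ≡⟨ cong (λ z → S l J + (G l J - z)) G0≡0 ⟩
    S l J + (G l J - 0)  ≡⟨ cong (S l J +_) (ℚ.+-identityʳ (G l J)) ⟩
    S l J + G l J  ∎
    where
    open ≡-Reasoning
    lemma : ∀ x y → x ≡ y + (x - y)
    lemma = solve-∀ ring
    zero-left : ∀ x y z → x * (0 * y * z) ≡ 0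
    zero-left = solve-∀ ring
    G0≡0 : G l 0 ≡ 0
    G0≡0 = zero-left (F l 0) (Y (ι l) (ι 0)) _

  F0-closed : ∀ j → (4 * ι j + 1) * (4 * ι j + 3) * F 0 j ≡ 8
  F0-closed zero    = refl
  F0-closed (suc j) = subst (λ m → (4 * m + 1) * (4 * m + 3) * F 0 (suc j) ≡ 8) (sym (ι-suc j))
    (*-cancel-pos (ι j + 1) (nonNeg+pos (0≤ι j) lit<) (by-2 1 (ι j + 1) (F-suc 0 j) (F0-closed j)
      (lemma (ι j) (F 0 j) (F 0 (suc j)))))
    where
    lemma : ∀ j f f₁ → (j + 1) * ((4 * (j + 1) + 1) * (4 * (j + 1) + 3) * f₁) - (j + 1) * 8
      ≡ 1 * ((j + 1) * (8 * 0 + 4 * j + 5) * (8 * 0 + 4 * j + 7) * f₁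
          - (1 + 2 * 0 + j) * (4 * j + 1) * (4 * j + 3) * f)
        + (j + 1) * ((4 * j + 1) * (4 * j + 3) * f - 8)
    lemma = solve-∀ ring

  F0≡πterm : ∀ j → F 0 j ≡ πterm j
  F0≡πterm j = *-cancel-pos _ (*-pos (0<k·ι+c 4 1 j) (0<k·ι+c 4 3 j))
    (trans (F0-closed j) (sym (trans (cong (_* πterm j) (sym eq))
      (/-ι 8 ((2 ℕ.+ 4 ℕ.* j) ℕ.+ (4 ℕ.* j) ℕ.* suc (2 ℕ.+ 4 ℕ.* j))))))
    where
    eq : ι (suc (4 ℕ.* j) ℕ.* suc (2 ℕ.+ 4 ℕ.* j)) ≡ (4 * ι j + 1) * (4 * ι j + 3)
    eq = trans (ι-* (suc (4 ℕ.* j)) (suc (2 ℕ.+ 4 ℕ.* j))) (cong₂ _*_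
      (trans (ι-suc (4 ℕ.* j)) (cong (_+ 1) (ι-* 4 j)))
      (trans (ι-+ 3 (4 ℕ.* j)) (trans (cong (3 +_) (ι-* 4 j)) (ℚ.+-comm 3 (4 * ι j)))))

  S0≡πsum : ∀ J → S 0 J ≡ πsum J
  S0≡πsum zero    = refl
  S0≡πsum (suc J) = cong₂ _+_ (S0≡πsum J) (F0≡πterm J)

  -- (4j + 1)(4j + 3) F(l, j) is the constant 8 at l = 0 and nonincreasing in j in general: the
  -- deficit in each step is a polynomial divisible by l with nonnegative coefficients.
  F-decay : ∀ l j → (4 * ι j + 1) * (4 * ι j + 3) * F l j ≤ 3 * V l
  F-decay l zero    = ℚ.≤-refl
  F-decay l (suc j) = ℚ.≤-trans
    (*-cancel-≤ _ (0<F-denominator l j)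
      (≤-by (((64 * ι l * ι l * (ι j + 1) + 32 * ι l * ι j * ι j + 64 * ι l * ι j + 26 * ι l)
            * ((4 * ι j + 1) * (4 * ι j + 3) * F l j)))
        ((0≤ι 64 ⊛ L ⊛ L ⊛ (J ⊹ 0≤ι 1) ⊹ 0≤ι 32 ⊛ L ⊛ J ⊛ J ⊹ 0≤ι 64 ⊛ L ⊛ J ⊹ 0≤ι 26 ⊛ L)
          ⊛ ((0≤ι 4 ⊛ J ⊹ 0≤ι 1) ⊛ (0≤ι 4 ⊛ J ⊹ 0≤ι 3) ⊛ ℚ.<⇒≤ (0<F l j)))
        (trans (cong (λ m → (ι j + 1) * (8 * ι l + 4 * ι j + 5) * (8 * ι l + 4 * ι j + 7)
            * ((4 * ι j + 1) * (4 * ι j + 3) * F l j)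
            - (ι j + 1) * (8 * ι l + 4 * ι j + 5) * (8 * ι l + 4 * ι j + 7)
            * ((4 * m + 1) * (4 * m + 3) * F l (suc j))) (ι-suc j))
          (by-1 (- ((4 * ι j + 5) * (4 * ι j + 7))) (F-suc l j)
            (lemma (ι l) (ι j) (F l j) (F l (suc j)))))))
    (F-decay l j)
    where
    L = 0≤ι l
    J = 0≤ι j
    lemma : ∀ l j f f₁ →
      (j + 1) * (8 * l + 4 * j + 5) * (8 * l + 4 * j + 7) * ((4 * j + 1) * (4 * j + 3) * f)
        - (j + 1) * (8 * l + 4 * j + 5) * (8 * l + 4 * j + 7) * ((4 * (j + 1) + 1) * (4 * (j + 1) + 3) * f₁)
        - (64 * l * l * (j + 1) + 32 * l * j * j + 64 * l * j + 26 * l) * ((4 * j + 1) * (4 * j + 3) * f)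
      ≡ - ((4 * j + 5) * (4 * j + 7)) * ((j + 1) * (8 * l + 4 * j + 5) * (8 * l + 4 * j + 7) * f₁
          - (1 + 2 * l + j) * (4 * j + 1) * (4 * j + 3) * f)
    lemma = solve-∀ ring

  G-nonNeg : ∀ l j → 0 ≤ G l j
  G-nonNeg l j = ℚ.<⇒≤ (0<F l j) ⊛ (J ⊛ 0≤Y ⊛ ℚ.<⇒≤ (0<invℚ (0<G-denominator l j)))
    where
    L = 0≤ι l
    J = 0≤ι j
    0≤Y = 0≤ι 16 ⊛ J ⊛ J ⊹ 0≤ι 96 ⊛ L ⊛ J ⊹ 0≤ι 64 ⊛ J ⊹ 0≤ι 128 ⊛ L ⊛ L ⊹ 0≤ι 160 ⊛ L ⊹ 0≤ι 45

  -- The quotient of `Y` by its two linear factors stays bounded in j, so G has the size of j F,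
  -- which is O(1/j) by `F-decay`. This is what makes the boundary term of the telescoping
  -- disappear.
  G-decay : ∀ l j → G l j * (ι j + 1) ≤ 6 * V l
  G-decay l j = *-cancel-≤ _ (0<G-denominator l j)
    (≤-by (12 * ι l * A * V l
          + 2 * A * (3 * V l - (4 * ι j + 1) * (4 * ι j + 3) * F l j)
          + F l j * (2 * A * (15 * ι j * ι j + 15 * ι j + 3)
              + ι j * (ι j + 1) * (16 * ι j * ι j + 32 * ι l * ι j + 32 * ι j + 32 * ι l + 25)))
      (0≤ι 12 ⊛ L ⊛ 0≤A ⊛ ℚ.<⇒≤ (0<V l)
        ⊹ 0≤ι 2 ⊛ 0≤A ⊛ 0≤-diff (F-decay l j)
        ⊹ ℚ.<⇒≤ (0<F l j) ⊛ (0≤ι 2 ⊛ 0≤A ⊛ (0≤ι 15 ⊛ J ⊛ J ⊹ 0≤ι 15 ⊛ J ⊹ 0≤ι 3)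
            ⊹ J ⊛ (J ⊹ 0≤ι 1) ⊛ (0≤ι 16 ⊛ J ⊛ J ⊹ 0≤ι 32 ⊛ L ⊛ J ⊹ 0≤ι 32 ⊛ J ⊹ 0≤ι 32 ⊛ L ⊹ 0≤ι 25)))
      (by-1 (- (ι j + 1)) (G-eq l j) (lemma (ι l) (ι j) (F l j) (G l j) (V l))))
    where
    L = 0≤ι l
    J = 0≤ι j
    A = (8 * ι l + 4 * ι j + 5) * (8 * ι l + 4 * ι j + 7)
    0≤A : 0 ≤ A
    0≤A = ℚ.<⇒≤ (*-pos (0<8l+4j+ 5 l j) (0<8l+4j+ 7 l j))
    lemma : ∀ l j f g v →
      (1 + 2 * l) * (8 * l + 4 * j + 5) * (8 * l + 4 * j + 7) * (6 * v)
        - (1 + 2 * l) * (8 * l + 4 * j + 5) * (8 * l + 4 * j + 7) * (g * (j + 1))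
        - (12 * l * ((8 * l + 4 * j + 5) * (8 * l + 4 * j + 7)) * v
          + 2 * ((8 * l + 4 * j + 5) * (8 * l + 4 * j + 7)) * (3 * v - (4 * j + 1) * (4 * j + 3) * f)
          + f * (2 * ((8 * l + 4 * j + 5) * (8 * l + 4 * j + 7)) * (15 * j * j + 15 * j + 3)
              + j * (j + 1) * (16 * j * j + 32 * l * j + 32 * j + 32 * l + 25)))
      ≡ - (j + 1) * ((1 + 2 * l) * (8 * l + 4 * j + 5) * (8 * l + 4 * j + 7) * g
          - j * (16 * j * j + 96 * l * j + 64 * j + 128 * l * l + 160 * l + 45) * f)
    lemma = solve-∀ ring

  -- The bounds of `G-decay` accumulated over the steps from 0 to l.
  K : ℕ → ℚ
  K zero    = 0
  K (suc l) = K l + 6 * V l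

  πsum≤S : ∀ l J → πsum J ≤ S l J
  πsum≤S zero    J = ℚ.≤-reflexive (sym (S0≡πsum J))
  πsum≤S (suc l) J = ℚ.≤-trans (πsum≤S l J) (≤-by (G l J) (G-nonNeg l J)
    (trans (cong (_- S l J) (S-suc l J)) (lemma (S l J) (G l J))))
    where
    lemma : ∀ s g → (s + g) - s ≡ g
    lemma = solve-∀ ring

  -- With `πsum≤S` this says that the sum of F(l, j) over j is π for every l. The constant grows
  -- with l, so that l has to be fixed before J.
  S-πsum-decay : ∀ l J → (S l J - πsum J) * (ι J + 1) ≤ K l
  S-πsum-decay zero J = ℚ.≤-reflexive (trans
    (cong (λ s → (s - πsum J) * (ι J + 1)) (S0≡πsum J)) (lemma (πsum J) (ι J)))
    where
    lemma : ∀ p j → (p - p) * (j + 1) ≡ 0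
    lemma = solve-∀ ring
  S-πsum-decay (suc l) J = ℚ.≤-trans
    (ℚ.≤-reflexive (trans (cong (λ s → (s - πsum J) * (ι J + 1)) (S-suc l J))
      (lemma (S l J) (πsum J) (G l J) (ι J))))
    (ℚ.+-mono-≤ (S-πsum-decay l J) (G-decay l J))
    where
    lemma : ∀ s p g j → ((s + g) - p) * (j + 1) ≡ (s - p) * (j + 1) + g * (j + 1)
    lemma = solve-∀ ring

  -- A ratio for which the tail can be summed: it makes (j + 1 + 2l) F(l, j) drop by at least 2l
  -- F(l, j) at each step from j = 1 on, and `S-tail` adds up these drops.
  F-ratio : ∀ l j → F l (suc j) * (ι j + 2 + 2 * ι l) ≤ F l j * (ι j + 1)
  F-ratio l j = *-cancel-≤ _ (0<F-denominator l j)
    (≤-by ((3 * (ι j + 1) * (ι j + 1) + (2 * ι l + ι j + 1) * (2 * ι l + ι j + 2) * (16 * ι j + 13)) * F l j)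
      ((0≤ι 3 ⊛ (j≥0 ⊹ 0≤ι 1) ⊛ (j≥0 ⊹ 0≤ι 1)
        ⊹ (0≤2ι l ⊹ j≥0 ⊹ 0≤ι 1) ⊛ (0≤2ι l ⊹ j≥0 ⊹ 0≤ι 2) ⊛ (0≤ι 16 ⊛ j≥0 ⊹ 0≤ι 13)) ⊛ ℚ.<⇒≤ (0<F l j))
      (by-1 (- (ι j + 2 + 2 * ι l)) (F-suc l j) (lemma (ι l) (ι j) (F l j) (F l (suc j)))))
    where
    j≥0 = 0≤ι j
    lemma : ∀ l j f f₁ →
      (j + 1) * (8 * l + 4 * j + 5) * (8 * l + 4 * j + 7) * (f * (j + 1))
        - (j + 1) * (8 * l + 4 * j + 5) * (8 * l + 4 * j + 7) * (f₁ * (j + 2 + 2 * l))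
        - (3 * (j + 1) * (j + 1) + (2 * l + j + 1) * (2 * l + j + 2) * (16 * j + 13)) * f
      ≡ - (j + 2 + 2 * l) * ((j + 1) * (8 * l + 4 * j + 5) * (8 * l + 4 * j + 7) * f₁
          - (1 + 2 * l + j) * (4 * j + 1) * (4 * j + 3) * f)
    lemma = solve-∀ ring

  S-tail : ∀ l J → 2 * ι l * (S l (suc J) - V l) + F l (suc J) * (ι J + 2 + 2 * ι l) ≤ F l 1 * (2 + 2 * ι l)
  S-tail l zero    = ℚ.≤-reflexive (lemma (ι l) (V l) (F l 1))
    where
    lemma : ∀ l v f → 2 * l * ((0 + v) - v) + f * (0 + 2 + 2 * l) ≡ f * (2 + 2 * l)
    lemma = solve-∀ ring
  S-tail l (suc J) = ℚ.≤-trans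
    (≤-by (F l (suc J) * (ι (suc J) + 1) - F l (suc (suc J)) * (ι (suc J) + 2 + 2 * ι l))
      (0≤-diff (F-ratio l (suc J)))
      (trans (cong (λ m → 2 * ι l * (S l (suc J) - V l) + F l (suc J) * (ι J + 2 + 2 * ι l)
          - (2 * ι l * (S l (suc J) + F l (suc J) - V l) + F l (suc (suc J)) * (m + 2 + 2 * ι l))) (ι-suc J))
        (trans (lemma (ι l) (ι J) (S l (suc J)) (V l) (F l (suc J)) (F l (suc (suc J))))
          (cong (λ m → F l (suc J) * (m + 1) - F l (suc (suc J)) * (m + 2 + 2 * ι l)) (sym (ι-suc J))))))
    (S-tail l J)
    where
    lemma : ∀ l j s v f f₁ →
      2 * l * (s - v) + f * (j + 2 + 2 * l) - (2 * l * (s + f - v) + f₁ * (j + 1 + 2 + 2 * l))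
      ≡ f * (j + 1 + 1) - f₁ * (j + 1 + 2 + 2 * l)
    lemma = solve-∀ ring

  F1≤V : ∀ l → F l 1 * (2 + 2 * ι l) ≤ V l
  F1≤V l = *-cancel-≤ _ (0<F-denominator l 0)
    (≤-by ((52 * ι l * ι l + 78 * ι l + 29) * V l)
      ((0≤ι 52 ⊛ 0≤ι l ⊛ 0≤ι l ⊹ 0≤ι 78 ⊛ 0≤ι l ⊹ 0≤ι 29) ⊛ ℚ.<⇒≤ (0<V l))
      (by-1 (- (2 + 2 * ι l)) (F-suc l 0) (lemma (ι l) (V l) (F l 1))))
    where
    lemma : ∀ l f f₁ →
      (0 + 1) * (8 * l + 4 * 0 + 5) * (8 * l + 4 * 0 + 7) * f
        - (0 + 1) * (8 * l + 4 * 0 + 5) * (8 * l + 4 * 0 + 7) * (f₁ * (2 + 2 * l))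
        - (52 * l * l + 78 * l + 29) * f
      ≡ - (2 + 2 * l) * ((0 + 1) * (8 * l + 4 * 0 + 5) * (8 * l + 4 * 0 + 7) * f₁
          - (1 + 2 * l + 0) * (4 * 0 + 1) * (4 * 0 + 3) * f)
    lemma = solve-∀ ring

  -- The terms after j = 0 add up to at most V/(2l), by `S-tail` and `F1≤V`. Together with `V≤S`
  -- this squeezes V(l) to π.
  πsum-upper : ∀ l J → 2 * ι l * πsum J ≤ (2 * ι l + 1) * V l
  πsum-upper l J = ≤-by
    (2 * ι l * (S l J - πsum J) + 2 * ι l * F l J + F l (suc J) * (ι J + 2 + 2 * ι l)
      + (F l 1 * (2 + 2 * ι l) - (2 * ι l * (S l J + F l J - V l) + F l (suc J) * (ι J + 2 + 2 * ι l)))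
      + (V l - F l 1 * (2 + 2 * ι l)))
    (0≤2ι l ⊛ 0≤-diff (πsum≤S l J) ⊹ 0≤2ι l ⊛ ℚ.<⇒≤ (0<F l J)
      ⊹ ℚ.<⇒≤ (0<F l (suc J)) ⊛ (0≤ι J ⊹ 0≤ι 2 ⊹ 0≤2ι l)
      ⊹ 0≤-diff (S-tail l J) ⊹ 0≤-diff (F1≤V l))
    (lemma (2 * ι l) (πsum J) (S l J) (F l J) (F l (suc J) * (ι J + 2 + 2 * ι l)) (V l) (F l 1 * (2 + 2 * ι l)))
    where
    lemma : ∀ l p s f e v u → (l + 1) * v - l * p
      ≡ l * (s - p) + l * f + e + (u - (l * (s + f - v) + e)) + (v - u)
    lemma = solve-∀ ring

  V≤S : ∀ l J → V l ≤ S l (suc J)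
  V≤S l zero    = ℚ.≤-reflexive (sym (ℚ.+-identityˡ (V l)))
  V≤S l (suc J) = ℚ.≤-trans (V≤S l J) (≤-by (F l (suc J)) (ℚ.<⇒≤ (0<F l (suc J)))
    (lemma (S l (suc J)) (F l (suc J))))
    where
    lemma : ∀ s f → s + f - s ≡ f
    lemma = solve-∀ ring

  w-suc⁴ : ∀ m → (2 * ι m + 2) * (2 * ι m + 4) * (2 * ι m + 6) * (2 * ι m + 8) * w (4 ℕ.+ m)
    ≡ (2 * ι m + 1) * (2 * ι m + 3) * (2 * ι m + 5) * (2 * ι m + 7) * w m
  w-suc⁴ m = by-4
    ((2 * ι m + 3) * (2 * ι m + 5) * (2 * ι m + 7))
    ((2 * ι m + 2) * (2 * ι m + 5) * (2 * ι m + 7))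
    ((2 * ι m + 2) * (2 * ι m + 4) * (2 * ι m + 7))
    ((2 * ι m + 2) * (2 * ι m + 4) * (2 * ι m + 6))
    (w-suc m)
    (at (suc m) (ι m + 1) (ι-suc m))
    (at (suc (suc m)) (ι m + 2) (ι-+ 2 m ⟫ ℚ.+-comm 2 (ι m)))
    (at (suc (suc (suc m))) (ι m + 3) (ι-+ 3 m ⟫ ℚ.+-comm 3 (ι m)))
    (lemma (ι m) (w m) (w (1 ℕ.+ m)) (w (2 ℕ.+ m)) (w (3 ℕ.+ m)) (w (4 ℕ.+ m)))
    where
    _⟫_ = trans
    at : ∀ n x → ι n ≡ x → (2 * x + 2) * w (suc n) ≡ (2 * x + 1) * w n
    at n .(ι n) refl = w-suc n
    lemma : ∀ m u₀ u₁ u₂ u₃ u₄ →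
      (2 * m + 2) * (2 * m + 4) * (2 * m + 6) * (2 * m + 8) * u₄
        - (2 * m + 1) * (2 * m + 3) * (2 * m + 5) * (2 * m + 7) * u₀
      ≡ (2 * m + 3) * (2 * m + 5) * (2 * m + 7) * ((2 * m + 2) * u₁ - (2 * m + 1) * u₀)
      + (2 * m + 2) * (2 * m + 5) * (2 * m + 7) * ((2 * (m + 1) + 2) * u₂ - (2 * (m + 1) + 1) * u₁)
      + (2 * m + 2) * (2 * m + 4) * (2 * m + 7) * ((2 * (m + 2) + 2) * u₃ - (2 * (m + 2) + 1) * u₂)
      + (2 * m + 2) * (2 * m + 4) * (2 * m + 6) * ((2 * (m + 3) + 2) * u₄ - (2 * (m + 3) + 1) * u₃)
    lemma = solve-∀ ring

  -- Expresses the Gamma quotient `V` by Wallis ratios. One step in l moves the index of w(4l) by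
  -- four, whence `w-suc⁴`.
  V-closed : ∀ l → V l * ((8 * ι l + 1) * (8 * ι l + 3) * w (l ℕ.* 4) * w l) ≡ 8 * (4 * ι l + 1)
  V-closed zero    = refl
  V-closed (suc l) = subst
    (λ m → V (suc l) * ((8 * m + 1) * (8 * m + 3) * w (4 ℕ.+ l ℕ.* 4) * w (suc l)) ≡ 8 * (4 * m + 1))
    (sym (ι-suc l))
    (*-cancel-pos D 0<D (by-2 1
      (256 * (L + 1) * (L + 1) * (4 * L + 3) * (4 * L + 5) * (8 * L + 5) * (8 * L + 7) * (2 * L + 1))
      (cong₂ _*_ (cong₂ _*_ (V-suc l) w4) (w-suc l)) (V-closed l)
      (lemma L (V l) (V (suc l)) (w (l ℕ.* 4)) (w (4 ℕ.+ l ℕ.* 4)) (w l) (w (suc l)))))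
    where
    L = ι l
    D = (8 * L + 5) * (8 * L + 7) * ((8 * L + 2) * (8 * L + 4) * (8 * L + 6) * (8 * L + 8)) * (2 * L + 2)
    0<D : 0 < D
    0<D = *-pos (*-pos (*-pos (0<k·ι+c 8 5 l) (0<k·ι+c 8 7 l))
      (*-pos (*-pos (*-pos (0<k·ι+c 8 2 l) (0<k·ι+c 8 4 l)) (0<k·ι+c 8 6 l)) (0<k·ι+c 8 8 l)))
      (0<k·ι+c 2 2 l)
    8L : 2 * ι (l ℕ.* 4) ≡ 8 * L
    8L = trans (cong (2 *_) (ι-* l 4)) (double L)
      where
      double : ∀ x → 2 * (x * 4) ≡ 8 * x
      double = solve-∀ ring
    w4 : (8 * L + 2) * (8 * L + 4) * (8 * L + 6) * (8 * L + 8) * w (4 ℕ.+ l ℕ.* 4)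
      ≡ (8 * L + 1) * (8 * L + 3) * (8 * L + 5) * (8 * L + 7) * w (l ℕ.* 4)
    w4 = subst (λ x → (x + 2) * (x + 4) * (x + 6) * (x + 8) * w (4 ℕ.+ l ℕ.* 4)
      ≡ (x + 1) * (x + 3) * (x + 5) * (x + 7) * w (l ℕ.* 4)) 8L (w-suc⁴ (l ℕ.* 4))
    lemma : ∀ l v v′ W W′ w w′ →
      (8 * l + 5) * (8 * l + 7) * ((8 * l + 2) * (8 * l + 4) * (8 * l + 6) * (8 * l + 8)) * (2 * l + 2) *
        (v′ * ((8 * (l + 1) + 1) * (8 * (l + 1) + 3) * W′ * w′))
      - (8 * l + 5) * (8 * l + 7) * ((8 * l + 2) * (8 * l + 4) * (8 * l + 6) * (8 * l + 8)) * (2 * l + 2) *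
        (8 * (4 * (l + 1) + 1))
      ≡ 1 * ((8 * l + 5) * (8 * l + 7) * (8 * l + 9) * (8 * l + 11) * v′
          * ((8 * l + 2) * (8 * l + 4) * (8 * l + 6) * (8 * l + 8) * W′) * ((2 * l + 2) * w′)
          - 256 * (l + 1) * (l + 1) * (4 * l + 3) * (4 * l + 5) * v
          * ((8 * l + 1) * (8 * l + 3) * (8 * l + 5) * (8 * l + 7) * W) * ((2 * l + 1) * w))
      + 256 * (l + 1) * (l + 1) * (4 * l + 3) * (4 * l + 5) * (8 * l + 5) * (8 * l + 7) * (2 * l + 1) *
        (v * ((8 * l + 1) * (8 * l + 3) * W * w) - 8 * (4 * l + 1))
    lemma = solve-∀ ring

  4l≡3l+l : ∀ l → l ℕ.* 4 ≡ 3 ℕ.* l ℕ.+ l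
  4l≡3l+l l = trans (ℕ.*-comm l 4) (ℕ.+-comm l (3 ℕ.* l))

  -- Asymptotically w(4l) is half of w(l). Monotonicity of `a` between l and 4l gives this side of
  -- the comparison; that of `b` gives the other one inside `1≤Vlw²`.
  w≤2w₄ : ∀ l → w (suc l) ≤ 2 * w (suc l ℕ.* 4)
  w≤2w₄ l = square-cancel-≤ (0≤ι 2 ⊛ ℚ.<⇒≤ (0<w (suc l ℕ.* 4))) (*-cancel-≤ (2 * ι (suc l))
    (*-pos (0<ι 2) (0<ι-suc l)) (begin
      2 * ι (suc l) * (w (suc l) * w (suc l))  ≤⟨ a-mono (3 ℕ.* suc l) (suc l) ⟩
      a (3 ℕ.* suc l ℕ.+ suc l)  ≡⟨ cong a (sym (4l≡3l+l (suc l))) ⟩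
      2 * ι (suc l ℕ.* 4) * (W * W)  ≡⟨ cong (λ x → 2 * x * (W * W)) (ι-* (suc l) 4) ⟩
      2 * (ι (suc l) * 4) * (W * W)  ≡⟨ lemma (ι (suc l)) W ⟩
      2 * ι (suc l) * (2 * W * (2 * W))  ∎))
    where
    open ℚ.≤-Reasoning
    W = w (suc l ℕ.* 4)
    lemma : ∀ l w → 2 * (l * 4) * (w * w) ≡ 2 * l * (2 * w * (2 * w))
    lemma = solve-∀ ring

  -- Trading w(4l) for w(l)/2 in `V-closed` shows that V is 1/(l w²) = 2/a up to a relative error
  -- O(1/l). Since V tends to π, this is Wallis' product.
  Vlw²≤1 : ∀ l → V (suc l) * (ι (suc l) * (w (suc l) * w (suc l))) ≤ 1
  Vlw²≤1 l = *-cancel-≤ (16 * (4 * L + 1)) (*-pos (0<ι 16) (0<k·ι+c 4 1 (suc l)))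
    (≤-by (V (suc l) * w (suc l) * ((8 * L + 1) * (8 * L + 3) * (2 * W - w (suc l)) + (16 * L + 3) * w (suc l)))
      (ℚ.<⇒≤ (0<V (suc l)) ⊛ w≥0
        ⊛ ((0≤ι 8 ⊛ L≥0 ⊹ 0≤ι 1) ⊛ (0≤ι 8 ⊛ L≥0 ⊹ 0≤ι 3) ⊛ 0≤-diff (w≤2w₄ l)
          ⊹ (0≤ι 16 ⊛ L≥0 ⊹ 0≤ι 3) ⊛ w≥0))
      (by-1 (- 2) (V-closed (suc l)) (lemma L (V (suc l)) W (w (suc l)))))
    where
    L = ι (suc l)
    L≥0 = 0≤ι (suc l)
    W = w (suc l ℕ.* 4)
    w≥0 = ℚ.<⇒≤ (0<w (suc l))
    lemma : ∀ l v W w → 16 * (4 * l + 1) * 1 - 16 * (4 * l + 1) * (v * (l * (w * w)))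
        - v * w * ((8 * l + 1) * (8 * l + 3) * (2 * W - w) + (16 * l + 3) * w)
      ≡ - 2 * (v * ((8 * l + 1) * (8 * l + 3) * W * w) - 8 * (4 * l + 1))
    lemma = solve-∀ ring

  1≤Vlw² : ∀ l → 1 ≤ V l * ((ι l + 1) * (w l * w l))
  1≤Vlw² l = *-cancel-≤ (8 * (4 * L + 1)) (*-pos (0<ι 8) (0<k·ι+c 4 1 l))
    (≤-by (V l * w l * (8 * (4 * L + 1) * (L + 1) * w l - (8 * L + 1) * (8 * L + 3) * W))
      (ℚ.<⇒≤ (0<V l) ⊛ ℚ.<⇒≤ (0<w l) ⊛ 0≤-diff bound)
      (by-1 1 (V-closed l) (lemma L (V l) W (w l))))
    where
    L = ι l
    L≥0 = 0≤ι l
    W = w (l ℕ.* 4)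
    bound-8L : (8 * L + 1) * (W * W) ≤ b l
    bound-8L = subst (_≤ b l) (trans (cong b (sym (4l≡3l+l l)))
      (trans (cong (λ x → (2 * x + 1) * (W * W)) (ι-* l 4)) (quadruple L (W * W)))) (b-anti (3 ℕ.* l) l)
      where
      quadruple : ∀ x y → (2 * (x * 4) + 1) * y ≡ (8 * x + 1) * y
      quadruple = solve-∀ ring
    bound : (8 * L + 1) * (8 * L + 3) * W ≤ 8 * (4 * L + 1) * (L + 1) * w l
    bound = square-cancel-≤
      (0≤ι 8 ⊛ (0≤ι 4 ⊛ L≥0 ⊹ 0≤ι 1) ⊛ (L≥0 ⊹ 0≤ι 1) ⊛ ℚ.<⇒≤ (0<w l))
      (≤-by ((8 * L + 1) * ((8 * L + 3) * (8 * L + 3)) * ((2 * L + 1) * (w l * w l) - (8 * L + 1) * (W * W))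
          + (1152 * L * L * L + 1424 * L * L + 502 * L + 55) * (w l * w l))
        ((0≤ι 8 ⊛ L≥0 ⊹ 0≤ι 1) ⊛ 0≤-square (8 * L + 3) ⊛ 0≤-diff bound-8L
          ⊹ (0≤ι 1152 ⊛ L≥0 ⊛ L≥0 ⊛ L≥0 ⊹ 0≤ι 1424 ⊛ L≥0 ⊛ L≥0 ⊹ 0≤ι 502 ⊛ L≥0 ⊹ 0≤ι 55) ⊛ 0≤-square (w l))
        (identity L W (w l)))
      where
      identity : ∀ l W w → 8 * (4 * l + 1) * (l + 1) * w * (8 * (4 * l + 1) * (l + 1) * w)
        - (8 * l + 1) * (8 * l + 3) * W * ((8 * l + 1) * (8 * l + 3) * W)
        ≡ (8 * l + 1) * ((8 * l + 3) * (8 * l + 3)) * ((2 * l + 1) * (w * w) - (8 * l + 1) * (W * W))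
          + (1152 * l * l * l + 1424 * l * l + 502 * l + 55) * (w * w)
      identity = solve-∀ ring
    lemma : ∀ l v W w → 8 * (4 * l + 1) * (v * ((l + 1) * (w * w))) - 8 * (4 * l + 1) * 1
        - v * w * (8 * (4 * l + 1) * (l + 1) * w - (8 * l + 1) * (8 * l + 3) * W)
      ≡ 1 * (v * ((8 * l + 1) * (8 * l + 3) * W * w) - 8 * (4 * l + 1))
    lemma = solve-∀ ring

  0≤πsum : ∀ J → 0 ≤ πsum J
  0≤πsum J = subst (λ n → 0 ≤ πsum n) (ℕ.+-identityʳ J) (Pi.πsum-mono 0 J)

  0≤a : ∀ n → 0 ≤ a n
  0≤a n = 0≤2ι n ⊛ 0≤-square (w n)

  aπ-upper : ∀ l J → ι (suc l) * (a (suc l) * πsum J - 2) ≤ 1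
  aπ-upper l J = ≤-by
    (w² * L * ((2 * L + 1) * V (suc l) - 2 * L * πsum J) + (2 * L + 1) * (1 - V (suc l) * (L * w²)))
    (0≤-square (w (suc l)) ⊛ 0≤ι (suc l) ⊛ 0≤-diff (πsum-upper (suc l) J)
      ⊹ (0≤2ι (suc l) ⊹ 0≤ι 1) ⊛ 0≤-diff (Vlw²≤1 l))
    (lemma L w² (V (suc l)) (πsum J))
    where
    L = ι (suc l)
    w² = w (suc l) * w (suc l)
    lemma : ∀ l w v p → 1 - l * (2 * l * w * p - 2)
      ≡ w * l * ((2 * l + 1) * v - 2 * l * p) + (2 * l + 1) * (1 - v * (l * w))
    lemma = solve-∀ ring

  aπ≤3 : ∀ l J → a (suc l) * πsum J ≤ 3
  aπ≤3 l J = *-cancel-≤ (ι (suc l)) (0<ι-suc l)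
    (≤-by ((1 - L * (a (suc l) * πsum J - 2)) + ι l)
      (0≤-diff (aπ-upper l J) ⊹ 0≤ι l)
      (trans (lemma L (a (suc l) * πsum J)) (cong (1 - L * (a (suc l) * πsum J - 2) +_)
        (trans (cong (_- 1) (ι-suc l)) (cancel (ι l))))))
    where
    L = ι (suc l)
    lemma : ∀ l x → l * 3 - l * x ≡ 1 - l * (x - 2) + (l - 1)
    lemma = solve-∀ ring
    cancel : ∀ x → x + 1 - 1 ≡ x
    cancel = solve-∀ ring

  w²≤1 : ∀ l → w l * w l ≤ 1
  w²≤1 l = ℚ.≤-trans (≤-by (2 * ι l * (w l * w l)) (0≤a l) (lemma (ι l) (w l)))
    (subst (λ m → b m ≤ 1) (ℕ.+-identityʳ l) (b-anti l 0))
    where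
    lemma : ∀ n w → (2 * n + 1) * (w * w) - w * w ≡ 2 * n * (w * w)
    lemma = solve-∀ ring

  -- The lower bound for V is through `V≤S`, which compares V with partial sums of F(l, j) and not
  -- with those of Leibniz's series; the difference of the two stays on the right until J is chosen.
  aπ-lower : ∀ l J → ι (suc l) * (2 - a (suc l) * πsum (suc J))
    ≤ 3 + 3 * ι (suc l) * (S (suc l) (suc J) - πsum (suc J))
  aπ-lower l J = ≤-by
    (2 * L * (V (suc l) * ((L + 1) * w²) - 1)
      + 2 * L * (L + 1) * w² * (s - V (suc l))
      + L * (s - p) * ((1 - a (suc l)) + 2 * (1 - w²))
      + (3 - a (suc l) * p))
    (0≤2ι (suc l) ⊛ 0≤-diff (1≤Vlw² (suc l))
      ⊹ 0≤2ι (suc l) ⊛ (0≤ι (suc l) ⊹ 0≤ι 1) ⊛ 0≤-square (w (suc l)) ⊛ 0≤-diff (V≤S (suc l) J)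
      ⊹ 0≤ι (suc l) ⊛ 0≤-diff (πsum≤S (suc l) (suc J)) ⊛ (0≤-diff (a≤1 (suc l)) ⊹ 0≤ι 2 ⊛ 0≤-diff (w²≤1 (suc l)))
      ⊹ 0≤-diff (aπ≤3 l (suc J)))
    (lemma L w² (V (suc l)) s p)
    where
    L = ι (suc l)
    w² = w (suc l) * w (suc l)
    s = S (suc l) (suc J)
    p = πsum (suc J)
    lemma : ∀ l w v s p → 3 + 3 * l * (s - p) - l * (2 - 2 * l * w * p)
      ≡ 2 * l * (v * ((l + 1) * w) - 1) + 2 * l * (l + 1) * w * (s - v)
        + l * (s - p) * ((1 - 2 * l * w) + 2 * (1 - w)) + (3 - 2 * l * w * p)
    lemma = solve-∀ ring

  wallis : ∀ ε → 0 < ε → Eventually λ l → Eventually λ J → ∣ a l * πsum J - 2 ∣ ≤ ε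
  wallis ε 0<ε = suc (proj₁ N) , atLeast
    where
    -- l times the error is at most 4: the 3 of `aπ-lower`, and 1 for its last term once J is large
    -- enough to make 3lδ ≤ 1.
    N = archimedean (4 * invℚ ε)
    atLeast : ∀ l → suc (proj₁ N) ℕ.≤ l → Eventually λ J → ∣ a l * πsum J - 2 ∣ ≤ ε
    atLeast (suc l) (ℕ.s≤s N≤l) = suc (proj₁ M) , close
      where
      L = ι (suc l)
      M = archimedean (3 * L * K (suc l))
      4≤Lε : 4 ≤ L * ε
      4≤Lε = begin
        4  ≡⟨ sym (ℚ.*-identityʳ 4) ⟩
        4 * 1  ≡⟨ cong (4 *_) (sym (invℚ-pos 0<ε)) ⟩
        4 * (ε * invℚ ε)  ≡⟨ lemma ε (invℚ ε) ⟩
        4 * invℚ ε * ε  ≤⟨ *-monoʳ ε (ℚ.<⇒≤ 0<ε) (ℚ.≤-trans (proj₂ N) (ι-mono (ℕ.m≤n⇒m≤1+n N≤l))) ⟩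
        L * ε  ∎
        where
        open ℚ.≤-Reasoning
        lemma : ∀ x y → 4 * (x * y) ≡ 4 * y * x
        lemma = solve-∀ ring
      close : ∀ J → suc (proj₁ M) ℕ.≤ J → ∣ a (suc l) * πsum J - 2 ∣ ≤ ε
      close (suc J) (ℕ.s≤s M≤J) = ∣∣-≤
        (*-cancel-≤ L (0<ι-suc l) (ℚ.≤-trans (ℚ.≤-trans (aπ-upper l (suc J)) lit≤) 4≤Lε))
        (*-cancel-≤ L (0<ι-suc l) (ℚ.≤-trans (ℚ.≤-reflexive (swap L (a (suc l) * πsum (suc J))))
          (ℚ.≤-trans (aπ-lower l J) (ℚ.≤-trans 3+3Lδ≤4 4≤Lε))))
        where
        δ = S (suc l) (suc J) - πsum (suc J)
        swap : ∀ l x → l * - (x - 2) ≡ l * (2 - x)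
        swap = solve-∀ ring
        3Lδ≤1 : 3 * L * δ ≤ 1
        3Lδ≤1 = *-cancel-≤ (ι (suc J) + 1) (nonNeg+pos (0≤ι (suc J)) lit<) (begin
          (ι (suc J) + 1) * (3 * L * δ)  ≡⟨ reorder (ι (suc J)) L δ ⟩
          3 * L * (δ * (ι (suc J) + 1))  ≤⟨ *-monoˡ (3 * L) (0≤ι 3 ⊛ 0≤ι (suc l)) (S-πsum-decay (suc l) (suc J)) ⟩
          3 * L * K (suc l)  ≤⟨ proj₂ M ⟩
          ι (proj₁ M)  ≤⟨ ι-mono (ℕ.m≤n⇒m≤1+n M≤J) ⟩
          ι (suc J)  ≤⟨ ≤-by 1 lit≤ (plus-one (ι (suc J))) ⟩
          (ι (suc J) + 1) * 1  ∎)
          where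
          open ℚ.≤-Reasoning
          reorder : ∀ j l d → (j + 1) * (3 * l * d) ≡ 3 * l * (d * (j + 1))
          reorder = solve-∀ ring
          plus-one : ∀ x → (x + 1) * 1 - x ≡ 1
          plus-one = solve-∀ ring
        3+3Lδ≤4 : 3 + 3 * L * δ ≤ 4
        3+3Lδ≤4 = ℚ.≤-trans (ℚ.+-monoʳ-≤ 3 3Lδ≤1) lit≤

-- The coefficients (1/4)ₙ(3/4)ₙ/n!² as products of Wallis ratios.

module Coefficients where

  open import Data.Rational.Base using (_+_; _*_; _-_; -_; _≤_; _<_)
  open Rational using (*-pos; *-mono)
  open RationalArithmetic
  open Wallis

  c : ℕ → ℚ
  c n = poch (ℤ.+ 1 ℚ./ 4) n * poch (ℤ.+ 3 ℚ./ 4) n * 1/!² n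

  1/!²-inverse : ∀ n → ι (n ! ℕ.* n !) * 1/!² n ≡ 1
  1/!²-inverse n = inverse (n ! ℕ.* n !) {{ℕ.m*n≢0 (n !) (n !) {{n ℕ.!≢0}} {{n ℕ.!≢0}}}}
    where
    inverse : ∀ m {{_ : ℕ.NonZero m}} → ι m * ((ℤ.+ 1) ℚ./ m) ≡ 1
    inverse (suc m) = /-ι 1 m

  1/!²-suc : ∀ n → (ι n + 1) * (ι n + 1) * 1/!² (suc n) ≡ 1/!² n
  1/!²-suc n = *-cancel-pos (ι (n ! ℕ.* n !)) 0<n!²
    (trans (lemma (ι (n ! ℕ.* n !)) (ι n) (1/!² (suc n)))
      (trans (trans (cong (_* 1/!² (suc n)) (sym split)) (1/!²-inverse (suc n))) (sym (1/!²-inverse n))))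
    where
    0<n!² : 0 < ι (n ! ℕ.* n !)
    0<n!² = 0<ι (n ! ℕ.* n !) {{ℕ.m*n≢0 (n !) (n !) {{n ℕ.!≢0}} {{n ℕ.!≢0}}}}
    split : ι (suc n ! ℕ.* suc n !) ≡ ι (n ! ℕ.* n !) * (ι n + 1) * (ι n + 1)
    split = trans (ι-* (suc n !) (suc n !)) (trans
      (cong (λ x → x * x) (trans (ι-* (suc n) (n !)) (cong (_* ι (n !)) (ι-suc n))))
      (trans (lemma₂ (ι n) (ι (n !))) (cong (λ x → x * (ι n + 1) * (ι n + 1)) (sym (ι-* (n !) (n !))))))
      where
      lemma₂ : ∀ n x → (n + 1) * x * ((n + 1) * x) ≡ x * x * (n + 1) * (n + 1)
      lemma₂ = solve-∀ ring
    lemma : ∀ x n y → x * ((n + 1) * (n + 1) * y) ≡ x * (n + 1) * (n + 1) * y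
    lemma = solve-∀ ring

  -- (n + 1/4)(n + 3/4) = n² + n + 3/16.
  3/16 : ℚ
  3/16 = ℤ.+ 3 ℚ./ 16

  c-suc : ∀ n → (ι n + 1) * (ι n + 1) * c (suc n) ≡ (ι n * ι n + ι n + 3/16) * c n
  c-suc n = by-1 (A * (¼ + ι n) * (B * (¾ + ι n))) (1/!²-suc n) (lemma (ι n) A B (1/!² n) (1/!² (suc n)))
    where
    A = poch (ℤ.+ 1 ℚ./ 4) n
    B = poch (ℤ.+ 3 ℚ./ 4) n
    ¼ = ℤ.+ 1 ℚ./ 4
    ¾ = ℤ.+ 3 ℚ./ 4
    lemma : ∀ n A B u u′ →
      (n + 1) * (n + 1) * (A * ((ℤ.+ 1 ℚ./ 4) + n) * (B * ((ℤ.+ 3 ℚ./ 4) + n)) * u′)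
        - (n * n + n + (ℤ.+ 3 ℚ./ 16)) * (A * B * u)
      ≡ A * ((ℤ.+ 1 ℚ./ 4) + n) * (B * ((ℤ.+ 3 ℚ./ 4) + n)) * ((n + 1) * (n + 1) * u′ - u)
    lemma = solve-∀ ring

  -- The duplication formulas (1/4)ₙ(3/4)ₙ = (1/2)₂ₙ/4ⁿ and (2n)! = 4ⁿ n! (1/2)ₙ, here by comparing
  -- the ratios of consecutive terms.
  c≡ww : ∀ n → c n ≡ w (n ℕ.* 2) * w n
  c≡ww zero    = refl
  c≡ww (suc n) = *-cancel-pos (16 * (N + 1) * (N + 1) * (2 * N + 1)) 0<D
    (by-3 (16 * (2 * N + 1)) (- 1) (16 * (2 * N + 1) * (N * N + N + 3/16)) (c-suc n)
      (cong₂ _*_ w2 (w-suc n)) (c≡ww n)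
      (lemma N (c n) (c (suc n)) (w (n ℕ.* 2)) (w (2 ℕ.+ n ℕ.* 2)) (w n) (w (suc n))))
    where
    N = ι n
    N+1 : 0 < N + 1
    N+1 = nonNeg+pos (0≤ι n) lit<
    0<D : 0 < 16 * (N + 1) * (N + 1) * (2 * N + 1)
    0<D = *-pos (*-pos (*-pos (0<ι 16) N+1) N+1) (0<k·ι+c 2 1 n)
    m = n ℕ.* 2
    at : ∀ k x → ι k ≡ x → (2 * x + 2) * w (suc k) ≡ (2 * x + 1) * w k
    at k .(ι k) refl = w-suc k
    w2 : (4 * N + 2) * (4 * N + 4) * w (2 ℕ.+ m) ≡ (4 * N + 1) * (4 * N + 3) * w m
    w2 = by-2 (4 * N + 2) (4 * N + 3)
      (at (suc m) (N * 2 + 1) (trans (ι-suc m) (cong (_+ 1) (ι-* n 2)))) (at m (N * 2) (ι-* n 2))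
      (lemma₂ N (w m) (w (1 ℕ.+ m)) (w (2 ℕ.+ m)))
      where
      lemma₂ : ∀ n u₀ u₁ u₂ → (4 * n + 2) * (4 * n + 4) * u₂ - (4 * n + 1) * (4 * n + 3) * u₀
        ≡ (4 * n + 2) * ((2 * (n * 2 + 1) + 2) * u₂ - (2 * (n * 2 + 1) + 1) * u₁)
        + (4 * n + 3) * ((2 * (n * 2) + 2) * u₁ - (2 * (n * 2) + 1) * u₀)
      lemma₂ = solve-∀ ring
    lemma : ∀ n c c′ W W′ w w′ →
      16 * (n + 1) * (n + 1) * (2 * n + 1) * c′ - 16 * (n + 1) * (n + 1) * (2 * n + 1) * (W′ * w′)
      ≡ 16 * (2 * n + 1) * ((n + 1) * (n + 1) * c′ - (n * n + n + (ℤ.+ 3 ℚ./ 16)) * c)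
      + - 1 * ((4 * n + 2) * (4 * n + 4) * W′ * ((2 * n + 2) * w′) - (4 * n + 1) * (4 * n + 3) * W * ((2 * n + 1) * w))
      + 16 * (2 * n + 1) * (n * n + n + (ℤ.+ 3 ℚ./ 16)) * (c - W * w)
    lemma = solve-∀ ring

  0<c : ∀ n → 0 < c n
  0<c n = subst (0 <_) (sym (c≡ww n)) (*-pos (0<w (n ℕ.* 2)) (0<w n))

  κ : ℕ → ℚ
  κ n = 2 * ι n * c n

  0≤κ : ∀ n → 0 ≤ κ n
  0≤κ n = 0≤2ι n ⊛ ℚ.<⇒≤ (0<c n)

  -- Both factors on the right tend to 2/π, so κ tends to √2/π; working with the square keeps √2 out
  -- of the rational part.
  2κ² : ∀ n → 2 * (κ n * κ n) ≡ a (n ℕ.* 2) * a n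
  2κ² n = trans (cong (λ x → 2 * (2 * ι n * x * (2 * ι n * x))) (c≡ww n))
    (trans (lemma (ι n) (w (n ℕ.* 2)) (w n))
      (cong (λ x → 2 * x * (w (n ℕ.* 2) * w (n ℕ.* 2)) * a n) (sym (ι-* n 2))))
    where
    lemma : ∀ n W w → 2 * (2 * n * (W * w) * (2 * n * (W * w))) ≡ 2 * (n * 2) * (W * W) * (2 * n * (w * w))
    lemma = solve-∀ ring

  κ≤1 : ∀ n → κ n ≤ 1
  κ≤1 n = square-cancel-≤ lit≤ (*-cancel-≤ 2 lit< (begin
    2 * (κ n * κ n)  ≡⟨ 2κ² n ⟩
    a (n ℕ.* 2) * a n  ≤⟨ *-mono (0≤2ι n ⊛ 0≤-square (w n)) lit≤ (a≤1 (n ℕ.* 2)) (a≤1 n) ⟩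
    1 * 1  ≤⟨ lit≤ ⟩
    2 * (1 * 1)  ∎))
    where open ℚ.≤-Reasoning

-- Symbolic calculus of rational polynomials and a mean value inequality on [0, 1].

module Polynomials where

  open import Data.Rational.Base using (_+_; _*_; _-_; -_; _≤_; _<_; ∣_∣)
  open Rational using (*-pos; *-mono)
  open RationalArithmetic

  infixl 6 _⊞_ _⊟_
  infixl 7 _⊠_

  -- Polynomials are kept as syntax so that derivatives, second differences and bounds are found by
  -- recursion and no limit is involved in differentiating.
  data Poly : Set where
    X           : Poly
    con         : ℚ → Poly
    _⊞_ _⊟_ _⊠_ : Poly → Poly → Poly

  ⟦_⟧ : Poly → ℚ → ℚ
  ⟦ X ⟧     x = x
  ⟦ con a ⟧ x = a
  ⟦ e ⊞ f ⟧ x = ⟦ e ⟧ x + ⟦ f ⟧ x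
  ⟦ e ⊟ f ⟧ x = ⟦ e ⟧ x - ⟦ f ⟧ x
  ⟦ e ⊠ f ⟧ x = ⟦ e ⟧ x * ⟦ f ⟧ x

  ∂ : Poly → ℚ → ℚ
  ∂ X       x = 1
  ∂ (con a) x = 0
  ∂ (e ⊞ f) x = ∂ e x + ∂ f x
  ∂ (e ⊟ f) x = ∂ e x - ∂ f x
  ∂ (e ⊠ f) x = ∂ e x * ⟦ f ⟧ x + ⟦ e ⟧ x * ∂ f x

  _[_] : Poly → Poly → Poly
  X       [ g ] = g
  con a   [ g ] = con a
  (e ⊞ f) [ g ] = e [ g ] ⊞ f [ g ]
  (e ⊟ f) [ g ] = e [ g ] ⊟ f [ g ]
  (e ⊠ f) [ g ] = e [ g ] ⊠ f [ g ]

  ⟦⟧-[] : ∀ e g x → ⟦ e [ g ] ⟧ x ≡ ⟦ e ⟧ (⟦ g ⟧ x)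
  ⟦⟧-[] X       g x = refl
  ⟦⟧-[] (con a) g x = refl
  ⟦⟧-[] (e ⊞ f) g x = cong₂ _+_ (⟦⟧-[] e g x) (⟦⟧-[] f g x)
  ⟦⟧-[] (e ⊟ f) g x = cong₂ _-_ (⟦⟧-[] e g x) (⟦⟧-[] f g x)
  ⟦⟧-[] (e ⊠ f) g x = cong₂ _*_ (⟦⟧-[] e g x) (⟦⟧-[] f g x)

  ∂-[] : ∀ e g x → ∂ (e [ g ]) x ≡ ∂ e (⟦ g ⟧ x) * ∂ g x
  ∂-[] X       g x = sym (ℚ.*-identityˡ (∂ g x))
  ∂-[] (con a) g x = sym (ℚ.*-zeroˡ (∂ g x))
  ∂-[] (e ⊞ f) g x = trans (cong₂ _+_ (∂-[] e g x) (∂-[] f g x))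
    (sym (ℚ.*-distribʳ-+ (∂ g x) (∂ e (⟦ g ⟧ x)) (∂ f (⟦ g ⟧ x))))
  ∂-[] (e ⊟ f) g x = trans (cong₂ _-_ (∂-[] e g x) (∂-[] f g x))
    (lemma (∂ g x) (∂ e (⟦ g ⟧ x)) (∂ f (⟦ g ⟧ x)))
    where
    lemma : ∀ z u v → u * z - v * z ≡ (u - v) * z
    lemma = solve-∀ ring
  ∂-[] (e ⊠ f) g x = trans
    (cong₂ _+_ (cong₂ _*_ (∂-[] e g x) (⟦⟧-[] f g x)) (cong₂ _*_ (⟦⟧-[] e g x) (∂-[] f g x)))
    (lemma (∂ g x) (∂ e (⟦ g ⟧ x)) (∂ f (⟦ g ⟧ x)) (⟦ e ⟧ (⟦ g ⟧ x)) (⟦ f ⟧ (⟦ g ⟧ x)))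
    where
    lemma : ∀ z u v p q → u * z * q + p * (v * z) ≡ (u * q + p * v) * z
    lemma = solve-∀ ring

  pow : Poly → ℕ → Poly
  pow e zero    = con 1
  pow e (suc n) = e ⊠ pow e n

  ⟦pow⟧ : ∀ e n x → ⟦ pow e n ⟧ x ≡ ⟦ e ⟧ x ↑ n
  ⟦pow⟧ e zero    x = refl
  ⟦pow⟧ e (suc n) x = cong (⟦ e ⟧ x *_) (⟦pow⟧ e n x)

  ∂-pow : ∀ e n x → ∂ (pow e (suc n)) x ≡ (ι n + 1) * (⟦ e ⟧ x ↑ n * ∂ e x)
  ∂-pow e zero x = lemma (∂ e x) (⟦ e ⟧ x)
    where
    lemma : ∀ e′ e → e′ * 1 + e * 0 ≡ (0 + 1) * (1 * e′)
    lemma = solve-∀ ring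
  ∂-pow e (suc n) x = trans
    (cong₂ (λ y z → ∂ e x * (⟦ e ⟧ x * y) + ⟦ e ⟧ x * z) (⟦pow⟧ e n x) (∂-pow e n x))
    (trans (lemma (ι n) (∂ e x) (⟦ e ⟧ x) (⟦ e ⟧ x ↑ n))
      (cong (λ m → (m + 1) * (⟦ e ⟧ x * ⟦ e ⟧ x ↑ n * ∂ e x)) (sym (ι-suc n))))
    where
    lemma : ∀ n e′ e y → e′ * (e * y) + e * ((n + 1) * (y * e′)) ≡ (n + 1 + 1) * (e * y * e′)
    lemma = solve-∀ ring

  -- The second divided difference (e(y) - e(x) - (y - x) e′(x)) / (y - x)².
  curve : Poly → ℚ → ℚ → ℚ
  curve X       x y = 0
  curve (con a) x y = 0
  curve (e ⊞ f) x y = curve e x y + curve f x y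
  curve (e ⊟ f) x y = curve e x y - curve f x y
  curve (e ⊠ f) x y = curve e x y * ⟦ f ⟧ y + ⟦ e ⟧ x * curve f x y
    + ∂ e x * (∂ f x + (y - x) * curve f x y)

  taylor : ∀ e x y → ⟦ e ⟧ y ≡ ⟦ e ⟧ x + (y - x) * (∂ e x + (y - x) * curve e x y)
  taylor X x y = lemma x y
    where
    lemma : ∀ x y → y ≡ x + (y - x) * (1 + (y - x) * 0)
    lemma = solve-∀ ring
  taylor (con a) x y = lemma a x y
    where
    lemma : ∀ a x y → a ≡ a + (y - x) * (0 + (y - x) * 0)
    lemma = solve-∀ ring
  taylor (e ⊞ f) x y = by-2 1 1 (taylor e x y) (taylor f x y)
    (lemma (y - x) (⟦ e ⟧ y) (⟦ e ⟧ x) (∂ e x) (curve e x y) (⟦ f ⟧ y) (⟦ f ⟧ x) (∂ f x) (curve f x y))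
    where
    lemma : ∀ h e₁ e e′ r f₁ f f′ s → e₁ + f₁ - (e + f + h * (e′ + f′ + h * (r + s)))
      ≡ 1 * (e₁ - (e + h * (e′ + h * r))) + 1 * (f₁ - (f + h * (f′ + h * s)))
    lemma = solve-∀ ring
  taylor (e ⊟ f) x y = by-2 1 (- 1) (taylor e x y) (taylor f x y)
    (lemma (y - x) (⟦ e ⟧ y) (⟦ e ⟧ x) (∂ e x) (curve e x y) (⟦ f ⟧ y) (⟦ f ⟧ x) (∂ f x) (curve f x y))
    where
    lemma : ∀ h e₁ e e′ r f₁ f f′ s → e₁ - f₁ - (e - f + h * (e′ - f′ + h * (r - s)))
      ≡ 1 * (e₁ - (e + h * (e′ + h * r))) + - 1 * (f₁ - (f + h * (f′ + h * s)))
    lemma = solve-∀ ring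
  taylor (e ⊠ f) x y = by-2 (⟦ f ⟧ y) (⟦ e ⟧ x + (y - x) * ∂ e x) (taylor e x y) (taylor f x y)
    (lemma (y - x) (⟦ e ⟧ y) (⟦ e ⟧ x) (∂ e x) (curve e x y) (⟦ f ⟧ y) (⟦ f ⟧ x) (∂ f x) (curve f x y))
    where
    lemma : ∀ h e₁ e e′ r f₁ f f′ s →
      e₁ * f₁ - (e * f + h * (e′ * f + e * f′ + h * (r * f₁ + e * s + e′ * (f′ + h * s))))
      ≡ f₁ * (e₁ - (e + h * (e′ + h * r))) + (e + h * e′) * (f₁ - (f + h * (f′ + h * s)))
    lemma = solve-∀ ring

  InUnit : ℚ → Set
  InUnit x = 0 ≤ x × x ≤ 1

  ∣+∣≤ : ∀ {u v b c} → ∣ u ∣ ≤ b → ∣ v ∣ ≤ c → ∣ u + v ∣ ≤ b + c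
  ∣+∣≤ {u} {v} p q = ℚ.≤-trans (ℚ.∣p+q∣≤∣p∣+∣q∣ u v) (ℚ.+-mono-≤ p q)

  ∣-∣≤ : ∀ {u v b c} → ∣ u ∣ ≤ b → ∣ v ∣ ≤ c → ∣ u - v ∣ ≤ b + c
  ∣-∣≤ {u} {v} p q = ∣+∣≤ {u} { - v} p (subst (_≤ _) (sym (ℚ.∣-p∣≡∣p∣ v)) q)

  ∣*∣≤ : ∀ {u v b c} → ∣ u ∣ ≤ b → ∣ v ∣ ≤ c → ∣ u * v ∣ ≤ b * c
  ∣*∣≤ {u} {v} p q = subst (_≤ _) (sym (ℚ.∣p*q∣≡∣p∣*∣q∣ u v))
    (*-mono (ℚ.0≤∣p∣ v) (ℚ.≤-trans (ℚ.0≤∣p∣ u) p) p q)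

  ∣0∣≤ : ∣ 0ℚ ∣ ≤ 0ℚ
  ∣0∣≤ = ℚ.≤-refl

  unit-∣∣ : ∀ {x} → InUnit x → ∣ x ∣ ≤ 1
  unit-∣∣ {x} (0≤x , x≤1) = subst (_≤ 1) (sym (ℚ.0≤p⇒∣p∣≡p 0≤x)) x≤1

  bound : ∀ e → ∃ λ b → ∀ x → InUnit x → ∣ ⟦ e ⟧ x ∣ ≤ b
  bound X       = 1 , λ x → unit-∣∣
  bound (con a) = ∣ a ∣ , λ x _ → ℚ.≤-refl
  bound (e ⊞ f) = let b , p = bound e ; c , q = bound f in
    b + c , λ x i → ∣+∣≤ {⟦ e ⟧ x} (p x i) (q x i)
  bound (e ⊟ f) = let b , p = bound e ; c , q = bound f in
    b + c , λ x i → ∣-∣≤ {⟦ e ⟧ x} (p x i) (q x i)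
  bound (e ⊠ f) = let b , p = bound e ; c , q = bound f in
    b * c , λ x i → ∣*∣≤ {⟦ e ⟧ x} (p x i) (q x i)

  ∂-bound : ∀ e → ∃ λ b → ∀ x → InUnit x → ∣ ∂ e x ∣ ≤ b
  ∂-bound X       = 1 , λ x _ → ℚ.≤-refl
  ∂-bound (con a) = 0 , λ x _ → ∣0∣≤
  ∂-bound (e ⊞ f) = let b , p = ∂-bound e ; c , q = ∂-bound f in
    b + c , λ x i → ∣+∣≤ {∂ e x} (p x i) (q x i)
  ∂-bound (e ⊟ f) = let b , p = ∂-bound e ; c , q = ∂-bound f in
    b + c , λ x i → ∣-∣≤ {∂ e x} (p x i) (q x i)
  ∂-bound (e ⊠ f) =
    let b , p = bound e ; c , q = bound f ; b′ , p′ = ∂-bound e ; c′ , q′ = ∂-bound f in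
    b′ * c + b * c′ , λ x i →
      ∣+∣≤ {∂ e x * ⟦ f ⟧ x} (∣*∣≤ {∂ e x} (p′ x i) (q x i)) (∣*∣≤ {⟦ e ⟧ x} (p x i) (q′ x i))

  -- Recursion gives a crude constant, but one uniform in both points, which is enough: refining the
  -- subdivision below beats any constant.
  curve-bound : ∀ e → ∃ λ b → ∀ x y → InUnit x → InUnit y → ∣ curve e x y ∣ ≤ b
  curve-bound X       = 0 , λ x y _ _ → ∣0∣≤
  curve-bound (con a) = 0 , λ x y _ _ → ∣0∣≤
  curve-bound (e ⊞ f) = let b , p = curve-bound e ; c , q = curve-bound f in
    b + c , λ x y i j → ∣+∣≤ {curve e x y} (p x y i j) (q x y i j)
  curve-bound (e ⊟ f) = let b , p = curve-bound e ; c , q = curve-bound f in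
    b + c , λ x y i j → ∣-∣≤ {curve e x y} (p x y i j) (q x y i j)
  curve-bound (e ⊠ f) =
    let b , p = bound e ; c , q = bound f ; b′ , p′ = ∂-bound e ; c′ , q′ = ∂-bound f
        r , s = curve-bound e ; t , u = curve-bound f in
    r * c + b * t + b′ * (c′ + (1 + 1) * t) , λ x y i j →
      ∣+∣≤ {curve e x y * ⟦ f ⟧ y + ⟦ e ⟧ x * curve f x y}
        (∣+∣≤ {curve e x y * ⟦ f ⟧ y} (∣*∣≤ {curve e x y} (s x y i j) (q y j))
          (∣*∣≤ {⟦ e ⟧ x} (p x i) (u x y i j)))
        (∣*∣≤ {∂ e x} (p′ x i) (∣+∣≤ {∂ f x} (q′ x i)
          (∣*∣≤ {y - x} (∣-∣≤ {y} (unit-∣∣ j) (unit-∣∣ i)) (u x y i j))))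

  module Subdivision (e : Poly) {u v} (0≤u : 0 ≤ u) (u<v : u < v) (v≤1 : v ≤ 1)
    (0≤∂ : ∀ x → u ≤ x → x < v → 0 ≤ ∂ e x) (m : ℕ) where

    M h : ℚ
    M = proj₁ (curve-bound e)
    h = (v - u) * invℚ (ι (suc m))

    0<h : 0 < h
    0<h = *-pos (0<-diff u<v) (0<invℚ (0<ι-suc m))

    mh : ι (suc m) * h ≡ v - u
    mh = by-1 (v - u) (invℚ-pos (0<ι-suc m)) (lemma (ι (suc m)) (v - u) (invℚ (ι (suc m))))
      where
      lemma : ∀ m d i → m * (d * i) - d ≡ d * (m * i - 1)
      lemma = solve-∀ ring

    point : ℕ → ℚ
    point i = u + ι i * h

    u≤point : ∀ i → u ≤ point i
    u≤point i = ≤-by (ι i * h) (0≤ι i ⊛ ℚ.<⇒≤ 0<h) (lemma u (ι i * h))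
      where
      lemma : ∀ u x → u + x - u ≡ x
      lemma = solve-∀ ring

    last : point (suc m) ≡ v
    last = trans (cong (u +_) mh) (lemma u v)
      where
      lemma : ∀ u v → u + (v - u) ≡ v
      lemma = solve-∀ ring

    point-mono : ∀ {i j} → i ℕ.≤ j → point i ≤ point j
    point-mono i≤j = ℚ.+-monoʳ-≤ u (*-monoʳ h (ℚ.<⇒≤ 0<h) (ι-mono i≤j))

    point-suc : ∀ i → point (suc i) ≡ point i + h
    point-suc i = trans (cong (λ x → u + x * h) (ι-suc i)) (lemma u (ι i) h)
      where
      lemma : ∀ u i h → u + (i + 1) * h ≡ u + i * h + h
      lemma = solve-∀ ring

    point<v : ∀ {i} → i ℕ.≤ m → point i < v
    point<v {i} i≤m = ℚ.<-≤-trans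
      (<-by h 0<h (trans (cong (_- point i) (point-suc i)) (lemma (point i) h)))
      (ℚ.≤-trans (point-mono (ℕ.s≤s i≤m)) (ℚ.≤-reflexive last))
      where
      lemma : ∀ x h → x + h - x ≡ h
      lemma = solve-∀ ring

    inUnit : ∀ {i} → i ℕ.≤ suc m → InUnit (point i)
    inUnit {i} i≤ = ℚ.≤-trans 0≤u (u≤point i)
      , ℚ.≤-trans (point-mono i≤) (ℚ.≤-trans (ℚ.≤-reflexive last) v≤1)

    -- On one piece the first-order term of Taylor's formula has the right sign and the second-order
    -- term loses at most M h²; the losses add up over the pieces.
    drop : ∀ i → i ℕ.≤ suc m → ⟦ e ⟧ u - ⟦ e ⟧ (point i) ≤ ι i * (M * (h * h))
    drop zero _ = ℚ.≤-reflexive (trans (cong (λ x → ⟦ e ⟧ u - ⟦ e ⟧ x) (start u h))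
      (lemma (⟦ e ⟧ u) (M * (h * h))))
      where
      start : ∀ u h → u + 0 * h ≡ u
      start = solve-∀ ring
      lemma : ∀ x y → x - x ≡ 0 * y
      lemma = solve-∀ ring
    drop (suc i) (ℕ.s≤s i≤m) = begin
      ⟦ e ⟧ u - ⟦ e ⟧ (point (suc i))
        ≡⟨ cong (λ z → ⟦ e ⟧ u - z) (taylor e x y) ⟩
      ⟦ e ⟧ u - (⟦ e ⟧ x + (y - x) * (∂ e x + (y - x) * curve e x y))
        ≡⟨ cong (λ z → ⟦ e ⟧ u - (⟦ e ⟧ x + z * (∂ e x + z * curve e x y)))
             (trans (cong (_- x) (point-suc i)) (cancel x h)) ⟩
      ⟦ e ⟧ u - (⟦ e ⟧ x + h * (∂ e x + h * curve e x y))
        ≤⟨ ≤-by (h * ∂ e x + h * h * (M + curve e x y))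
             (ℚ.<⇒≤ 0<h ⊛ 0≤∂ x (u≤point i) (point<v i≤m)
               ⊹ ℚ.<⇒≤ 0<h ⊛ ℚ.<⇒≤ 0<h ⊛ 0≤M+curve)
             (expand (⟦ e ⟧ u) (⟦ e ⟧ x) h (∂ e x) (curve e x y) M) ⟩
      (⟦ e ⟧ u - ⟦ e ⟧ x) + M * (h * h)
        ≤⟨ ℚ.+-monoˡ-≤ (M * (h * h)) (drop i (ℕ.m≤n⇒m≤1+n i≤m)) ⟩
      ι i * (M * (h * h)) + M * (h * h)
        ≡⟨ collect (ι i) (M * (h * h)) ⟩
      (ι i + 1) * (M * (h * h))
        ≡⟨ cong (_* (M * (h * h))) (sym (ι-suc i)) ⟩
      ι (suc i) * (M * (h * h)) ∎
      where
      open ℚ.≤-Reasoning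
      x y : ℚ
      x = point i
      y = point (suc i)
      cancel : ∀ x h → x + h - x ≡ h
      cancel = solve-∀ ring
      collect : ∀ i z → i * z + z ≡ (i + 1) * z
      collect = solve-∀ ring
      expand : ∀ e₀ e h e′ r m →
        e₀ - e + m * (h * h) - (e₀ - (e + h * (e′ + h * r))) ≡ h * e′ + h * h * (m + r)
      expand = solve-∀ ring
      0≤M+curve : 0 ≤ M + curve e x y
      0≤M+curve = subst (0 ≤_) (double-neg M (curve e x y)) (0≤-diff (-≤-∣∣
        (proj₂ (curve-bound e) x y (inUnit (ℕ.m≤n⇒m≤1+n i≤m)) (inUnit (ℕ.s≤s i≤m)))))
        where
        double-neg : ∀ m r → m - - r ≡ m + r
        double-neg = solve-∀ ring

    total-drop : ι (suc m) * (⟦ e ⟧ u - ⟦ e ⟧ v) ≤ M * ((v - u) * (v - u))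
    total-drop = ℚ.≤-trans
      (*-monoˡ (ι (suc m)) (0≤ι (suc m))
        (subst (λ z → ⟦ e ⟧ u - ⟦ e ⟧ z ≤ ι (suc m) * (M * (h * h))) last (drop (suc m) ℕ.≤-refl)))
      (ℚ.≤-reflexive (trans (lemma (ι (suc m)) M h) (cong (λ z → M * (z * z)) mh)))
      where
      lemma : ∀ m M h → m * (m * (M * (h * h))) ≡ M * (m * h * (m * h))
      lemma = solve-∀ ring

  nondecreasing : ∀ e {u v} → 0 ≤ u → u ≤ v → v ≤ 1 →
    (∀ x → u ≤ x → x < v → 0 ≤ ∂ e x) → ⟦ e ⟧ u ≤ ⟦ e ⟧ v
  nondecreasing e {u} {v} 0≤u u≤v v≤1 0≤∂ with ℚ.<-cmp u v
  ... | tri≈ _ refl _ = ℚ.≤-refl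
  ... | tri> _ _ v<u  = ⊥-elim (ℚ.<-irrefl refl (ℚ.<-≤-trans v<u u≤v))
  ... | tri< u<v _ _  = ℚ.≮⇒≥ λ ev<eu →
    let g = ⟦ e ⟧ u - ⟦ e ⟧ v
        0<g = 0<-diff ev<eu
        N , p = archimedean (C * invℚ g)
        open ℚ.≤-Reasoning
    in ℚ.<-irrefl refl (begin-strict
      C  ≡⟨ sym (ℚ.*-identityʳ C) ⟩
      C * 1  ≡⟨ cong (C *_) (sym (invℚ-pos 0<g)) ⟩
      C * (g * invℚ g)  ≡⟨ lemma C g (invℚ g) ⟩
      C * invℚ g * g  ≤⟨ *-monoʳ g (ℚ.<⇒≤ 0<g) p ⟩
      ι N * g  <⟨ <-by g 0<g (trans (cong (λ x → x * g - ι N * g) (ι-suc N)) (step (ι N) g)) ⟩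
      ι (suc N) * g  ≤⟨ Subdivision.total-drop e 0≤u u<v v≤1 0≤∂ N ⟩
      C  ∎)
    where
    C = proj₁ (curve-bound e) * ((v - u) * (v - u))
    lemma : ∀ c g i → c * (g * i) ≡ c * i * g
    lemma = solve-∀ ring
    step : ∀ n g → (n + 1) * g - n * g ≡ g
    step = solve-∀ ring

  mean-value : ∀ f g {u v} → 0 ≤ u → u ≤ v → v ≤ 1 →
    (∀ x → u ≤ x → x < v → ∣ ∂ f x ∣ ≤ ∂ g x) → ∣ ⟦ f ⟧ v - ⟦ f ⟧ u ∣ ≤ ⟦ g ⟧ v - ⟦ g ⟧ u
  mean-value f g {u} {v} 0≤u u≤v v≤1 ∣∂f∣≤∂g = ∣∣-≤
    (≤-by (⟦ g ⊟ f ⟧ v - ⟦ g ⊟ f ⟧ u)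
      (0≤-diff (nondecreasing (g ⊟ f) 0≤u u≤v v≤1 λ x u≤x x<v → 0≤-diff (≤-∣∣ (∣∂f∣≤∂g x u≤x x<v))))
      (lemma₁ (⟦ f ⟧ u) (⟦ f ⟧ v) (⟦ g ⟧ u) (⟦ g ⟧ v)))
    (≤-by (⟦ g ⊞ f ⟧ v - ⟦ g ⊞ f ⟧ u)
      (0≤-diff (nondecreasing (g ⊞ f) 0≤u u≤v v≤1 λ x u≤x x<v →
        subst (0 ≤_) (lemma₃ (∂ g x) (∂ f x)) (0≤-diff (-≤-∣∣ (∣∂f∣≤∂g x u≤x x<v)))))
      (lemma₂ (⟦ f ⟧ u) (⟦ f ⟧ v) (⟦ g ⟧ u) (⟦ g ⟧ v)))
    where
    lemma₁ : ∀ a b c d → d - c - (b - a) ≡ d - b - (c - a)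
    lemma₁ = solve-∀ ring
    lemma₂ : ∀ a b c d → d - c - - (b - a) ≡ d + b - (c + a)
    lemma₂ = solve-∀ ring
    lemma₃ : ∀ x y → x - - y ≡ x + y
    lemma₃ = solve-∀ ring

-- Bonnet's recurrence for Pₙ(x) zⁿ as polynomials in q, and two-sided bounds.

module Recurrence where

  open import Data.Rational.Base using (_+_; _*_; _-_; -_; _≤_; _<_)
  open Rational using (*-pos)
  open RationalArithmetic
  open Polynomials

  -- The recurrence of the sequence n ↦ Pₙ(x) zⁿ in terms of s = xz and d = z².
  rec : ℚ → ℚ → ℕ → ℚ
  rec s d zero          = 1ℚ
  rec s d (suc zero)    = s
  rec s d (suc (suc n)) = ((2 * ι n + 3) * s * rec s d (suc n) - (ι n + 1) * d * rec s d n) * invℚ (ι n + 2)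

  0<ι+2 : ∀ n → 0 < ι n + 2
  0<ι+2 n = nonNeg+pos (0≤ι n) lit<

  rec-step : ∀ s d n → (ι n + 2) * rec s d (suc (suc n))
    ≡ (2 * ι n + 3) * s * rec s d (suc n) - (ι n + 1) * d * rec s d n
  rec-step s d n = by-1 ((2 * ι n + 3) * s * rec s d (suc n) - (ι n + 1) * d * rec s d n) (invℚ-pos (0<ι+2 n))
    (lemma (ι n + 2) (invℚ (ι n + 2)) ((2 * ι n + 3) * s * rec s d (suc n) - (ι n + 1) * d * rec s d n))
    where
    lemma : ∀ a b r → a * (r * b) - r ≡ r * (a * b - 1)
    lemma = solve-∀ ring

  recPoly : Poly → Poly → ℕ → Poly
  recPoly s d zero          = con 1ℚ
  recPoly s d (suc zero)    = s
  recPoly s d (suc (suc n)) =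
    (con (2 * ι n + 3) ⊠ s ⊠ recPoly s d (suc n) ⊟ con (ι n + 1) ⊠ d ⊠ recPoly s d n) ⊠ con (invℚ (ι n + 2))

  ⟦recPoly⟧ : ∀ s d n x → ⟦ recPoly s d n ⟧ x ≡ rec (⟦ s ⟧ x) (⟦ d ⟧ x) n
  ⟦recPoly⟧ s d zero          x = refl
  ⟦recPoly⟧ s d (suc zero)    x = refl
  ⟦recPoly⟧ s d (suc (suc n)) x = cong₂
    (λ u v → ((2 * ι n + 3) * ⟦ s ⟧ x * u - (ι n + 1) * ⟦ d ⟧ x * v) * invℚ (ι n + 2))
    (⟦recPoly⟧ s d (suc n) x) (⟦recPoly⟧ s d n x)

  ∂-rec-step : ∀ s d n x → (ι n + 2) * ∂ (recPoly s d (suc (suc n))) x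
    ≡ (2 * ι n + 3) * (∂ s x * ⟦ recPoly s d (suc n) ⟧ x + ⟦ s ⟧ x * ∂ (recPoly s d (suc n)) x)
      - (ι n + 1) * (∂ d x * ⟦ recPoly s d n ⟧ x + ⟦ d ⟧ x * ∂ (recPoly s d n) x)
  ∂-rec-step s d n x = by-1
    ((2 * ι n + 3) * (∂ s x * ⟦ recPoly s d (suc n) ⟧ x + ⟦ s ⟧ x * ∂ (recPoly s d (suc n)) x)
      - (ι n + 1) * (∂ d x * ⟦ recPoly s d n ⟧ x + ⟦ d ⟧ x * ∂ (recPoly s d n) x))
    (invℚ-pos (0<ι+2 n))
    (lemma (ι n + 2) (invℚ (ι n + 2)) (2 * ι n + 3) (ι n + 1) (⟦ s ⟧ x) (∂ s x) (⟦ d ⟧ x) (∂ d x)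
      (⟦ recPoly s d (suc n) ⟧ x) (∂ (recPoly s d (suc n)) x) (⟦ recPoly s d n ⟧ x) (∂ (recPoly s d n) x))
    where
    lemma : ∀ m i a b s s′ d d′ p p′ o o′ →
      m * ((((0 * s + a * s′) * p + a * s * p′) - ((0 * d + b * d′) * o + b * d * o′)) * i
        + (a * s * p - b * d * o) * 0)
      - (a * (s′ * p + s * p′) - b * (d′ * o + d * o′))
      ≡ (a * (s′ * p + s * p′) - b * (d′ * o + d * o′)) * (m * i - 1)
    lemma = solve-∀ ring

  σ d : ℚ → ℚ
  σ q = (1 - q) * (1 - 7 * q)
  d q = (1 - 9 * q) * (1 - q) * ((1 - 3 * q) * (1 - 3 * q))

  -- `P₋` at 0 is a default for the index -1: it only ever occurs multiplied by n = 0.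
  P P₋ : ℕ → ℚ → ℚ
  P n q = rec (σ q) (d q) n
  P₋ zero    q = 0
  P₋ (suc n) q = P n q

  P-step : ∀ n q → (ι n + 1) * P (suc n) q ≡ (2 * ι n + 1) * σ q * P n q - ι n * d q * P₋ n q
  P-step zero    q = lemma (σ q) (d q)
    where
    lemma : ∀ s d → (0 + 1) * s ≡ (2 * 0 + 1) * s * 1 - 0 * d * 0
    lemma = solve-∀ ring
  P-step (suc n) q = subst (λ m → (m + 1) * P (suc (suc n)) q
      ≡ (2 * m + 1) * σ q * P (suc n) q - m * d q * P n q) (sym (ι-suc n))
    (by-1 1 (rec-step (σ q) (d q) n) (lemma (ι n) (σ q) (d q) (P (suc (suc n)) q) (P (suc n) q) (P n q)))
    where
    lemma : ∀ n s d p₂ p₁ p₀ → (n + 1 + 1) * p₂ - ((2 * (n + 1) + 1) * s * p₁ - (n + 1) * d * p₀)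
      ≡ 1 * ((n + 2) * p₂ - ((2 * n + 3) * s * p₁ - (n + 1) * d * p₀))
    lemma = solve-∀ ring

  module Bounds {q} (0≤q : 0 ≤ q) (9q≤1 : 9 * q ≤ 1) where

    r : ℚ
    r = 1 - 4 * q

    0≤1-9q : 0 ≤ 1 - 9 * q
    0≤1-9q = 0≤-diff 9q≤1

    0≤1-kq : ∀ k {k≤9 : True (ι k ℚ.≤? 9)} → 0 ≤ 1 - ι k * q
    0≤1-kq k {k≤9} = ℚ.≤-trans 0≤1-9q (≤-by ((9 - ι k) * q)
      (0≤-diff (toWitness k≤9) ⊛ 0≤q) (lemma (ι k) q))
      where
      lemma : ∀ k q → 1 - k * q - (1 - 9 * q) ≡ (9 - k) * q
      lemma = solve-∀ ring

    0≤1-q : 0 ≤ 1 - q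
    0≤1-q = subst (λ x → 0 ≤ 1 - x) (ℚ.*-identityˡ q) (0≤1-kq 1)

    0≤r : 0 ≤ r
    0≤r = 0≤1-kq 4

    1≤2r : 1 ≤ 2 * r
    1≤2r = ≤-by (1 - 8 * q) (0≤1-kq 8) (lemma q)
      where
      lemma : ∀ q → 2 * (1 - 4 * q) - 1 ≡ 1 - 8 * q
      lemma = solve-∀ ring

    0<r : 0 < r
    0<r = ℚ.*-cancelˡ-<-nonNeg 2 (ℚ.<-≤-trans lit< 1≤2r)

    0≤σ : 0 ≤ σ q
    0≤σ = 0≤1-q ⊛ 0≤1-kq 7

    0≤d : 0 ≤ d q
    0≤d = 0≤1-9q ⊛ 0≤1-q ⊛ 0≤-square (1 - 3 * q)

    σ≤r : σ q ≤ r
    σ≤r = ≤-by (q * (4 - 7 * q))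
      (0≤q ⊛ ℚ.≤-trans (0≤1-kq 7) (≤-by 3 lit≤ (lemma₁ q))) (lemma₂ q)
      where
      lemma₁ : ∀ q → 4 - 7 * q - (1 - 7 * q) ≡ 3
      lemma₁ = solve-∀ ring
      lemma₂ : ∀ q → 1 - 4 * q - (1 - q) * (1 - 7 * q) ≡ q * (4 - 7 * q)
      lemma₂ = solve-∀ ring

    -- t² - 2σt + d is the limiting characteristic polynomial of the recurrence. Together with σ ≤ r
    -- this places r above its larger root σ + √(σ² - d).
    r-dominates : 0 ≤ r * r - 2 * σ q * r + d q
    r-dominates = subst (0 ≤_) (lemma q) (0≤q ⊛ 0≤q ⊛ (0≤ι 5 ⊹ 0≤ι 11 ⊛ 0≤1-kq 8 ⊹ 0≤ι 81 ⊛ 0≤q ⊛ 0≤q))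
      where
      lemma : ∀ q → q * q * (5 + 11 * (1 - 8 * q) + 81 * q * q)
        ≡ (1 - 4 * q) * (1 - 4 * q) - 2 * ((1 - q) * (1 - 7 * q)) * (1 - 4 * q)
          + (1 - 9 * q) * (1 - q) * ((1 - 3 * q) * (1 - 3 * q))
      lemma = solve-∀ ring

    σ²-d : σ q * σ q - d q ≡ 32 * (q * q * q) * (1 - q)
    σ²-d = lemma q
      where
      lemma : ∀ q → (1 - q) * (1 - 7 * q) * ((1 - q) * (1 - 7 * q))
        - (1 - 9 * q) * (1 - q) * ((1 - 3 * q) * (1 - 3 * q)) ≡ 32 * (q * q * q) * (1 - q)
      lemma = solve-∀ ring

    q³ : ℚ
    q³ = q * q * q

    0≤q³ : 0 ≤ q³
    0≤q³ = 0≤q ⊛ 0≤q ⊛ 0≤q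

    0≤σ²-d : 0 ≤ σ q * σ q - d q
    0≤σ²-d = subst (0 ≤_) (sym σ²-d) (0≤ι 32 ⊛ 0≤q³ ⊛ 0≤1-q)

    -- The defect P(n + 1) - σ P(n) obeys a recurrence of its own with the source (σ² - d) P(n). The
    -- two claims need each other: the source is nonnegative only if P(n) is.
    P-lower : ∀ n → 0 ≤ P n q × σ q * P n q ≤ P (suc n) q
    P-lower zero    = lit≤ , ℚ.≤-reflexive (ℚ.*-identityʳ (σ q))
    P-lower (suc n) = 0≤p₁ , *-cancel-≤ (ι n + 2) (0<ι+2 n)
      (≤-by ((ι n + 1) * (σ q * (P (suc n) q - σ q * P n q) + (σ q * σ q - d q) * P n q))
        ((0≤ι n ⊹ 0≤ι 1) ⊛ (0≤σ ⊛ 0≤-diff σp₀≤p₁ ⊹ 0≤σ²-d ⊛ 0≤p₀))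
        (by-1 1 (rec-step (σ q) (d q) n) (lemma (ι n) (σ q) (d q) (P (suc (suc n)) q) (P (suc n) q) (P n q))))
      where
      0≤p₀ = proj₁ (P-lower n)
      σp₀≤p₁ = proj₂ (P-lower n)
      0≤p₁ = ℚ.≤-trans (0≤σ ⊛ 0≤p₀) σp₀≤p₁
      lemma : ∀ n s d p₂ p₁ p₀ → (n + 2) * p₂ - (n + 2) * (s * p₁)
        - (n + 1) * (s * (p₁ - s * p₀) + (s * s - d) * p₀)
        ≡ 1 * ((n + 2) * p₂ - ((2 * n + 3) * s * p₁ - (n + 1) * d * p₀))
      lemma = solve-∀ ring

    0≤P : ∀ n → 0 ≤ P n q
    0≤P n = proj₁ (P-lower n)

    -- The recurrence subtracts a multiple of P(n), so an upper bound on P(n) alone would not close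
    -- the induction; the ratio provides the lower bound P(n) ≥ P(n + 1)/r.
    P-ratio : ∀ n → P (suc n) q ≤ r * P n q
    P-ratio zero    = ℚ.≤-trans σ≤r (ℚ.≤-reflexive (sym (ℚ.*-identityʳ r)))
    P-ratio (suc n) = *-cancel-≤ (r * (ι n + 2)) (*-pos 0<r (0<ι+2 n))
      (≤-by ((ι n + 1) * d q * (r * P n q - P (suc n) q)
          + P (suc n) q * ((ι n + 1) * (r * r - 2 * σ q * r + d q) + r * (r - σ q)))
        ((0≤ι n ⊹ 0≤ι 1) ⊛ 0≤d ⊛ 0≤-diff (P-ratio n)
          ⊹ 0≤P (suc n) ⊛ ((0≤ι n ⊹ 0≤ι 1) ⊛ r-dominates ⊹ 0≤r ⊛ 0≤-diff σ≤r))
        (by-1 (- r) (rec-step (σ q) (d q) n)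
          (lemma (ι n) r (σ q) (d q) (P (suc (suc n)) q) (P (suc n) q) (P n q))))
      where
      lemma : ∀ n r s d p₂ p₁ p₀ → r * (n + 2) * (r * p₁) - r * (n + 2) * p₂
        - ((n + 1) * d * (r * p₀ - p₁) + p₁ * ((n + 1) * (r * r - 2 * s * r + d) + r * (r - s)))
        ≡ - r * ((n + 2) * p₂ - ((2 * n + 3) * s * p₁ - (n + 1) * d * p₀))
      lemma = solve-∀ ring

    P≤r↑ : ∀ n → P n q ≤ r ↑ n
    P≤r↑ zero    = ℚ.≤-refl
    P≤r↑ (suc n) = ℚ.≤-trans (P-ratio n) (*-monoˡ r 0≤r (P≤r↑ n))

    σ↑≤P : ∀ n → σ q ↑ n ≤ P n q
    σ↑≤P zero    = ℚ.≤-refl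
    σ↑≤P (suc n) = ℚ.≤-trans (*-monoˡ (σ q) 0≤σ (σ↑≤P n)) (proj₂ (P-lower n))

    -- The source σ² - d = 32q³(1 - q) of the defect is of third order in q. The constant is 128 = 4
    -- · 32, because 1 ≤ 4r² turns rⁿ into 4rⁿ⁺².
    defect≤ : ∀ n → P (suc n) q - σ q * P n q ≤ ι n * (128 * q³ * r ↑ suc n)
    defect≤ zero    = ℚ.≤-reflexive (lemma (σ q) (128 * q³ * r ↑ 1))
      where
      lemma : ∀ s x → s - s * 1 ≡ 0 * x
      lemma = solve-∀ ring
    defect≤ (suc n) = *-cancel-≤ (ι n + 2) (0<ι+2 n)
      (≤-by ((ι n + 1) * ((σ q * (X′ - (P (suc n) q - σ q * P n q)) + (r - σ q) * X′)
            + (σ q * σ q - d q) * (r ↑ n - P n q)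
            + (32 * q³ * (2 * r + 1) * (2 * r - 1) + 32 * q³ * q) * r ↑ n)
          + (ι n + 1) * (128 * q³ * (r * (r * r ↑ n))))
        ((0≤ι n ⊹ 0≤ι 1) ⊛ ((0≤σ ⊛ 0≤-diff (defect≤ n) ⊹ 0≤-diff σ≤r ⊛ 0≤X′)
            ⊹ 0≤σ²-d ⊛ 0≤-diff (P≤r↑ n)
            ⊹ (0≤ι 32 ⊛ 0≤q³ ⊛ (0≤ι 2 ⊛ 0≤r ⊹ 0≤ι 1) ⊛ 0≤-diff 1≤2r ⊹ 0≤ι 32 ⊛ 0≤q³ ⊛ 0≤q) ⊛ 0≤rⁿ)
          ⊹ (0≤ι n ⊹ 0≤ι 1) ⊛ (0≤ι 128 ⊛ 0≤q³ ⊛ (0≤r ⊛ (0≤r ⊛ 0≤rⁿ))))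
        (trans (cong (λ m → (ι n + 2) * (m * (128 * q³ * (r * (r * r ↑ n))))
              - (ι n + 2) * (P (suc (suc n)) q - σ q * P (suc n) q)) (ι-suc n))
          (by-2 (- 1) ((ι n + 1) * r ↑ n) (rec-step (σ q) (d q) n) (sym σ²-d)
            (lemma (ι n) r (σ q) (d q) q³ q (r ↑ n) (P (suc (suc n)) q) (P (suc n) q) (P n q)))))
      where
      0≤rⁿ = ↑-nonNeg n 0≤r
      X′ : ℚ
      X′ = ι n * (128 * q³ * (r * r ↑ n))
      0≤X′ : 0 ≤ X′
      0≤X′ = 0≤ι n ⊛ (0≤ι 128 ⊛ 0≤q³ ⊛ (0≤r ⊛ 0≤rⁿ))
      lemma : ∀ n r s d c q y p₂ p₁ p₀ →
        (n + 2) * ((n + 1) * (128 * c * (r * (r * y)))) - (n + 2) * (p₂ - s * p₁)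
        - ((n + 1) * ((s * (n * (128 * c * (r * y)) - (p₁ - s * p₀)) + (r - s) * (n * (128 * c * (r * y))))
            + (s * s - d) * (y - p₀)
            + (32 * c * (2 * r + 1) * (2 * r - 1) + 32 * c * q) * y)
          + (n + 1) * (128 * c * (r * (r * y))))
        ≡ - 1 * ((n + 2) * p₂ - ((2 * n + 3) * s * p₁ - (n + 1) * d * p₀))
          + (n + 1) * y * (32 * c * (1 - q) - (s * s - d))
      lemma = solve-∀ ring

    -- Adds up the defects of `defect≤`, each carried on by a factor σ ≤ r per step.
    P-σ↑≤ : ∀ n → P n q - σ q ↑ n ≤ ι n * ι n * (128 * q³ * r ↑ n)
    P-σ↑≤ zero    = ℚ.≤-reflexive (lemma (128 * q³ * 1))
      where
      lemma : ∀ x → 1 - 1 ≡ 0 * 0 * x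
      lemma = solve-∀ ring
    P-σ↑≤ (suc n) = ≤-by
      ((ι n * (128 * q³ * (r * r ↑ n)) - (P (suc n) q - σ q * P n q))
        + σ q * (ι n * ι n * (128 * q³ * r ↑ n) - (P n q - σ q ↑ n))
        + (r - σ q) * (ι n * ι n * (128 * q³ * r ↑ n))
        + (ι n + 1) * (128 * q³ * (r * r ↑ n)))
      (0≤-diff (defect≤ n) ⊹ 0≤σ ⊛ 0≤-diff (P-σ↑≤ n)
        ⊹ 0≤-diff σ≤r ⊛ (0≤ι n ⊛ 0≤ι n ⊛ (0≤ι 128 ⊛ 0≤q³ ⊛ ↑-nonNeg n 0≤r))
        ⊹ (0≤ι n ⊹ 0≤ι 1) ⊛ (0≤ι 128 ⊛ 0≤q³ ⊛ (0≤r ⊛ ↑-nonNeg n 0≤r)))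
      (trans (cong (λ m → m * m * (128 * q³ * (r * r ↑ n)) - (P (suc n) q - σ q * σ q ↑ n)) (ι-suc n))
        (lemma (ι n) r (σ q) (128 * q³) (r ↑ n) (σ q ↑ n) (P (suc n) q) (P n q)))
      where
      lemma : ∀ n r s c y z p₁ p₀ → (n + 1) * (n + 1) * (c * (r * y)) - (p₁ - s * z)
        ≡ (n * (c * (r * y)) - (p₁ - s * p₀)) + s * (n * n * (c * y) - (p₀ - z))
          + (r - s) * (n * n * (c * y)) + (n + 1) * (c * (r * y))
      lemma = solve-∀ ring

    -- (1 - 4q)ⁿ ≤ (1 - q)⁴ⁿ, and three of the four factors absorb powers of nq.
    r≤[1-q]⁴ : r ≤ (1 - q) * (1 - q) * ((1 - q) * (1 - q))
    r≤[1-q]⁴ = ≤-by (q * q * (4 * (1 - q) + 2 + q * q))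
      (0≤q ⊛ 0≤q ⊛ (0≤ι 4 ⊛ 0≤1-q ⊹ 0≤ι 2 ⊹ 0≤q ⊛ 0≤q)) (lemma q)
      where
      lemma : ∀ q → (1 - q) * (1 - q) * ((1 - q) * (1 - q)) - (1 - 4 * q) ≡ q * q * (4 * (1 - q) + 2 + q * q)
      lemma = solve-∀ ring

    r↑≤ : ∀ n → let x = (1 - q) ↑ n in r ↑ n ≤ x * x * (x * x)
    r↑≤ n = ℚ.≤-trans (↑-mono n 0≤r r≤[1-q]⁴) (ℚ.≤-reflexive
      (trans (↑-* ((1 - q) * (1 - q)) ((1 - q) * (1 - q)) n)
        (cong₂ _*_ (↑-* (1 - q) (1 - q) n) (↑-* (1 - q) (1 - q) n))))

    nq[1-q]↑≤1 : ∀ n → ι n * q * (1 - q) ↑ n ≤ 1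
    nq[1-q]↑≤1 n = ℚ.≤-trans
      (≤-by ((1 - q) ↑ n) (↑-nonNeg n 0≤1-q) (lemma (ι n * q) ((1 - q) ↑ n)))
      (bernoulli q n 0≤q (≤-by (1 - q) 0≤1-q refl))
      where
      lemma : ∀ x y → (1 + x) * y - x * y ≡ y
      lemma = solve-∀ ring

-- The first-order differential relation for Ψ and its integration from θ = 1.

module Flow where

  open import Data.Rational.Base using (_+_; _*_; _-_; -_; _≤_; _<_; ∣_∣)
  open Rational using (*-pos; *-mono)
  open RationalArithmetic
  open Coefficients
  open Polynomials
  open Recurrence

  σP dP : Poly
  σP = (con 1 ⊟ X) ⊠ (con 1 ⊟ con 7 ⊠ X)
  dP = (con 1 ⊟ con 9 ⊠ X) ⊠ (con 1 ⊟ X) ⊠ ((con 1 ⊟ con 3 ⊠ X) ⊠ (con 1 ⊟ con 3 ⊠ X))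

  pP p₋P : ℕ → Poly
  pP n = recPoly σP dP n
  p₋P zero    = con 0
  p₋P (suc n) = pP n

  ⟦pP⟧ : ∀ n q → ⟦ pP n ⟧ q ≡ P n q
  ⟦pP⟧ = ⟦recPoly⟧ σP dP

  ⟦p₋P⟧ : ∀ n q → ⟦ p₋P n ⟧ q ≡ P₋ n q
  ⟦p₋P⟧ zero    q = refl
  ⟦p₋P⟧ (suc n) q = ⟦pP⟧ n q

  P′ P′₋ : ℕ → ℚ → ℚ
  P′ n = ∂ (pP n)
  P′₋ n = ∂ (p₋P n)

  P′-step : ∀ n q → (ι n + 2) * P′ (suc (suc n)) q
    ≡ (2 * ι n + 3) * ((14 * q - 8) * P (suc n) q + σ q * P′ (suc n) q)
      - (ι n + 1) * ((156 * q - 16 - 432 * q * q + 324 * q * q * q) * P n q + d q * P′ n q)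
  P′-step n q = trans (∂-rec-step σP dP n q) (cong₂ _-_
    (cong₂ (λ u v → (2 * ι n + 3) * (u * v + σ q * P′ (suc n) q)) (∂σ q) (⟦pP⟧ (suc n) q))
    (cong₂ (λ u v → (ι n + 1) * (u * v + d q * P′ n q)) (∂d q) (⟦pP⟧ n q)))
    where
    ∂σ : ∀ q → (0 - 1) * (1 - 7 * q) + (1 - q) * (0 - (0 * q + 7 * 1)) ≡ 14 * q - 8
    ∂σ = solve-∀ ring
    ∂d : ∀ q → ((0 - (0 * q + 9 * 1)) * (1 - q) + (1 - 9 * q) * (0 - 1)) * ((1 - 3 * q) * (1 - 3 * q))
        + (1 - 9 * q) * (1 - q) * ((0 - (0 * q + 3 * 1)) * (1 - 3 * q) + (1 - 3 * q) * (0 - (0 * q + 3 * 1)))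
      ≡ 156 * q - 16 - 432 * q * q + 324 * q * q * q
    ∂d = solve-∀ ring

  -- The classical (x² - 1) Pₙ′(x) = n (x Pₙ - Pₙ₋₁) carried to the variable q by the chain rule.
  -- The proof does not pass through x: the differentiated recurrence reproduces the relation by
  -- two-step induction.
  P′-closed : ∀ n q → 2 * q * (1 - q) * P′ n q
    ≡ ι n * ((3 - 4 * q) * P n q - 3 * (1 - q) * (1 - 3 * q) * P₋ n q)
  P′-closed zero q = lemma q
    where
    lemma : ∀ q → 2 * q * (1 - q) * 0 ≡ 0 * ((3 - 4 * q) * 1 - 3 * (1 - q) * (1 - 3 * q) * 0)
    lemma = solve-∀ ring
  P′-closed (suc zero) q = lemma q
    where
    lemma : ∀ q → 2 * q * (1 - q) * ((0 - 1) * (1 - 7 * q) + (1 - q) * (0 - (0 * q + 7 * 1)))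
      ≡ 1 * ((3 - 4 * q) * ((1 - q) * (1 - 7 * q)) - 3 * (1 - q) * (1 - 3 * q) * 1)
    lemma = solve-∀ ring
  P′-closed (suc (suc n)) q = *-cancel-pos (ι n + 2) (0<ι+2 n) (by-5
    (2 * q * (1 - q)) ((2 * N + 3) * σ q) (- ((N + 1) * d q)) (- ((N + 2) * (3 - 4 * q)))
    ((N + 1) * (3 * (1 - q) * (1 - 3 * q)))
    (P′-step n q)
    (subst (λ m → 2 * q * (1 - q) * P′ (suc n) q ≡ m * ((3 - 4 * q) * P (suc n) q - 3 * (1 - q) * (1 - 3 * q) * P n q))
      (ι-suc n) (P′-closed (suc n) q))
    (P′-closed n q) (rec-step (σ q) (d q) n) (P-step n q)
    (trans (cong (λ m → (N + 2) * (2 * q * (1 - q) * P′ (suc (suc n)) q)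
        - (N + 2) * (m * ((3 - 4 * q) * P (suc (suc n)) q - 3 * (1 - q) * (1 - 3 * q) * P (suc n) q)))
        (trans (ι-+ 2 n) (ℚ.+-comm 2 N)))
      (lemma N q (P′ (suc (suc n)) q) (P′ (suc n) q) (P′ n q) (P (suc (suc n)) q) (P (suc n) q) (P n q) (P₋ n q))))
    where
    N = ι n
    lemma : ∀ n q t₂ t₁ t₀ p₂ p₁ p₀ o →
      (n + 2) * (2 * q * (1 - q) * t₂)
        - (n + 2) * ((n + 2) * ((3 - 4 * q) * p₂ - 3 * (1 - q) * (1 - 3 * q) * p₁))
      ≡ 2 * q * (1 - q) * ((n + 2) * t₂ -
          ((2 * n + 3) * ((14 * q - 8) * p₁ + (1 - q) * (1 - 7 * q) * t₁)
            - (n + 1) * ((156 * q - 16 - 432 * q * q + 324 * q * q * q) * p₀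
              + (1 - 9 * q) * (1 - q) * ((1 - 3 * q) * (1 - 3 * q)) * t₀)))
      + (2 * n + 3) * ((1 - q) * (1 - 7 * q)) * (2 * q * (1 - q) * t₁
          - (n + 1) * ((3 - 4 * q) * p₁ - 3 * (1 - q) * (1 - 3 * q) * p₀))
      + - ((n + 1) * ((1 - 9 * q) * (1 - q) * ((1 - 3 * q) * (1 - 3 * q)))) * (2 * q * (1 - q) * t₀
          - n * ((3 - 4 * q) * p₀ - 3 * (1 - q) * (1 - 3 * q) * o))
      + - ((n + 2) * (3 - 4 * q)) * ((n + 2) * p₂ -
          ((2 * n + 3) * ((1 - q) * (1 - 7 * q)) * p₁
            - (n + 1) * ((1 - 9 * q) * (1 - q) * ((1 - 3 * q) * (1 - 3 * q))) * p₀))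
      + (n + 1) * (3 * (1 - q) * (1 - 3 * q)) * ((n + 1) * p₁ -
          ((2 * n + 1) * ((1 - q) * (1 - 7 * q)) * p₀
            - n * ((1 - 9 * q) * (1 - q) * ((1 - 3 * q) * (1 - 3 * q))) * o))
    lemma = solve-∀ ring

  ψ : ℕ → ℚ → ℚ
  ψ n q = (ι n * (1 + 12 * q) + 3 * q) * P n q - ι n * ((1 - 9 * q) * (1 - 3 * q)) * P₋ n q

  ψP : ℕ → Poly
  ψP n = (con (ι n) ⊠ (con 1 ⊞ con 12 ⊠ X) ⊞ con 3 ⊠ X) ⊠ pP n
    ⊟ con (ι n) ⊠ ((con 1 ⊟ con 9 ⊠ X) ⊠ (con 1 ⊟ con 3 ⊠ X)) ⊠ p₋P n

  ⟦ψP⟧ : ∀ n q → ⟦ ψP n ⟧ q ≡ ψ n q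
  ⟦ψP⟧ n q = cong₂ (λ u v → (ι n * (1 + 12 * q) + 3 * q) * u - ι n * ((1 - 9 * q) * (1 - 3 * q)) * v)
    (⟦pP⟧ n q) (⟦p₋P⟧ n q)

  ∂ψP : ∀ n q → ∂ (ψP n) q
    ≡ (12 * ι n + 3) * P n q + (ι n * (1 + 12 * q) + 3 * q) * P′ n q
      - (ι n * (54 * q - 12) * P₋ n q + ι n * ((1 - 9 * q) * (1 - 3 * q)) * P′₋ n q)
  ∂ψP n q = trans (lemma (ι n) q (⟦ pP n ⟧ q) (P′ n q) (⟦ p₋P n ⟧ q) (P′₋ n q))
    (cong₂ (λ u v → (12 * ι n + 3) * u + (ι n * (1 + 12 * q) + 3 * q) * P′ n q
      - (ι n * (54 * q - 12) * v + ι n * ((1 - 9 * q) * (1 - 3 * q)) * P′₋ n q))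
    (⟦pP⟧ n q) (⟦p₋P⟧ n q))
    where
    lemma : ∀ n q p p′ o o′ →
      (((0 * (1 + 12 * q) + n * (0 + (0 * q + 12 * 1))) + (0 * q + 3 * 1)) * p + (n * (1 + 12 * q) + 3 * q) * p′)
      - ((0 * ((1 - 9 * q) * (1 - 3 * q))
            + n * ((0 - (0 * q + 9 * 1)) * (1 - 3 * q) + (1 - 9 * q) * (0 - (0 * q + 3 * 1)))) * o
          + n * ((1 - 9 * q) * (1 - 3 * q)) * o′)
      ≡ (12 * n + 3) * p + (n * (1 + 12 * q) + 3 * q) * p′
        - (n * (54 * q - 12) * o + n * ((1 - 9 * q) * (1 - 3 * q)) * o′)
    lemma = solve-∀ ring

  -- The operator f ↦ f - 2(1 - q) f′ is the θ-derivative of θ f(1 - θ²). After multiplication by cₙ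
  -- the right side telescopes, since (n² + n + 3/16) cₙ = (n + 1)² cₙ₊₁. The condition q > 0 allows
  -- the factor q of `P′-closed` to be cancelled.
  ψ-flow : ∀ n q → 0 < q → ψ n q - 2 * (1 - q) * ∂ (ψP n) q
    ≡ 16 * (2 - 3 * q) * (ι n * ι n * P₋ n q - (ι n * ι n + ι n + 3/16) * P n q)
  ψ-flow zero q 0<q = trans (cong (λ z → ψ 0 q - 2 * (1 - q) * z) (∂ψP 0 q)) (lemma q)
    where
    lemma : ∀ q → (0 * (1 + 12 * q) + 3 * q) * 1 - 0 * ((1 - 9 * q) * (1 - 3 * q)) * 0
      - 2 * (1 - q) * ((12 * 0 + 3) * 1 + (0 * (1 + 12 * q) + 3 * q) * 0
        - (0 * (54 * q - 12) * 0 + 0 * ((1 - 9 * q) * (1 - 3 * q)) * 0))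
      ≡ 16 * (2 - 3 * q) * (0 * 0 * 0 - (0 * 0 + 0 + (ℤ.+ 3 ℚ./ 16)) * 1)
    lemma = solve-∀ ring
  ψ-flow (suc n) q 0<q = trans (cong (λ z → ψ (suc n) q - 2 * (1 - q) * z) (∂ψP (suc n) q))
    (subst (λ m → Goal m) (sym (ι-suc n)) (*-cancel-pos q 0<q (by-3
      (- ((N + 1) * (1 + 12 * q) + 3 * q)) ((N + 1) * ((1 - 9 * q) * (1 - 3 * q))) (- (3 * (N + 1)))
      (subst (λ m → 2 * q * (1 - q) * P′ (suc n) q ≡ m * ((3 - 4 * q) * P (suc n) q - 3 * (1 - q) * (1 - 3 * q) * P n q))
        (ι-suc n) (P′-closed (suc n) q))
      (P′-closed n q) (P-step n q)
      (lemma N q (P′ (suc n) q) (P′ n q) (P (suc n) q) (P n q) (P₋ n q)))))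
    where
    N = ι n
    Goal : ℚ → Set
    Goal m = (m * (1 + 12 * q) + 3 * q) * P (suc n) q - m * ((1 - 9 * q) * (1 - 3 * q)) * P n q
      - 2 * (1 - q) * ((12 * m + 3) * P (suc n) q + (m * (1 + 12 * q) + 3 * q) * P′ (suc n) q
        - (m * (54 * q - 12) * P n q + m * ((1 - 9 * q) * (1 - 3 * q)) * P′ n q))
      ≡ 16 * (2 - 3 * q) * (m * m * P n q - (m * m + m + 3/16) * P (suc n) q)
    lemma : ∀ n q t₁ t₀ p₁ p₀ o →
      q * (((n + 1) * (1 + 12 * q) + 3 * q) * p₁ - (n + 1) * ((1 - 9 * q) * (1 - 3 * q)) * p₀
        - 2 * (1 - q) * ((12 * (n + 1) + 3) * p₁ + ((n + 1) * (1 + 12 * q) + 3 * q) * t₁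
          - ((n + 1) * (54 * q - 12) * p₀ + (n + 1) * ((1 - 9 * q) * (1 - 3 * q)) * t₀)))
      - q * (16 * (2 - 3 * q) * ((n + 1) * (n + 1) * p₀ - ((n + 1) * (n + 1) + (n + 1) + (ℤ.+ 3 ℚ./ 16)) * p₁))
      ≡ - ((n + 1) * (1 + 12 * q) + 3 * q) *
          (2 * q * (1 - q) * t₁ - (n + 1) * ((3 - 4 * q) * p₁ - 3 * (1 - q) * (1 - 3 * q) * p₀))
      + (n + 1) * ((1 - 9 * q) * (1 - 3 * q)) *
          (2 * q * (1 - q) * t₀ - n * ((3 - 4 * q) * p₀ - 3 * (1 - q) * (1 - 3 * q) * o))
      + - (3 * (n + 1)) * ((n + 1) * p₁ -
          ((2 * n + 1) * ((1 - q) * (1 - 7 * q)) * p₀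
            - n * ((1 - 9 * q) * (1 - q) * ((1 - 3 * q) * (1 - 3 * q))) * o))
    lemma = solve-∀ ring

  Ψ : ℕ → ℚ → ℚ
  Ψ N q = ∑ N (λ n → c n * ψ n q)

  ΨP : ℕ → Poly
  ΨP zero    = con 0
  ΨP (suc N) = ΨP N ⊞ con (c N) ⊠ ψP N

  ⟦ΨP⟧ : ∀ N q → ⟦ ΨP N ⟧ q ≡ Ψ N q
  ⟦ΨP⟧ zero    q = refl
  ⟦ΨP⟧ (suc N) q = cong₂ (λ u v → u + c N * v) (⟦ΨP⟧ N q) (⟦ψP⟧ N q)

  -- Σ cₙ ψₙ √(1 - q) is constant, up to the boundary term of a telescoping sum.
  Ψ-flow : ∀ N q → 0 < q → Ψ N q - 2 * (1 - q) * ∂ (ΨP N) q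
    ≡ - (16 * (2 - 3 * q)) * (ι N * ι N * c N * P₋ N q)
  Ψ-flow zero q 0<q = lemma q (c 0)
    where
    lemma : ∀ q c → 0 - 2 * (1 - q) * 0 ≡ - (16 * (2 - 3 * q)) * (0 * 0 * c * 0)
    lemma = solve-∀ ring
  Ψ-flow (suc N) q 0<q = subst
    (λ m → Ψ N q + c N * ψ N q - 2 * (1 - q) * ∂ (ΨP (suc N)) q
      ≡ - (16 * (2 - 3 * q)) * (m * m * c (suc N) * P N q)) (sym (ι-suc N))
    (by-3 1 (c N) (16 * (2 - 3 * q) * P N q) (Ψ-flow N q 0<q) (ψ-flow N q 0<q) (c-suc N)
      (lemma (ι N) q (c N) (c (suc N)) (Ψ N q) (∂ (ΨP N) q) (ψ N q) (∂ (ψP N) q) (⟦ ψP N ⟧ q) (P N q) (P₋ N q)))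
    where
    lemma : ∀ n q c c₁ S S′ s s′ s₀ p o →
      S + c * s - 2 * (1 - q) * (S′ + (0 * s₀ + c * s′))
        - - (16 * (2 - 3 * q)) * ((n + 1) * (n + 1) * c₁ * p)
      ≡ 1 * (S - 2 * (1 - q) * S′ - - (16 * (2 - 3 * q)) * (n * n * c * o))
      + c * (s - 2 * (1 - q) * s′ - 16 * (2 - 3 * q) * (n * n * o - (n * n + n + (ℤ.+ 3 ℚ./ 16)) * p))
      + 16 * (2 - 3 * q) * p * ((n + 1) * (n + 1) * c₁ - (n * n + n + (ℤ.+ 3 ℚ./ 16)) * c)
    lemma = solve-∀ ring

  -- 8274 = 8192 + 80 + 2, from the three contributions to Remainder.B below.
  hP fP gP : ℕ → Poly
  hP N = ΨP N ⊞ con (κ N) ⊠ pow σP N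
  fP N = X ⊠ hP N [ con 1 ⊟ X ⊠ X ]
  gP N = con (8274 * invℚ (2 * ι N + 1)) ⊠ (X ⊠ pow (X ⊠ X) N)

  fP-value : ∀ N θ → ⟦ fP N ⟧ θ ≡ θ * (Ψ N (1 - θ * θ) + κ N * σ (1 - θ * θ) ↑ N)
  fP-value N θ = cong (θ *_) (trans (⟦⟧-[] (hP N) (con 1 ⊟ X ⊠ X) θ)
    (cong₂ (λ u v → u + κ N * v) (⟦ΨP⟧ N (1 - θ * θ)) (⟦pow⟧ σP N (1 - θ * θ))))

  -- This is where the coefficient 2N c_N in `hP` comes from: differentiating σᴺ contributes N² c_N
  -- (32 - 88q + 56q²) s, the boundary term contributes -N² c_N (32 - 48q) s, and the constants 32
  -- cancel. What remains of this order carries a factor q.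
  ∂fP : ∀ n θ → 0 < 1 - θ * θ → let q = 1 - θ * θ ; N = ι n + 1 ; s = σ q ↑ n in
    ∂ (fP (suc n)) θ ≡ N * c (suc n) *
      (N * (- (16 * (2 - 3 * q)) * (P n q - s) + (56 * q * q - 40 * q) * s) + 2 * (σ q * s))
  ∂fP n θ 0<q = trans
    (cong₂ (λ u v → 1 * u + θ * v) (⟦⟧-[] (hP (suc n)) (con 1 ⊟ X ⊠ X) θ) (∂-[] (hP (suc n)) (con 1 ⊟ X ⊠ X) θ))
    (trans (cong₂ (λ u v → 1 * (⟦ ΨP (suc n) ⟧ q + κ (suc n) * u)
          + θ * ((∂ (ΨP (suc n)) q + (0 * u + κ (suc n) * v)) * (0 - (1 * θ + θ * 1))))
        (⟦pow⟧ σP (suc n) q) (∂-pow σP n q))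
      (trans (cong₂ (λ u k → 1 * (u + k * (σ q * s))
            + θ * ((∂ (ΨP (suc n)) q + (0 * (σ q * s) + k * ((ι n + 1) * (s * ∂ σP q)))) * (0 - (1 * θ + θ * 1))))
          (⟦ΨP⟧ (suc n) q) κ-suc)
        (by-1 1 flow (lemma (ι n) θ (Ψ (suc n) q) (∂ (ΨP (suc n)) q) (c (suc n)) s (P n q)))))
    where
    q s : ℚ
    q = 1 - θ * θ
    s = σ q ↑ n
    κ-suc : κ (suc n) ≡ 2 * (ι n + 1) * c (suc n)
    κ-suc = cong (λ m → 2 * m * c (suc n)) (ι-suc n)
    flow : Ψ (suc n) q - 2 * (1 - q) * ∂ (ΨP (suc n)) q
      ≡ - (16 * (2 - 3 * q)) * ((ι n + 1) * (ι n + 1) * c (suc n) * P n q)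
    flow = subst (λ m → Ψ (suc n) q - 2 * (1 - q) * ∂ (ΨP (suc n)) q
      ≡ - (16 * (2 - 3 * q)) * (m * m * c (suc n) * P n q)) (ι-suc n) (Ψ-flow (suc n) q 0<q)
    lemma : ∀ n θ S S′ c s p →
      1 * (S + 2 * (n + 1) * c * ((1 - (1 - θ * θ)) * (1 - 7 * (1 - θ * θ)) * s))
        + θ * ((S′ + (0 * ((1 - (1 - θ * θ)) * (1 - 7 * (1 - θ * θ)) * s)
            + 2 * (n + 1) * c * ((n + 1) * (s * ((0 - 1) * (1 - 7 * (1 - θ * θ))
              + (1 - (1 - θ * θ)) * (0 - (0 * (1 - θ * θ) + 7 * 1)))))))
          * (0 - (1 * θ + θ * 1)))
      - (n + 1) * c * ((n + 1) * (- (16 * (2 - 3 * (1 - θ * θ))) * (p - s)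
            + (56 * (1 - θ * θ) * (1 - θ * θ) - 40 * (1 - θ * θ)) * s)
          + 2 * ((1 - (1 - θ * θ)) * (1 - 7 * (1 - θ * θ)) * s))
      ≡ 1 * (S - 2 * (1 - (1 - θ * θ)) * S′
          - - (16 * (2 - 3 * (1 - θ * θ))) * ((n + 1) * (n + 1) * c * p))
    lemma = solve-∀ ring

  ∂gP : ∀ n θ → ∂ (gP (suc n)) θ ≡ 8274 * (θ * θ) ↑ suc n
  ∂gP n θ = trans
    (cong₂ (λ u v → 0 * (θ * (θ * θ * u)) + k * (1 * (θ * θ * u) + θ * v))
      (⟦pow⟧ (X ⊠ X) n θ) (∂-pow (X ⊠ X) n θ))
    (by-1 (8274 * (θ * θ * (θ * θ) ↑ n))
      (subst (λ m → (2 * m + 1) * invℚ (2 * ι (suc n) + 1) ≡ 1) (ι-suc n)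
        (invℚ-pos {2 * ι (suc n) + 1} (nonNeg+pos (0≤ι 2 ⊛ 0≤ι (suc n)) lit<)))
      (lemma (ι n) θ (invℚ (2 * ι (suc n) + 1)) ((θ * θ) ↑ n)))
    where
    k : ℚ
    k = 8274 * invℚ (2 * ι (suc n) + 1)
    lemma : ∀ n θ i y →
      0 * (θ * (θ * θ * y)) + 8274 * i * (1 * (θ * θ * y) + θ * ((n + 1) * (y * (1 * θ + θ * 1))))
        - 8274 * (θ * θ * y)
      ≡ 8274 * (θ * θ * y) * ((2 * (n + 1) + 1) * i - 1)
    lemma = solve-∀ ring

  module Remainder {q} (0≤q : 0 ≤ q) (9q≤1 : 9 * q ≤ 1) (n : ℕ) where
    open Bounds 0≤q 9q≤1

    N s Δ R x : ℚ
    N = ι n + 1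
    s = σ q ↑ n
    Δ = P n q - s
    R = r ↑ suc n
    x = (1 - q) ↑ suc n

    0≤N = 0≤ι n ⊹ 0≤ι 1
    0≤s = ↑-nonNeg n 0≤σ
    0≤rⁿ = ↑-nonNeg n 0≤r
    0≤R = ↑-nonNeg (suc n) 0≤r
    0≤x = ↑-nonNeg (suc n) 0≤1-q

    0≤Δ : 0 ≤ Δ
    0≤Δ = 0≤-diff (σ↑≤P n)

    rⁿ≤2R : r ↑ n ≤ 2 * R
    rⁿ≤2R = ≤-by ((2 * r - 1) * r ↑ n) (0≤-diff 1≤2r ⊛ 0≤rⁿ) (lemma r (r ↑ n))
      where
      lemma : ∀ r y → 2 * (r * y) - y ≡ (2 * r - 1) * y
      lemma = solve-∀ ring

    Δ≤ : Δ ≤ N * N * (256 * q³ * R)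
    Δ≤ = ℚ.≤-trans (P-σ↑≤ n) (≤-by
      (128 * q³ * ((2 * ι n + 1) * r ↑ n + N * N * (2 * R - r ↑ n)))
      (0≤ι 128 ⊛ 0≤q³ ⊛ ((0≤ι 2 ⊛ 0≤ι n ⊹ 0≤ι 1) ⊛ 0≤rⁿ ⊹ 0≤N ⊛ 0≤N ⊛ 0≤-diff rⁿ≤2R))
      (lemma (ι n) q³ (r ↑ n) R))
      where
      lemma : ∀ n c y R → (n + 1) * (n + 1) * (256 * c * R) - n * n * (128 * c * y)
        ≡ 128 * c * ((2 * n + 1) * y + (n + 1) * (n + 1) * (2 * R - y))
      lemma = solve-∀ ring

    s≤2R : s ≤ 2 * R
    s≤2R = ℚ.≤-trans (↑-mono n 0≤σ σ≤r) rⁿ≤2R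

    σs≤R : σ q * s ≤ R
    σs≤R = ↑-mono (suc n) 0≤σ σ≤r

    Nqx≤1 : N * q * x ≤ 1
    Nqx≤1 = subst (λ m → m * q * x ≤ 1) (ι-suc n) (nq[1-q]↑≤1 (suc n))

    x≤1 : x ≤ 1
    x≤1 = ↑≤1 (suc n) 0≤1-q (≤-by q 0≤q (lemma q))
      where
      lemma : ∀ q → 1 - (1 - q) ≡ q
      lemma = solve-∀ ring

    -- `inner` with its coefficients replaced by bounds of their absolute values: 16(2 - 3q) ≤ 32
    -- and 40q - 56q² ≤ 40q.
    B : ℚ
    B = N * (32 * Δ + 40 * q * s) + 2 * (σ q * s)

    0≤B : 0 ≤ B
    0≤B = 0≤N ⊛ (0≤ι 32 ⊛ 0≤Δ ⊹ 0≤ι 40 ⊛ 0≤q ⊛ 0≤s) ⊹ 0≤ι 2 ⊛ (0≤σ ⊛ 0≤s)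

    -- With y = Nq the bound on B is (8192y³ + 80y + 2) x⁴, where 8192 = 32 · 256 and 80 = 40 · 2.
    -- Three factors x absorb up to three factors y through yx ≤ 1, and the fourth stays: x = θ²ᴺ is
    -- what can be integrated.
    B≤8274x : B ≤ 8274 * x
    B≤8274x = ℚ.≤-trans
      (≤-by (32 * N * (N * N * (256 * q³ * R) - Δ) + 40 * N * q * (2 * R - s) + 2 * (R - σ q * s))
        (0≤ι 32 ⊛ 0≤N ⊛ 0≤-diff Δ≤ ⊹ 0≤ι 40 ⊛ 0≤N ⊛ 0≤q ⊛ 0≤-diff s≤2R ⊹ 0≤ι 2 ⊛ 0≤-diff σs≤R)
        (lemma₁ N q Δ s R (σ q)))
      (ℚ.≤-trans
        (*-monoˡ (8192 * y³ + 80 * (N * q) + 2)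
          (0≤ι 8192 ⊛ 0≤y³ ⊹ 0≤ι 80 ⊛ 0≤Nq ⊹ 0≤ι 2) (r↑≤ (suc n)))
        (≤-by (x * (8192 * ((1 - z) * (1 + z + z * z)) + 80 * ((1 - z) + z * ((1 - x) * (1 + x)))
            + 2 * ((1 - x) * (1 + x + x * x))))
          (0≤x ⊛ (0≤ι 8192 ⊛ (0≤1-z ⊛ (0≤ι 1 ⊹ 0≤z ⊹ 0≤z ⊛ 0≤z))
            ⊹ 0≤ι 80 ⊛ (0≤1-z ⊹ 0≤z ⊛ (0≤1-x ⊛ (0≤ι 1 ⊹ 0≤x)))
            ⊹ 0≤ι 2 ⊛ (0≤1-x ⊛ (0≤ι 1 ⊹ 0≤x ⊹ 0≤x ⊛ 0≤x))))
          (lemma₂ (N * q) x)))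
      where
      y³ z : ℚ
      y³ = N * q * (N * q) * (N * q)
      z = N * q * x
      0≤Nq = 0≤N ⊛ 0≤q
      0≤y³ = 0≤Nq ⊛ 0≤Nq ⊛ 0≤Nq
      0≤z = 0≤Nq ⊛ 0≤x
      0≤1-z = 0≤-diff Nqx≤1
      0≤1-x = 0≤-diff x≤1
      lemma₁ : ∀ N q Δ s R σ → (8192 * (N * q * (N * q) * (N * q)) + 80 * (N * q) + 2) * R
        - (N * (32 * Δ + 40 * q * s) + 2 * (σ * s))
        ≡ 32 * N * (N * N * (256 * (q * q * q) * R) - Δ) + 40 * N * q * (2 * R - s) + 2 * (R - σ * s)
      lemma₁ = solve-∀ ring
      lemma₂ : ∀ y x → 8274 * x - (8192 * (y * y * y) + 80 * y + 2) * (x * x * (x * x))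
        ≡ x * (8192 * ((1 - y * x) * (1 + y * x + y * x * (y * x))) + 80 * ((1 - y * x) + y * x * ((1 - x) * (1 + x)))
            + 2 * ((1 - x) * (1 + x + x * x)))
      lemma₂ = solve-∀ ring

    Nc : ℚ
    Nc = N * c (suc n)

    0≤Nc : 0 ≤ Nc
    0≤Nc = 0≤N ⊛ ℚ.<⇒≤ (0<c (suc n))

    Nc≤1 : Nc ≤ 1
    Nc≤1 = ℚ.≤-trans (≤-by Nc 0≤Nc (trans (cong (λ m → 2 * m * c (suc n) - Nc) (ι-suc n)) (lemma N (c (suc n)))))
      (κ≤1 (suc n))
      where
      lemma : ∀ n c → 2 * n * c - n * c ≡ n * c
      lemma = solve-∀ ring

    inner : ℚ
    inner = N * (- (16 * (2 - 3 * q)) * Δ + (56 * q * q - 40 * q) * s) + 2 * (σ q * s)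

    ∣remainder∣≤ : ∣ Nc * inner ∣ ≤ 8274 * x
    ∣remainder∣≤ = ℚ.≤-trans (∣∣-≤
      (≤-by ((1 - Nc) * B + Nc * (N * ((48 + 16 * (1 - 3 * q)) * Δ + (24 * q + 56 * q * (1 - q)) * s)))
        (0≤-diff Nc≤1 ⊛ 0≤B ⊹ 0≤Nc ⊛ (0≤N ⊛ ((0≤ι 48 ⊹ 0≤ι 16 ⊛ 0≤1-kq 3) ⊛ 0≤Δ
          ⊹ (0≤ι 24 ⊛ 0≤q ⊹ 0≤ι 56 ⊛ 0≤q ⊛ 0≤1-q) ⊛ 0≤s)))
        (lemma₁ Nc N q Δ s (σ q * s)))
      (≤-by ((1 - Nc) * B + Nc * (N * (48 * q * Δ + 56 * q * q * s) + 4 * (σ q * s)))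
        (0≤-diff Nc≤1 ⊛ 0≤B ⊹ 0≤Nc ⊛ (0≤N ⊛ (0≤ι 48 ⊛ 0≤q ⊛ 0≤Δ ⊹ 0≤ι 56 ⊛ 0≤q ⊛ 0≤q ⊛ 0≤s)
          ⊹ 0≤ι 4 ⊛ (0≤σ ⊛ 0≤s)))
        (lemma₂ Nc N q Δ s (σ q * s))))
      B≤8274x
      where
      lemma₁ : ∀ k N q Δ s t →
        N * (32 * Δ + 40 * q * s) + 2 * t - k * (N * (- (16 * (2 - 3 * q)) * Δ + (56 * q * q - 40 * q) * s) + 2 * t)
        ≡ (1 - k) * (N * (32 * Δ + 40 * q * s) + 2 * t)
          + k * (N * ((48 + 16 * (1 - 3 * q)) * Δ + (24 * q + 56 * q * (1 - q)) * s))
      lemma₁ = solve-∀ ring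
      lemma₂ : ∀ k N q Δ s t →
        N * (32 * Δ + 40 * q * s) + 2 * t - - (k * (N * (- (16 * (2 - 3 * q)) * Δ + (56 * q * q - 40 * q) * s) + 2 * t))
        ≡ (1 - k) * (N * (32 * Δ + 40 * q * s) + 2 * t) + k * (N * (48 * q * Δ + 56 * q * q * s) + 4 * t)
      lemma₂ = solve-∀ ring

  -- The normalisation Pₙ(1) = 1. At q = 0 both σ and d are 1, so this fixes the initial value of
  -- the integration at θ = 1.
  rec-1-1 : ∀ n → rec 1 1 n ≡ 1
  rec-1-1 zero          = refl
  rec-1-1 (suc zero)    = refl
  rec-1-1 (suc (suc n)) = *-cancel-pos (ι n + 2) (0<ι+2 n) (by-3 1 (2 * ι n + 3) (- (ι n + 1))
    (rec-step 1 1 n) (rec-1-1 (suc n)) (rec-1-1 n) (lemma (ι n) (rec 1 1 (suc (suc n))) (rec 1 1 (suc n)) (rec 1 1 n)))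
    where
    lemma : ∀ n p₂ p₁ p₀ → (n + 2) * p₂ - (n + 2) * 1
      ≡ 1 * ((n + 2) * p₂ - ((2 * n + 3) * 1 * p₁ - (n + 1) * 1 * p₀))
        + (2 * n + 3) * (p₁ - 1) + - (n + 1) * (p₀ - 1)
    lemma = solve-∀ ring

  ψ-at-0 : ∀ n → ψ n 0 ≡ 0
  ψ-at-0 zero    = refl
  ψ-at-0 (suc n) = trans (cong₂ (λ u v → (ι (suc n) * (1 + 12 * 0) + 3 * 0) * u - ι (suc n) * ((1 - 9 * 0) * (1 - 3 * 0)) * v)
    (rec-1-1 (suc n)) (rec-1-1 n)) (lemma (ι (suc n)))
    where
    lemma : ∀ n → (n * (1 + 12 * 0) + 3 * 0) * 1 - n * ((1 - 9 * 0) * (1 - 3 * 0)) * 1 ≡ 0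
    lemma = solve-∀ ring

  Ψ-at-0 : ∀ N → Ψ N 0 ≡ 0
  Ψ-at-0 zero    = refl
  Ψ-at-0 (suc N) = trans (cong₂ (λ u v → u + c N * v) (Ψ-at-0 N) (ψ-at-0 N))
    (trans (ℚ.+-identityˡ (c N * 0)) (ℚ.*-zeroʳ (c N)))

  1↑ : ∀ n → 1 ↑ n ≡ 1
  1↑ zero    = refl
  1↑ (suc n) = trans (ℚ.*-identityˡ (1 ↑ n)) (1↑ n)

  fP-at-1 : ∀ N → ⟦ fP N ⟧ 1 ≡ κ N
  fP-at-1 N = trans (fP-value N 1) (trans (cong₂ (λ u v → 1 * (u + κ N * v)) (Ψ-at-0 N) (1↑ N)) (lemma (κ N)))
    where
    lemma : ∀ k → 1 * (0 + k * 1) ≡ k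
    lemma = solve-∀ ring

  gP-at-1 : ∀ N → ⟦ gP N ⟧ 1 ≡ 8274 * invℚ (2 * ι N + 1)
  gP-at-1 N = trans (cong (λ u → 8274 * invℚ (2 * ι N + 1) * (1 * u)) (trans (⟦pow⟧ (X ⊠ X) N 1) (1↑ N)))
    (lemma (8274 * invℚ (2 * ι N + 1)))
    where
    lemma : ∀ k → k * (1 * 1) ≡ k
    lemma = solve-∀ ring

  -- Integration from θ to 1: `fP` is κ at 1, and at θ it exceeds θΨ by θκσᴺ, which costs the power
  -- (1 - 4q)ᴺ. The hypothesis 8 ≤ 9θ² is 9q ≤ 1.
  θ-estimate : ∀ n θ → 0 ≤ θ → θ ≤ 1 → 8 ≤ 9 * (θ * θ) → let N = suc n ; q = 1 - θ * θ in
    ∣ θ * Ψ N q - κ N ∣ ≤ 8274 * invℚ (2 * ι N + 1) + (1 - 4 * q) ↑ N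
  θ-estimate n θ 0≤θ θ≤1 8≤9θ² = subst (λ z → ∣ z ∣ ≤ 8274 * invℚ (2 * ι N + 1) + (1 - 4 * q) ↑ N)
    (trans (cong₂ (λ u v → - (u - v) - θ * (κ N * σ q ↑ N)) (fP-at-1 N) (fP-value N θ))
      (lemma₁ θ (κ N) (Ψ N q) (κ N * σ q ↑ N)))
    (∣-∣≤ { - (⟦ fP N ⟧ 1 - ⟦ fP N ⟧ θ)} {θ * (κ N * σ q ↑ N)}
      (subst (_≤ 8274 * invℚ (2 * ι N + 1)) (sym (ℚ.∣-p∣≡∣p∣ (⟦ fP N ⟧ 1 - ⟦ fP N ⟧ θ)))
        (ℚ.≤-trans (mean-value (fP N) (gP N) 0≤θ θ≤1 ℚ.≤-refl slope)
          (≤-by (⟦ gP N ⟧ θ) 0≤g (trans (cong (_- (⟦ gP N ⟧ 1 - ⟦ gP N ⟧ θ)) (sym (gP-at-1 N)))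
            (lemma₂ (⟦ gP N ⟧ 1) (⟦ gP N ⟧ θ))))))
      (subst (_≤ (1 - 4 * q) ↑ N) (sym (ℚ.0≤p⇒∣p∣≡p 0≤tail)) tail≤))
    where
    N : ℕ
    N = suc n
    q : ℚ
    q = 1 - θ * θ
    θ²≤1 : θ * θ ≤ 1
    θ²≤1 = *-mono 0≤θ lit≤ θ≤1 θ≤1
    lemma₃ : ∀ θ → 1 - 9 * (1 - θ * θ) ≡ 9 * (θ * θ) - 8
    lemma₃ = solve-∀ ring
    open Bounds {q} (0≤-diff θ²≤1) (≤-by (9 * (θ * θ) - 8) (0≤-diff 8≤9θ²) (lemma₃ θ))
    lemma₁ : ∀ θ k S z → - (k - θ * (S + z)) - θ * z ≡ θ * S - k
    lemma₁ = solve-∀ ring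
    lemma₂ : ∀ a b → a - (a - b) ≡ b
    lemma₂ = solve-∀ ring
    0≤g : 0 ≤ ⟦ gP N ⟧ θ
    0≤g = (0≤ι 8274 ⊛ ℚ.<⇒≤ (0<invℚ (nonNeg+pos (0≤ι 2 ⊛ 0≤ι N) lit<)))
      ⊛ (0≤θ ⊛ subst (0 ≤_) (sym (⟦pow⟧ (X ⊠ X) N θ)) (↑-nonNeg N (0≤θ ⊛ 0≤θ)))
    0≤tail : 0 ≤ θ * (κ N * σ q ↑ N)
    0≤tail = 0≤θ ⊛ (0≤κ N ⊛ ↑-nonNeg N 0≤σ)
    tail≤ : θ * (κ N * σ q ↑ N) ≤ (1 - 4 * q) ↑ N
    tail≤ = ℚ.≤-trans (*-mono (0≤κ N ⊛ ↑-nonNeg N 0≤σ) lit≤ θ≤1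
        (*-mono (↑-nonNeg N 0≤σ) lit≤ (κ≤1 N) (↑-mono N 0≤σ σ≤r)))
      (ℚ.≤-reflexive (lemma₄ ((1 - 4 * q) ↑ N)))
      where
      lemma₄ : ∀ x → 1 * (1 * x) ≡ x
      lemma₄ = solve-∀ ring
    slope : ∀ x → θ ≤ x → x < 1 → ∣ ∂ (fP N) x ∣ ≤ ∂ (gP N) x
    slope x θ≤x x<1 = subst₂ _≤_ (cong ∣_∣ (sym (∂fP n x 0<q′)))
      (trans (cong (λ y → 8274 * y ↑ suc n) (lemma₅ x)) (sym (∂gP n x)))
      (Remainder.∣remainder∣≤ (ℚ.<⇒≤ 0<q′) 9q′≤1 n)
      where
      0≤x : 0 ≤ x
      0≤x = ℚ.≤-trans 0≤θ θ≤x
      0<q′ : 0 < 1 - x * x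
      0<q′ = subst (0 <_) (lemma₆ x) (*-pos (0<-diff x<1) (+-pos-nonNeg (0<ι 1) 0≤x))
        where
        lemma₆ : ∀ x → (1 - x) * (1 + x) ≡ 1 - x * x
        lemma₆ = solve-∀ ring
      9q′≤1 : 9 * (1 - x * x) ≤ 1
      9q′≤1 = ≤-by (9 * ((x - θ) * (x + θ)) + (9 * (θ * θ) - 8))
        (0≤ι 9 ⊛ (0≤-diff θ≤x ⊛ (0≤x ⊹ 0≤θ)) ⊹ 0≤-diff 8≤9θ²) (lemma₇ x θ)
        where
        lemma₇ : ∀ x θ → 1 - 9 * (1 - x * x) ≡ 9 * ((x - θ) * (x + θ)) + (9 * (θ * θ) - 8)
        lemma₇ = solve-∀ ring
      lemma₅ : ∀ x → 1 - (1 - x * x) ≡ x * x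
      lemma₅ = solve-∀ ring

  -- N is found before θ, uniformly for q ≥ q₀, because θ will run through the rational approximants
  -- of a real number.
  θ-limit : ∀ ε q₀ → 0 < ε → 0 < q₀ → Eventually λ N → ∀ θ → 0 ≤ θ → θ ≤ 1 → 8 ≤ 9 * (θ * θ) →
    q₀ ≤ 1 - θ * θ → ∣ θ * Ψ N (1 - θ * θ) - κ N ∣ ≤ ε
  θ-limit ε q₀ 0<ε 0<q₀ = suc (proj₁ M) , close
    where
    -- 4138 = 4137 + 1: N · 8274/(2N + 1) is at most 4137, and N q (1 - 4q)ᴺ is at most 1 by
    -- `bernoulli`.
    M = archimedean (4138 * invℚ (ε * q₀))
    close : ∀ N → suc (proj₁ M) ℕ.≤ N → ∀ θ → 0 ≤ θ → θ ≤ 1 → 8 ≤ 9 * (θ * θ) →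
      q₀ ≤ 1 - θ * θ → ∣ θ * Ψ N (1 - θ * θ) - κ N ∣ ≤ ε
    close (suc n) (ℕ.s≤s M≤n) θ 0≤θ θ≤1 8≤9θ² q₀≤q = ℚ.≤-trans (θ-estimate n θ 0≤θ θ≤1 8≤9θ²)
      (*-cancel-≤ (N * q₀) 0<Nq₀ (ℚ.≤-trans scaled≤4138 4138≤Nq₀ε))
      where
      N i q R : ℚ
      N = ι (suc n)
      i = invℚ (2 * N + 1)
      q = 1 - θ * θ
      R = (1 - 4 * q) ↑ suc n
      0<Nq₀ : 0 < N * q₀
      0<Nq₀ = *-pos (0<ι-suc n) 0<q₀
      0<i : 0 < i
      0<i = 0<invℚ (nonNeg+pos (0≤ι 2 ⊛ 0≤ι (suc n)) lit<)
      0≤q₀ = ℚ.<⇒≤ 0<q₀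
      4q≤1 : 4 * q ≤ 1
      4q≤1 = ≤-by (5 * q + (9 * (θ * θ) - 8)) (0≤ι 5 ⊛ ℚ.≤-trans 0≤q₀ q₀≤q ⊹ 0≤-diff 8≤9θ²) (lemma₂ θ)
        where
        lemma₂ : ∀ θ → 1 - 4 * (1 - θ * θ) ≡ 5 * (1 - θ * θ) + (9 * (θ * θ) - 8)
        lemma₂ = solve-∀ ring
      0≤R : 0 ≤ R
      0≤R = ↑-nonNeg (suc n) (0≤-diff 4q≤1)
      q≤1 : q ≤ 1
      q≤1 = ≤-by (θ * θ) (0≤θ ⊛ 0≤θ) (lemma₃ θ)
        where
        lemma₃ : ∀ θ → 1 - (1 - θ * θ) ≡ θ * θ
        lemma₃ = solve-∀ ring
      scaled≤4138 : N * q₀ * (8274 * i + R) ≤ 4138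
      scaled≤4138 = ≤-by (4137 * i * q₀ + 4137 * (1 - q₀) + N * (q - q₀) * R + 3 * N * q * R + R + (1 - (1 + N * (4 * q)) * R))
        (0≤ι 4137 ⊛ ℚ.<⇒≤ 0<i ⊛ 0≤q₀ ⊹ 0≤ι 4137 ⊛ 0≤-diff (ℚ.≤-trans q₀≤q q≤1)
          ⊹ 0≤ι (suc n) ⊛ 0≤-diff q₀≤q ⊛ 0≤R ⊹ 0≤ι 3 ⊛ 0≤ι (suc n) ⊛ ℚ.≤-trans 0≤q₀ q₀≤q ⊛ 0≤R ⊹ 0≤R
          ⊹ 0≤-diff (bernoulli (4 * q) (suc n) (0≤ι 4 ⊛ ℚ.≤-trans 0≤q₀ q₀≤q) 4q≤1))
        (by-1 (- (4137 * q₀)) (invℚ-pos {2 * N + 1} (nonNeg+pos (0≤ι 2 ⊛ 0≤ι (suc n)) lit<)) (lemma₄ N q q₀ i R))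
        where
        lemma₄ : ∀ N q q₀ i R → 4138 - N * q₀ * (8274 * i + R)
          - (4137 * i * q₀ + 4137 * (1 - q₀) + N * (q - q₀) * R + 3 * N * q * R + R + (1 - (1 + N * (4 * q)) * R))
          ≡ - (4137 * q₀) * ((2 * N + 1) * i - 1)
        lemma₄ = solve-∀ ring
      4138≤Nq₀ε : 4138 ≤ N * q₀ * ε
      4138≤Nq₀ε = begin
        4138  ≡⟨ sym (ℚ.*-identityʳ 4138) ⟩
        4138 * 1  ≡⟨ cong (4138 *_) (sym (invℚ-pos (*-pos 0<ε 0<q₀))) ⟩
        4138 * (ε * q₀ * invℚ (ε * q₀))  ≡⟨ lemma₅ ε q₀ (invℚ (ε * q₀)) ⟩
        4138 * invℚ (ε * q₀) * (q₀ * ε)  ≤⟨ *-monoʳ (q₀ * ε) (0≤q₀ ⊛ ℚ.<⇒≤ 0<ε)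
                                                    (ℚ.≤-trans (proj₂ M) (ι-mono (ℕ.m≤n⇒m≤1+n M≤n))) ⟩
        N * (q₀ * ε)  ≡⟨ sym (ℚ.*-assoc N q₀ ε) ⟩
        N * q₀ * ε  ∎
        where
        open ℚ.≤-Reasoning
        lemma₅ : ∀ e q i → 4138 * (e * q * i) ≡ 4138 * i * (q * e)
        lemma₅ = solve-∀ ring

-- From the cubic weight to Ψ by telescoping in n.

module CubicReduction where

  open import Data.Rational.Base using (_+_; _*_; _-_; -_; _≤_; _<_; ∣_∣)
  open Rational using (*-pos; *-mono)
  open RationalArithmetic
  open Coefficients
  open Recurrence
  open Flow

  -- The given coefficients in the parameter q: multiplied by (1 + 3k)⁴/(1 + k)² these quartics
  -- become C₀, C₁, C₂ and C₃.
  K₀ K₁ K₂ K₃ : ℚ → ℚ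
  K₃ q = 1024 * q * q - 2304 * q * q * q + 1296 * q * q * q * q
  K₂ q = 3408 * q * q - 384 * q - 6912 * q * q * q + 3888 * q * q * q * q
  K₁ q = 16 - 360 * q + 2441 * q * q - 4932 * q * q * q + 2835 * q * q * q * q
  K₀ q = 3 - 63 * q + 411 * q * q - 837 * q * q * q + 486 * q * q * q * q

  boundary : ℕ → ℚ → ℚ
  boundary n q = 16 * ι n * ι n * c n * ((ι n + 1) * d q * P₋ n q - ι n * P n q)

  -- Modulo differences of `boundary` the cubic weight collapses to ψ. The recurrences of c and P
  -- remove everything at index n + 1, and a polynomial identity in n, q and two neighbouring values
  -- of P remains.
  cubic-reduction : ∀ n q →
    c n * P n q * (K₃ q * (ι n * (ι n * (ι n * 1))) + K₂ q * (ι n * (ι n * 1)) + K₁ q * ι n + K₀ q)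
    ≡ 3 * ((1 - q) * (1 - 3 * q)) * (c n * ψ n q) + (boundary (suc n) q - boundary n q)
  cubic-reduction n q = subst
    (λ m → c n * P n q * (K₃ q * (ι n * (ι n * (ι n * 1))) + K₂ q * (ι n * (ι n * 1)) + K₁ q * ι n + K₀ q)
      ≡ 3 * ((1 - q) * (1 - 3 * q)) * (c n * ψ n q)
        + (16 * m * m * c (suc n) * ((m + 1) * d q * P n q - m * P (suc n) q) - boundary n q))
    (sym (ι-suc n))
    (by-2 (- (16 * ((N + 2) * d q * P n q - (N + 1) * P (suc n) q))) (16 * (N * N + N + 3/16) * c n)
      (c-suc n) (P-step n q) (lemma N q (c n) (c (suc n)) (P (suc n) q) (P n q) (P₋ n q)))
    where
    N = ι n
    lemma : ∀ n q c c₁ p₁ p o →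
      c * p * ((1024 * q * q - 2304 * q * q * q + 1296 * q * q * q * q) * (n * (n * (n * 1)))
          + (3408 * q * q - 384 * q - 6912 * q * q * q + 3888 * q * q * q * q) * (n * (n * 1))
          + (16 - 360 * q + 2441 * q * q - 4932 * q * q * q + 2835 * q * q * q * q) * n
          + (3 - 63 * q + 411 * q * q - 837 * q * q * q + 486 * q * q * q * q))
      - (3 * ((1 - q) * (1 - 3 * q)) * (c * ((n * (1 + 12 * q) + 3 * q) * p - n * ((1 - 9 * q) * (1 - 3 * q)) * o))
        + (16 * (n + 1) * (n + 1) * c₁ *
            ((n + 1 + 1) * ((1 - 9 * q) * (1 - q) * ((1 - 3 * q) * (1 - 3 * q))) * p - (n + 1) * p₁)
          - 16 * n * n * c *
            ((n + 1) * ((1 - 9 * q) * (1 - q) * ((1 - 3 * q) * (1 - 3 * q))) * o - n * p)))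
      ≡ - (16 * ((n + 2) * ((1 - 9 * q) * (1 - q) * ((1 - 3 * q) * (1 - 3 * q))) * p - (n + 1) * p₁)) *
          ((n + 1) * (n + 1) * c₁ - (n * n + n + (ℤ.+ 3 ℚ./ 16)) * c)
      + 16 * (n * n + n + (ℤ.+ 3 ℚ./ 16)) * c * ((n + 1) * p₁ -
          ((2 * n + 1) * ((1 - q) * (1 - 7 * q)) * p
            - n * ((1 - 9 * q) * (1 - q) * ((1 - 3 * q) * (1 - 3 * q))) * o))
    lemma = solve-∀ ring

  qOf : ℚ → ℚ
  qOf k = k * (1 - k) * invℚ (1 + 3 * k)

  cubic₃ cubic₂ cubic₁ cubic₀ scale : ℚ → ℚ
  cubic₃ k = (16 * (k - 1) ↑ 2 * k ↑ 2) * invℚ ((1 + k) ↑ 2) * (8 + 15 * k + 9 * k ↑ 2) ↑ 2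
  cubic₂ k = 48 * (k - 1) * k * (8 - 15 * k + 27 * k ↑ 2 + 27 * k ↑ 3 + 81 * k ↑ 4)
  cubic₁ k = (4 - 33 * k + 45 * k ↑ 2) * (4 - 17 * k + 17 * k ↑ 2 - 3 * k ↑ 3 + 63 * k ↑ 4)
  cubic₀ k = 3 * (1 - 3 * k) ↑ 4 * (1 + k + 2 * k ↑ 2)
  scale k = (1 + 3 * k) ↑ 4 * invℚ ((1 + k) ↑ 2)

  module Parameter {k} (0<k : 0 < k) where

    0≤k = ℚ.<⇒≤ 0<k

    0<1+3k : 0 < 1 + 3 * k
    0<1+3k = +-pos-nonNeg (0<ι 1) (0≤ι 3 ⊛ 0≤k)

    0<[1+k]² : 0 < (1 + k) * ((1 + k) * 1)
    0<[1+k]² = *-pos 0<1+k (*-pos 0<1+k lit<)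
      where
      0<1+k = +-pos-nonNeg (0<ι 1) 0≤k

    q u j : ℚ
    q = qOf k
    u = 1 + 3 * k
    j = invℚ ((1 + k) ↑ 2)

    uq : u * q ≡ k * (1 - k)
    uq = by-1 (k * (1 - k)) (invℚ-pos 0<1+3k) (lemma u (k * (1 - k)) (invℚ u))
      where
      lemma : ∀ u v i → u * (v * i) - v ≡ v * (u * i - 1)
      lemma = solve-∀ ring

    [1+k]²j : (1 + k) * ((1 + k) * 1) * j ≡ 1
    [1+k]²j = invℚ-pos 0<[1+k]²

    -- Clearing 1 + 3k leaves a square, so the bound is exact at every positive term of a Cauchy
    -- sequence for k, even when k is near 1/3.
    9q≤1 : 9 * q ≤ 1
    9q≤1 = *-cancel-≤ u 0<1+3k (≤-by ((1 - 3 * k) * (1 - 3 * k)) (0≤-square (1 - 3 * k))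
      (by-1 (- 9) uq (lemma k q)))
      where
      lemma : ∀ k q → (1 + 3 * k) * 1 - (1 + 3 * k) * (9 * q) - (1 - 3 * k) * (1 - 3 * k)
        ≡ - 9 * ((1 + 3 * k) * q - k * (1 - k))
      lemma = solve-∀ ring

    -- u⁴ K(q) is a form in u and v = uq, which become polynomials in k.
    form : ℚ → ℚ → ℚ → ℚ → ℚ → ℚ → ℚ → ℚ
    form a₀ a₁ a₂ a₃ a₄ u v =
      a₀ * (u * u * u * u) + a₁ * (u * u * u * v) + a₂ * (u * u * v * v) + a₃ * (u * v * v * v) + a₄ * (v * v * v * v)

    scaleK : ∀ a₀ a₁ a₂ a₃ a₄ y →
      form a₀ a₁ a₂ a₃ a₄ u (k * (1 - k)) ≡ y * ((1 + k) * ((1 + k) * 1)) →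
      u * (u * (u * (u * 1))) * j * (a₀ + a₁ * q + a₂ * q * q + a₃ * q * q * q + a₄ * q * q * q * q) ≡ y
    scaleK a₀ a₁ a₂ a₃ a₄ y eq = by-2 j y
      (trans (cong (form a₀ a₁ a₂ a₃ a₄ u) uq) eq) [1+k]²j (lemma a₀ a₁ a₂ a₃ a₄ u q j y ((1 + k) * ((1 + k) * 1)))
      where
      lemma : ∀ a₀ a₁ a₂ a₃ a₄ u q j y s →
        u * (u * (u * (u * 1))) * j * (a₀ + a₁ * q + a₂ * q * q + a₃ * q * q * q + a₄ * q * q * q * q) - y
        ≡ j * (a₀ * (u * u * u * u) + a₁ * (u * u * u * (u * q)) + a₂ * (u * u * (u * q) * (u * q))
            + a₃ * (u * (u * q) * (u * q) * (u * q)) + a₄ * (u * q * (u * q) * (u * q) * (u * q)) - y * s)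
          + y * (s * j - 1)
      lemma = solve-∀ ring

    cubic₃-eq : scale k * K₃ q ≡ cubic₃ k
    cubic₃-eq = trans (cong (scale k *_) (pad q)) (scaleK 0 0 1024 (- 2304) 1296 (cubic₃ k)
      (by-1 (- (16 * ((k - 1) * ((k - 1) * 1)) * (k * (k * 1)) * ((8 + 15 * k + 9 * (k * (k * 1))) * ((8 + 15 * k + 9 * (k * (k * 1))) * 1))))
        [1+k]²j (lemma k j)))
      where
      pad : ∀ q → 1024 * q * q - 2304 * q * q * q + 1296 * q * q * q * q
        ≡ 0 + 0 * q + 1024 * q * q + - 2304 * q * q * q + 1296 * q * q * q * q
      pad = solve-∀ ring
      lemma : ∀ k j →
        0 * ((1 + 3 * k) * (1 + 3 * k) * (1 + 3 * k) * (1 + 3 * k)) + 0 * ((1 + 3 * k) * (1 + 3 * k) * (1 + 3 * k) * (k * (1 - k)))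
          + 1024 * ((1 + 3 * k) * (1 + 3 * k) * (k * (1 - k)) * (k * (1 - k)))
          + - 2304 * ((1 + 3 * k) * (k * (1 - k)) * (k * (1 - k)) * (k * (1 - k)))
          + 1296 * (k * (1 - k) * (k * (1 - k)) * (k * (1 - k)) * (k * (1 - k)))
        - (16 * ((k - 1) * ((k - 1) * 1)) * (k * (k * 1))) * j * ((8 + 15 * k + 9 * (k * (k * 1))) * ((8 + 15 * k + 9 * (k * (k * 1))) * 1))
          * ((1 + k) * ((1 + k) * 1))
        ≡ - (16 * ((k - 1) * ((k - 1) * 1)) * (k * (k * 1)) * ((8 + 15 * k + 9 * (k * (k * 1))) * ((8 + 15 * k + 9 * (k * (k * 1))) * 1)))
          * ((1 + k) * ((1 + k) * 1) * j - 1)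
      lemma = solve-∀ ring

    cubic₂-eq : scale k * K₂ q ≡ cubic₂ k
    cubic₂-eq = trans (cong (scale k *_) (pad q)) (scaleK 0 (- 384) 3408 (- 6912) 3888 (cubic₂ k) (lemma k))
      where
      pad : ∀ q → 3408 * q * q - 384 * q - 6912 * q * q * q + 3888 * q * q * q * q
        ≡ 0 + - 384 * q + 3408 * q * q + - 6912 * q * q * q + 3888 * q * q * q * q
      pad = solve-∀ ring
      lemma : ∀ k →
        0 * ((1 + 3 * k) * (1 + 3 * k) * (1 + 3 * k) * (1 + 3 * k)) + - 384 * ((1 + 3 * k) * (1 + 3 * k) * (1 + 3 * k) * (k * (1 - k)))
          + 3408 * ((1 + 3 * k) * (1 + 3 * k) * (k * (1 - k)) * (k * (1 - k)))
          + - 6912 * ((1 + 3 * k) * (k * (1 - k)) * (k * (1 - k)) * (k * (1 - k)))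
          + 3888 * (k * (1 - k) * (k * (1 - k)) * (k * (1 - k)) * (k * (1 - k)))
        ≡ 48 * (k - 1) * k * (8 - 15 * k + 27 * (k * (k * 1)) + 27 * (k * (k * (k * 1))) + 81 * (k * (k * (k * (k * 1)))))
          * ((1 + k) * ((1 + k) * 1))
      lemma = solve-∀ ring

    cubic₁-eq : scale k * K₁ q ≡ cubic₁ k
    cubic₁-eq = trans (cong (scale k *_) (pad q)) (scaleK 16 (- 360) 2441 (- 4932) 2835 (cubic₁ k) (lemma k))
      where
      pad : ∀ q → 16 - 360 * q + 2441 * q * q - 4932 * q * q * q + 2835 * q * q * q * q
        ≡ 16 + - 360 * q + 2441 * q * q + - 4932 * q * q * q + 2835 * q * q * q * q
      pad = solve-∀ ring
      lemma : ∀ k →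
        16 * ((1 + 3 * k) * (1 + 3 * k) * (1 + 3 * k) * (1 + 3 * k)) + - 360 * ((1 + 3 * k) * (1 + 3 * k) * (1 + 3 * k) * (k * (1 - k)))
          + 2441 * ((1 + 3 * k) * (1 + 3 * k) * (k * (1 - k)) * (k * (1 - k)))
          + - 4932 * ((1 + 3 * k) * (k * (1 - k)) * (k * (1 - k)) * (k * (1 - k)))
          + 2835 * (k * (1 - k) * (k * (1 - k)) * (k * (1 - k)) * (k * (1 - k)))
        ≡ (4 - 33 * k + 45 * (k * (k * 1))) * (4 - 17 * k + 17 * (k * (k * 1)) - 3 * (k * (k * (k * 1))) + 63 * (k * (k * (k * (k * 1)))))
          * ((1 + k) * ((1 + k) * 1))
      lemma = solve-∀ ring

    cubic₀-eq : scale k * K₀ q ≡ cubic₀ k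
    cubic₀-eq = trans (cong (scale k *_) (pad q)) (scaleK 3 (- 63) 411 (- 837) 486 (cubic₀ k) (lemma k))
      where
      pad : ∀ q → 3 - 63 * q + 411 * q * q - 837 * q * q * q + 486 * q * q * q * q
        ≡ 3 + - 63 * q + 411 * q * q + - 837 * q * q * q + 486 * q * q * q * q
      pad = solve-∀ ring
      lemma : ∀ k →
        3 * ((1 + 3 * k) * (1 + 3 * k) * (1 + 3 * k) * (1 + 3 * k)) + - 63 * ((1 + 3 * k) * (1 + 3 * k) * (1 + 3 * k) * (k * (1 - k)))
          + 411 * ((1 + 3 * k) * (1 + 3 * k) * (k * (1 - k)) * (k * (1 - k)))
          + - 837 * ((1 + 3 * k) * (k * (1 - k)) * (k * (1 - k)) * (k * (1 - k)))
          + 486 * (k * (1 - k) * (k * (1 - k)) * (k * (1 - k)) * (k * (1 - k)))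
        ≡ 3 * ((1 - 3 * k) * ((1 - 3 * k) * ((1 - 3 * k) * ((1 - 3 * k) * 1)))) * (1 + k + 2 * (k * (k * 1)))
          * ((1 + k) * ((1 + k) * 1))
      lemma = solve-∀ ring

    M : ℚ
    M = (1 + 3 * k) ↑ 2 * (1 + 3 * k ↑ 2)

    scale-M : scale k * ((1 - q) * (1 - 3 * q)) ≡ M
    scale-M = by-2 j (u * u * (1 + 3 * (k * (k * 1))))
      (cong (λ v → (u - v) * (u - 3 * v) * (u * u)) uq) [1+k]²j (lemma k q j)
      where
      lemma : ∀ k q j →
        (1 + 3 * k) * ((1 + 3 * k) * ((1 + 3 * k) * ((1 + 3 * k) * 1))) * j * ((1 - q) * (1 - 3 * q))
          - (1 + 3 * k) * ((1 + 3 * k) * 1) * (1 + 3 * (k * (k * 1)))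
        ≡ j * (((1 + 3 * k) - (1 + 3 * k) * q) * ((1 + 3 * k) - 3 * ((1 + 3 * k) * q)) * ((1 + 3 * k) * (1 + 3 * k))
            - ((1 + 3 * k) - k * (1 - k)) * ((1 + 3 * k) - 3 * (k * (1 - k))) * ((1 + 3 * k) * (1 + 3 * k)))
          + (1 + 3 * k) * (1 + 3 * k) * (1 + 3 * (k * (k * 1))) * ((1 + k) * ((1 + k) * 1) * j - 1)
      lemma = solve-∀ ring

    -- Through its factor n² `boundary` vanishes at n = 0, so only the upper end of the telescoping
    -- remains.
    partial-sum : ∀ N → ∑ N (λ n → c n * P n q *
        (cubic₃ k * ι n ↑ 3 + cubic₂ k * ι n ↑ 2 + cubic₁ k * ι n + cubic₀ k))
      ≡ 3 * M * Ψ N q + scale k * boundary N q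
    partial-sum zero = lemma M (scale k) (c 0) ((0 + 1) * d q * 0 - 0 * 1)
      where
      lemma : ∀ M s c x → 0 ≡ 3 * M * 0 + s * (16 * 0 * 0 * c * x)
      lemma = solve-∀ ring
    partial-sum (suc N) = trans (cong₂ _+_ (partial-sum N) (term N))
      (by-1 (3 * (c N * ψ N q)) scale-M
        (lemma M (scale k) ((1 - q) * (1 - 3 * q)) (Ψ N q) (c N * ψ N q) (boundary N q) (boundary (suc N) q)))
      where
      term : ∀ n → c n * P n q * (cubic₃ k * ι n ↑ 3 + cubic₂ k * ι n ↑ 2 + cubic₁ k * ι n + cubic₀ k)
        ≡ scale k * (3 * ((1 - q) * (1 - 3 * q)) * (c n * ψ n q) + (boundary (suc n) q - boundary n q))
      term n = trans
        (cong₂ (λ x y → c n * P n q * (x + y))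
          (cong₂ _+_ (cong₂ (λ x y → x * ι n ↑ 3 + y * ι n ↑ 2) (sym cubic₃-eq) (sym cubic₂-eq))
            (cong (_* ι n) (sym cubic₁-eq))) (sym cubic₀-eq))
        (trans (collect (scale k) (c n * P n q) (K₃ q) (K₂ q) (K₁ q) (K₀ q) (ι n ↑ 3) (ι n ↑ 2) (ι n))
          (cong (scale k *_) (cubic-reduction n q)))
        where
        collect : ∀ s x a b c d e f n → x * (s * a * e + s * b * f + s * c * n + s * d)
          ≡ s * (x * (a * e + b * f + c * n + d))
        collect = solve-∀ ring
      lemma : ∀ M s e S t b b₁ → 3 * M * S + s * b + s * (3 * e * t + (b₁ - b)) - (3 * M * (S + t) + s * b₁)
        ≡ 3 * t * (s * e - M)
      lemma = solve-∀ ring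

  -- `boundary` is at most 64N²(1 - 4q)ᴺ ≤ 64N²x⁴ with x = (1 - q)ᴺ. Once it is multiplied by N q³,
  -- the bound N q x ≤ 1 used three times absorbs all powers of N.
  boundary-decay : ∀ {q} → 0 ≤ q → 9 * q ≤ 1 → ∀ n →
    ι (suc n) * (q * q * q) * ∣ boundary (suc n) q ∣ ≤ 64
  boundary-decay {q} 0≤q 9q≤1 n = ℚ.≤-trans
    (*-monoˡ (ι (suc n) * q³) (0≤ι (suc n) ⊛ 0≤q³) (∣∣-≤
      (≤-by (16 * N * (Nc * (N * P (suc n) q + (N - 1) * (2 * R) + (N + 1) * (2 * R - d q * P n q)) + 4 * N * (1 - Nc) * R))
        (0≤ι 16 ⊛ 0≤N ⊛ (0≤Nc ⊛ (0≤N ⊛ 0≤P (suc n)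
            ⊹ subst (0 ≤_) (cancel (ι n)) (0≤ι n) ⊛ (0≤ι 2 ⊛ 0≤R) ⊹ (0≤N ⊹ 0≤ι 1) ⊛ 0≤-diff dP≤2R)
          ⊹ 0≤ι 4 ⊛ 0≤N ⊛ 0≤-diff Nc≤1 ⊛ 0≤R))
        (trans (cong (λ m → 64 * N * N * R - 16 * m * m * c (suc n) * ((m + 1) * d q * P n q - m * P (suc n) q)) (ι-suc n))
          (lemma₁ N (c (suc n)) (d q) R (P (suc n) q) (P n q))))
      (≤-by (16 * N * (Nc * ((N + 1) * (d q * P n q) + N * (R - P (suc n) q) + 3 * N * R) + 4 * N * (1 - Nc) * R))
        (0≤ι 16 ⊛ 0≤N ⊛ (0≤Nc ⊛ ((0≤N ⊹ 0≤ι 1) ⊛ (0≤d ⊛ 0≤P n) ⊹ 0≤N ⊛ 0≤-diff (P≤r↑ (suc n)) ⊹ 0≤ι 3 ⊛ 0≤N ⊛ 0≤R)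
          ⊹ 0≤ι 4 ⊛ 0≤N ⊛ 0≤-diff Nc≤1 ⊛ 0≤R))
        (trans (cong (λ m → 64 * N * N * R - - (16 * m * m * c (suc n) * ((m + 1) * d q * P n q - m * P (suc n) q))) (ι-suc n))
          (lemma₂ N (c (suc n)) (d q) R (P (suc n) q) (P n q))))))
    (ℚ.≤-trans
      (*-monoˡ (ι (suc n) * q³) (0≤ι (suc n) ⊛ 0≤q³) (*-monoˡ (64 * N * N) (0≤ι 64 ⊛ 0≤N ⊛ 0≤N) (r↑≤ (suc n))))
      (≤-by (64 * ((1 - z) * (1 + z + z * z) + z * z * z * (1 - x)))
        (0≤ι 64 ⊛ (0≤-diff Nqx≤1 ⊛ (0≤ι 1 ⊹ 0≤z ⊹ 0≤z ⊛ 0≤z) ⊹ 0≤z ⊛ 0≤z ⊛ 0≤z ⊛ 0≤-diff x≤1))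
        (trans (cong (λ m → 64 - m * q³ * (64 * N * N * (x * x * (x * x)))) (ι-suc n)) (lemma₃ N q x))))
    where
    open Bounds 0≤q 9q≤1
    open Remainder 0≤q 9q≤1 n
    z : ℚ
    z = N * q * x
    0≤z = 0≤N ⊛ 0≤q ⊛ 0≤x
    cancel : ∀ n → n ≡ n + 1 - 1
    cancel = solve-∀ ring
    d≤1 : d q ≤ 1
    d≤1 = ℚ.≤-trans
      (≤-by (σ q * σ q - d q) 0≤σ²-d refl)
      (*-mono 0≤σ lit≤ σ≤1 σ≤1)
      where
      σ≤1 = ℚ.≤-trans σ≤r (≤-by (4 * q) (0≤ι 4 ⊛ 0≤q) (lemma q))
        where
        lemma : ∀ q → 1 - (1 - 4 * q) ≡ 4 * q
        lemma = solve-∀ ring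
    dP≤2R : d q * P n q ≤ 2 * R
    dP≤2R = ℚ.≤-trans (*-mono (0≤P n) lit≤ d≤1 (ℚ.≤-trans (P≤r↑ n) rⁿ≤2R)) (ℚ.≤-reflexive (ℚ.*-identityˡ (2 * R)))
    lemma₁ : ∀ N c d R p o → 64 * N * N * R - 16 * N * N * c * ((N + 1) * d * o - N * p)
      ≡ 16 * N * (N * c * (N * p + (N - 1) * (2 * R) + (N + 1) * (2 * R - d * o)) + 4 * N * (1 - N * c) * R)
    lemma₁ = solve-∀ ring
    lemma₂ : ∀ N c d R p o → 64 * N * N * R - - (16 * N * N * c * ((N + 1) * d * o - N * p))
      ≡ 16 * N * (N * c * ((N + 1) * (d * o) + N * (R - p) + 3 * N * R) + 4 * N * (1 - N * c) * R)
    lemma₂ = solve-∀ ring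
    lemma₃ : ∀ N q x → 64 - N * (q * q * q) * (64 * N * N * (x * x * (x * x)))
      ≡ 64 * ((1 - N * q * x) * (1 + N * q * x + N * q * x * (N * q * x)) + N * q * x * (N * q * x) * (N * q * x) * (1 - x))
    lemma₃ = solve-∀ ring

  boundary-limit : ∀ ε q₀ → 0 < ε → 0 < q₀ → Eventually λ N → ∀ q → q₀ ≤ q → 9 * q ≤ 1 → ∣ boundary N q ∣ ≤ ε
  boundary-limit ε q₀ 0<ε 0<q₀ = suc (proj₁ M) , close
    where
    0≤q₀ = ℚ.<⇒≤ 0<q₀
    e : ℚ
    e = ε * (q₀ * q₀ * q₀)
    0<e : 0 < e
    0<e = *-pos 0<ε (*-pos (*-pos 0<q₀ 0<q₀) 0<q₀)
    M = archimedean (64 * invℚ e)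
    close : ∀ N → suc (proj₁ M) ℕ.≤ N → ∀ q → q₀ ≤ q → 9 * q ≤ 1 → ∣ boundary N q ∣ ≤ ε
    close (suc n) (ℕ.s≤s M≤n) q q₀≤q 9q≤1 = *-cancel-≤ (ι (suc n) * (q * q * q))
      (*-pos (0<ι-suc n) (*-pos (*-pos 0<q 0<q) 0<q)) (begin
        ι (suc n) * (q * q * q) * ∣ boundary (suc n) q ∣  ≤⟨ boundary-decay (ℚ.<⇒≤ 0<q) 9q≤1 n ⟩
        64  ≡⟨ sym (ℚ.*-identityʳ 64) ⟩
        64 * 1  ≡⟨ cong (64 *_) (sym (invℚ-pos 0<e)) ⟩
        64 * (e * invℚ e)  ≡⟨ lemma₁ e (invℚ e) ⟩
        64 * invℚ e * e  ≤⟨ *-monoʳ e (ℚ.<⇒≤ 0<e)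
                                                               (ℚ.≤-trans (proj₂ M) (ι-mono (ℕ.m≤n⇒m≤1+n M≤n))) ⟩
        ι (suc n) * e  ≡⟨ lemma₂ (ι (suc n)) ε (q₀ * q₀ * q₀) ⟩
        ι (suc n) * (q₀ * q₀ * q₀) * ε  ≤⟨ *-monoʳ ε (ℚ.<⇒≤ 0<ε) (*-monoˡ (ι (suc n)) (0≤ι (suc n))
                                                               (*-mono 0≤q₀ (0≤q ⊛ 0≤q) (*-mono 0≤q₀ 0≤q q₀≤q q₀≤q) q₀≤q)) ⟩
        ι (suc n) * (q * q * q) * ε  ∎)
      where
      open ℚ.≤-Reasoning
      0<q = ℚ.<-≤-trans 0<q₀ q₀≤q
      0≤q = ℚ.<⇒≤ 0<q
      lemma₁ : ∀ e i → 64 * (e * i) ≡ 64 * i * e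
      lemma₁ = solve-∀ ring
      lemma₂ : ∀ n a b → n * (a * b) ≡ n * b * a
      lemma₂ = solve-∀ ring

-- The hypergeometric definition satisfies Bonnet's recurrence.

module LegendrePolynomials where

  open import Data.Rational.Base using (_+_; _*_; _-_; -_; _<_)
  open RationalArithmetic
  open Coefficients using (1/!²-suc)
  open Recurrence using (rec; rec-step; 0<ι+2)

  e : ℕ → ℕ → ℚ
  e n j = poch (- ι n) j * poch (ι (suc n)) j * 1/!² j

  e-suc : ∀ n j → (ι j + 1) * (ι j + 1) * e n (suc j) ≡ e n j * ((ι j - ι n) * (ι n + 1 + ι j))
  e-suc n j = by-2 (A * (- ι n + ι j) * (B * (ι (suc n) + ι j))) (A * (- ι n + ι j) * B * 1/!² j)
    (1/!²-suc j) (ι-suc n) (lemma (ι n) (ι (suc n)) (ι j) A B (1/!² j) (1/!² (suc j)))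
    where
    A B : ℚ
    A = poch (- ι n) j
    B = poch (ι (suc n)) j
    lemma : ∀ n n₁ j A B u u₁ →
      (j + 1) * (j + 1) * (A * (- n + j) * (B * (n₁ + j)) * u₁) - A * B * u * ((j - n) * (n + 1 + j))
      ≡ A * (- n + j) * (B * (n₁ + j)) * ((j + 1) * (j + 1) * u₁ - u) + A * (- n + j) * B * u * (n₁ - (n + 1))
    lemma = solve-∀ ring

  0<[j+1]² : ∀ j → 0 < (ι j + 1) * (ι j + 1)
  0<[j+1]² j = Rational.*-pos (nonNeg+pos (0≤ι j) lit<) (nonNeg+pos (0≤ι j) lit<)

  -- The ratio of the coefficients in n. It stays undivided because n + 1 - j vanishes at j = n + 1,
  -- the top degree of the next polynomial.
  e-shift : ∀ n j → (ι n + 1 - ι j) * e (suc n) j ≡ (ι n + 1 + ι j) * e n j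
  e-shift n zero    = lemma (ι n) (1/!² 0)
    where
    lemma : ∀ n u → (n + 1 - 0) * (1 * 1 * u) ≡ (n + 1 + 0) * (1 * 1 * u)
    lemma = solve-∀ ring
  e-shift n (suc j) = subst (λ m → (ι n + 1 - m) * e (suc n) (suc j) ≡ (ι n + 1 + m) * e n (suc j)) (sym (ι-suc j))
    (*-cancel-pos ((ι j + 1) * (ι j + 1)) (0<[j+1]² j) (by-3
      (ι n - ι j) (- (ι n + 2 + ι j)) (- ((ι n + 2 + ι j) * (ι n - ι j)))
      (subst (λ m → (ι j + 1) * (ι j + 1) * e (suc n) (suc j) ≡ e (suc n) j * ((ι j - m) * (m + 1 + ι j))) (ι-suc n) (e-suc (suc n) j))
      (e-suc n j) (e-shift n j)
      (lemma (ι n) (ι j) (e (suc n) (suc j)) (e n (suc j)) (e (suc n) j) (e n j))))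
    where
    lemma : ∀ n j e₁′ e₀′ e₁ e₀ →
      (j + 1) * (j + 1) * ((n + 1 - (j + 1)) * e₁′) - (j + 1) * (j + 1) * ((n + 1 + (j + 1)) * e₀′)
      ≡ (n - j) * ((j + 1) * (j + 1) * e₁′ - e₁ * ((j - (n + 1)) * (n + 1 + 1 + j)))
      + - (n + 2 + j) * ((j + 1) * (j + 1) * e₀′ - e₀ * ((j - n) * (n + 1 + j)))
      + - ((n + 2 + j) * (n - j)) * ((n + 1 - j) * e₁ - (n + 1 + j) * e₀)
    lemma = solve-∀ ring

  -- Bonnet's recurrence by coefficients of v = (1 - x)/2: since x = 1 - 2v, multiplication by x
  -- brings in the coefficient of the previous power.
  e-recurrence : ∀ n j → (ι n + 2) * e (suc (suc n)) (suc j)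
    ≡ (2 * ι n + 3) * (e (suc n) (suc j) - 2 * e (suc n) j) - (ι n + 1) * e n (suc j)
  e-recurrence n j = *-cancel-pos ((ι j + 1) * (ι j + 1)) (0<[j+1]² j) (by-5
    (ι n + 2) (- (2 * ι n + 3)) (ι n + 1) (- ((ι n + 2) * (ι n + 3 + ι j))) (- ((ι n + 1) * (ι j - ι n)))
    (subst (λ m → (ι j + 1) * (ι j + 1) * e (suc (suc n)) (suc j) ≡ e (suc (suc n)) j * ((ι j - m) * (m + 1 + ι j)))
      (trans (ι-+ 2 n) (ℚ.+-comm 2 (ι n))) (e-suc (suc (suc n)) j))
    (subst (λ m → (ι j + 1) * (ι j + 1) * e (suc n) (suc j) ≡ e (suc n) j * ((ι j - m) * (m + 1 + ι j))) (ι-suc n) (e-suc (suc n) j))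
    (e-suc n j)
    (subst (λ m → (m + 1 - ι j) * e (suc (suc n)) j ≡ (m + 1 + ι j) * e (suc n) j) (ι-suc n) (e-shift (suc n) j))
    (e-shift n j)
    (lemma (ι n) (ι j) (e (suc (suc n)) (suc j)) (e (suc n) (suc j)) (e n (suc j)) (e (suc (suc n)) j) (e (suc n) j) (e n j)))
    where
    lemma : ∀ n j e₂′ e₁′ e₀′ e₂ e₁ e₀ →
      (j + 1) * (j + 1) * ((n + 2) * e₂′) - (j + 1) * (j + 1) * ((2 * n + 3) * (e₁′ - 2 * e₁) - (n + 1) * e₀′)
      ≡ (n + 2) * ((j + 1) * (j + 1) * e₂′ - e₂ * ((j - (n + 2)) * (n + 2 + 1 + j)))
      + - (2 * n + 3) * ((j + 1) * (j + 1) * e₁′ - e₁ * ((j - (n + 1)) * (n + 1 + 1 + j)))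
      + (n + 1) * ((j + 1) * (j + 1) * e₀′ - e₀ * ((j - n) * (n + 1 + j)))
      + - ((n + 2) * (n + 3 + j)) * ((n + 1 + 1 - j) * e₂ - (n + 1 + 1 + j) * e₁)
      + - ((n + 1) * (j - n)) * ((n + 1 - j) * e₁ - (n + 1 + j) * e₀)
    lemma = solve-∀ ring

  -- Beyond the degree the Pochhammer symbol of -n contains the factor 0. Polynomials of three
  -- different degrees can thus be summed to a common length.
  e-zero : ∀ n → e n (suc n) ≡ 0
  e-zero n = *-cancel-pos ((ι n + 1) * (ι n + 1)) (0<[j+1]² n) (trans (e-suc n n) (lemma (e n n) (ι n)))
    where
    lemma : ∀ e n → e * ((n - n) * (n + 1 + n)) ≡ (n + 1) * (n + 1) * 0
    lemma = solve-∀ ring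

  e-zero′ : ∀ n → e n (suc (suc n)) ≡ 0
  e-zero′ n = *-cancel-pos ((ι (suc n) + 1) * (ι (suc n) + 1)) (0<[j+1]² (suc n))
    (trans (e-suc n (suc n)) (trans (cong (_* ((ι (suc n) - ι n) * (ι n + 1 + ι (suc n)))) (e-zero n))
      (lemma (ι (suc n)) ((ι (suc n) - ι n) * (ι n + 1 + ι (suc n))))))
    where
    lemma : ∀ m x → 0 * x ≡ (m + 1) * (m + 1) * 0
    lemma = solve-∀ ring

  partial : ℕ → ℕ → ℚ → ℚ
  partial J n v = ∑ J (λ j → e n j * v ↑ j)

  -- Truncation leaves one top term, produced by the shift in v. It vanishes as soon as J exceeds
  -- the degree n + 1.
  partial-recurrence : ∀ J n v → (ι n + 2) * partial (suc J) (suc (suc n)) v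
    ≡ (2 * ι n + 3) * (1 - 2 * v) * partial (suc J) (suc n) v - (ι n + 1) * partial (suc J) n v
      + 2 * (2 * ι n + 3) * (e (suc n) J * v ↑ suc J)
  partial-recurrence zero n v = lemma (ι n) v
    where
    lemma : ∀ n v → (n + 2) * (0 + 1 * 1)
      ≡ (2 * n + 3) * (1 - 2 * v) * (0 + 1 * 1) - (n + 1) * (0 + 1 * 1) + 2 * (2 * n + 3) * (1 * (v * 1))
    lemma = solve-∀ ring
  partial-recurrence (suc J) n v = by-2 1 (v ↑ suc J) (partial-recurrence J n v) (e-recurrence n J)
    (lemma (ι n) v (v ↑ suc J) (partial (suc J) (suc (suc n)) v) (partial (suc J) (suc n) v) (partial (suc J) n v)
      (e (suc (suc n)) (suc J)) (e (suc n) (suc J)) (e n (suc J)) (e (suc n) J))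
    where
    lemma : ∀ n v y S₂ S₁ S₀ e₂ e₁ e₀ e₁₋ →
      (n + 2) * (S₂ + e₂ * y)
        - ((2 * n + 3) * (1 - 2 * v) * (S₁ + e₁ * y) - (n + 1) * (S₀ + e₀ * y) + 2 * (2 * n + 3) * (e₁ * (v * y)))
      ≡ 1 * ((n + 2) * S₂ - ((2 * n + 3) * (1 - 2 * v) * S₁ - (n + 1) * S₀ + 2 * (2 * n + 3) * (e₁₋ * y)))
      + y * ((n + 2) * e₂ - ((2 * n + 3) * (e₁ - 2 * e₁₋) - (n + 1) * e₀))
    lemma = solve-∀ ring

  legendreℚ : ℕ → ℚ → ℚ
  legendreℚ n x = partial (suc n) n ((1 - x) * ½)

  legendre-recurrence : ∀ n x → (ι n + 2) * legendreℚ (suc (suc n)) x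
    ≡ (2 * ι n + 3) * x * legendreℚ (suc n) x - (ι n + 1) * legendreℚ n x
  legendre-recurrence n x = by-4 1
    (2 * (2 * ι n + 3) * v ↑ suc (suc (suc n)) + (2 * ι n + 3) * x * v ↑ suc (suc n))
    (- ((ι n + 1) * v ↑ suc n)) (- ((ι n + 1) * v ↑ suc (suc n)))
    (partial-recurrence (suc (suc n)) n v) (e-zero (suc n)) (e-zero n) (e-zero′ n)
    (lemma (ι n) x (legendreℚ (suc (suc n)) x) (legendreℚ (suc n) x) (legendreℚ n x)
      (e (suc n) (suc (suc n))) (e n (suc n)) (e n (suc (suc n))) (v ↑ suc n))
    where
    v : ℚ
    v = (1 - x) * ½
    lemma : ∀ n x S₂ S₁ S₀ a b c y → (n + 2) * S₂ - ((2 * n + 3) * x * S₁ - (n + 1) * S₀)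
      ≡ 1 * ((n + 2) * S₂ - ((2 * n + 3) * (1 - 2 * ((1 - x) * ½)) * (S₁ + a * ((1 - x) * ½ * y))
          - (n + 1) * (S₀ + b * y + c * ((1 - x) * ½ * y))
          + 2 * (2 * n + 3) * (a * ((1 - x) * ½ * ((1 - x) * ½ * y)))))
      + (2 * (2 * n + 3) * ((1 - x) * ½ * ((1 - x) * ½ * y)) + (2 * n + 3) * x * ((1 - x) * ½ * y)) * (a - 0)
      + - ((n + 1) * y) * (b - 0) + - ((n + 1) * ((1 - x) * ½ * y)) * (c - 0)
    lemma = solve-∀ ring

  -- Multiplied by zⁿ⁺², Bonnet's recurrence contains x and z only through xz and z². There is no
  -- division by z, so z may vanish.
  legendre-homogeneous : ∀ n x z → legendreℚ n x * z ↑ n ≡ rec (x * z) (z * z) n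
  legendre-homogeneous zero x z = refl
  legendre-homogeneous (suc zero) x z = lemma x z
    where
    lemma : ∀ x z → (0 + 1 * 1 + - 2 * ((1 - x) * ½ * 1)) * (z * 1) ≡ x * z
    lemma = solve-∀ ring
  legendre-homogeneous (suc (suc n)) x z = *-cancel-pos (ι n + 2) (0<ι+2 n) (by-4
    (z * (z * z ↑ n)) ((2 * ι n + 3) * (x * z)) (- ((ι n + 1) * (z * z))) (- 1)
    (legendre-recurrence n x) (legendre-homogeneous (suc n) x z) (legendre-homogeneous n x z)
    (rec-step (x * z) (z * z) n)
    (lemma (ι n) x z (z ↑ n) (legendreℚ (suc (suc n)) x) (legendreℚ (suc n) x) (legendreℚ n x)
      (rec (x * z) (z * z) (suc (suc n))) (rec (x * z) (z * z) (suc n)) (rec (x * z) (z * z) n)))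
    where
    lemma : ∀ n x z y L₂ L₁ L₀ r₂ r₁ r₀ →
      (n + 2) * (L₂ * (z * (z * y))) - (n + 2) * r₂
      ≡ z * (z * y) * ((n + 2) * L₂ - ((2 * n + 3) * x * L₁ - (n + 1) * L₀))
      + (2 * n + 3) * (x * z) * (L₁ * (z * y) - r₁)
      + - ((n + 1) * (z * z)) * (L₀ * y - r₀)
      + - 1 * ((n + 2) * r₂ - ((2 * n + 3) * (x * z) * r₁ - (n + 1) * (z * z) * r₀))
    lemma = solve-∀ ring

-- Transfer to the Cauchy reals: null sequences, equality and double limits.

open import Defs
open Rational
open Arithmetic
open Inversion
open Root
open Positivity
open Denominators
open RationalArithmetic using
  (ring; number-ℚ; ι; ∑; ∑-cong; _↑_; lit<; lit≤; 0≤ι; 0<ι; _⊹_; _⊛_; ≤-by; by-1; by-2; ∣∣-≤; ≤-∣∣; -≤-∣∣;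
   0≤-diff; 0≤-square; nonNeg+pos; square-cancel-≤; *-cancel-≤; *-monoˡ; *-monoʳ; invℚ-pos; 0<invℚ)
open Wallis using (a; wallis; 0≤πsum)
open Coefficients using (c; κ; 0≤κ; 2κ²)
open Polynomials using
  (Poly; X; con; _⊞_; _⊟_; _⊠_; ⟦_⟧; ∂; curve; taylor; ∂-bound; curve-bound; InUnit; unit-∣∣; ∣+∣≤; ∣*∣≤; ∣-∣≤)
open Recurrence using (rec; P; d)
open Flow using (σP; dP; pP; p₋P; ⟦pP⟧; ⟦p₋P⟧; Ψ; ΨP; ⟦ΨP⟧; θ-limit)
open CubicReduction using
  (boundary; boundary-limit; qOf; cubic₃; cubic₂; cubic₁; cubic₀; module Parameter)
open LegendrePolynomials using (e; legendreℚ; legendre-homogeneous)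

map-eventually : ∀ {P Q : ℕ → Set} → (∀ n → P n → Q n) → Eventually P → Eventually Q
map-eventually f (N , p) = N , λ n le → f n (p n le)

always : ∀ {P : ℕ → Set} → (∀ n → P n) → Eventually P
always p = 0 , λ n _ → p n

Small : (ℕ → ℚ) → Set
Small z = ∀ ε → 0ℚ ℚ.< ε → Eventually λ n → ℚ.∣ z n ∣ ℚ.≤ ε

half<id : ∀ {ε} → 0ℚ ℚ.< ε → ε ℚ.* ½ ℚ.< ε
half<id {ε} 0<ε = subst (ε ℚ.* ½ ℚ.<_) (halve ε)
  (subst (ℚ._< ε ℚ.* ½ ℚ.+ ε ℚ.* ½) (ℚ.+-identityˡ (ε ℚ.* ½)) (ℚ.+-monoˡ-< (ε ℚ.* ½) (half-pos 0<ε)))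

small⇒≈ : ∀ {x y} → Small (λ n → seq x n ℚ.- seq y n) → x ≈ y
small⇒≈ s = mk≈ λ ε 0<ε → map-eventually (λ n le → ℚ.≤-<-trans le (half<id 0<ε)) (s (ε ℚ.* ½) (half-pos 0<ε))

≈⇒small : ∀ {x y} → x ≈ y → Small (λ n → seq x n ℚ.- seq y n)
≈⇒small (mk≈ p) ε 0<ε = map-eventually (λ n → ℚ.<⇒≤) (p ε 0<ε)

small-+ : ∀ {u v} → Small u → Small v → Small (λ n → u n ℚ.+ v n)
small-+ {u} {v} su sv ε 0<ε = map-eventually
  (λ n (p , q) → ℚ.≤-trans (ℚ.∣p+q∣≤∣p∣+∣q∣ (u n) (v n))
    (ℚ.≤-trans (ℚ.+-mono-≤ p q) (ℚ.≤-reflexive (halve ε))))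
  (both (su (ε ℚ.* ½) (half-pos 0<ε)) (sv (ε ℚ.* ½) (half-pos 0<ε)))

small-* : ∀ (x : ℝ) {u} → Small u → Small (λ n → seq x n ℚ.* u n)
small-* x {u} su ε 0<ε =
  let K , 0<K , bx = bounded x
      δ , 0<δ , δK≡ε = scaled K 0<ε 0<K
  in map-eventually (λ n (p , q) → subst₂ ℚ._≤_ (sym (ℚ.∣p*q∣≡∣p∣*∣q∣ (seq x n) (u n)))
       (trans (ℚ.*-comm K δ) δK≡ε) (*-mono (ℚ.0≤∣p∣ (u n)) (ℚ.<⇒≤ 0<K) p q))
     (both bx (su δ 0<δ))

small-≡ : ∀ {u v : ℕ → ℚ} → (∀ n → u n ≡ v n) → Small u → Small v
small-≡ u≡v su ε 0<ε = map-eventually (λ n → subst (λ z → ℚ.∣ z ∣ ℚ.≤ ε) (u≡v n)) (su ε 0<ε)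

eventually≡⇒≈ : ∀ {x y} → Eventually (λ n → seq x n ≡ seq y n) → x ≈ y
eventually≡⇒≈ {x} {y} (N , p) = small⇒≈ λ ε 0<ε → N , λ n le →
  subst (λ z → ℚ.∣ z ∣ ℚ.≤ ε) (sym (trans (cong (ℚ._- seq y n) (p n le)) (ℚ.+-inverseʳ (seq y n)))) (ℚ.<⇒≤ 0<ε)

pointwise : ∀ {x y} → (∀ n → seq x n ≡ seq y n) → x ≈ y
pointwise p = eventually≡⇒≈ (always p)

≈-refl : ∀ {x} → x ≈ x
≈-refl = pointwise λ _ → refl

-- The counterpart of `by-1` for `_≈_`: the identity is checked between the n-th rational terms, so
-- the ring solver over ℚ serves for the reals too. The multiplier is a real because it has to be
-- bounded.
by-ℝ₁ : ∀ {x y l r} a → l ≈ r →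
  (∀ n → seq x n ℚ.- seq y n ≡ seq a n ℚ.* (seq l n ℚ.- seq r n)) → x ≈ y
by-ℝ₁ a h eq = small⇒≈ (small-≡ (λ n → sym (eq n)) (small-* a (≈⇒small h)))

by-ℝ₂ : ∀ {x y l r l′ r′} a b → l ≈ r → l′ ≈ r′ →
  (∀ n → seq x n ℚ.- seq y n ≡ seq a n ℚ.* (seq l n ℚ.- seq r n) ℚ.+ seq b n ℚ.* (seq l′ n ℚ.- seq r′ n)) → x ≈ y
by-ℝ₂ a b h h′ eq = small⇒≈ (small-≡ (λ n → sym (eq n))
  (small-+ (small-* a (≈⇒small h)) (small-* b (≈⇒small h′))))

by-ℝ₃ : ∀ {x y l r l′ r′ l″ r″} a b c → l ≈ r → l′ ≈ r′ → l″ ≈ r″ →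
  (∀ n → seq x n ℚ.- seq y n ≡ seq a n ℚ.* (seq l n ℚ.- seq r n) ℚ.+ seq b n ℚ.* (seq l′ n ℚ.- seq r′ n)
    ℚ.+ seq c n ℚ.* (seq l″ n ℚ.- seq r″ n)) → x ≈ y
by-ℝ₃ a b c h h′ h″ eq = small⇒≈ (small-≡ (λ n → sym (eq n))
  (small-+ (small-+ (small-* a (≈⇒small h)) (small-* b (≈⇒small h′))) (small-* c (≈⇒small h″))))

by-ℝ₄ : ∀ {x y l₁ r₁ l₂ r₂ l₃ r₃ l₄ r₄} a b c d → l₁ ≈ r₁ → l₂ ≈ r₂ → l₃ ≈ r₃ → l₄ ≈ r₄ →
  (∀ n → seq x n ℚ.- seq y n ≡ seq a n ℚ.* (seq l₁ n ℚ.- seq r₁ n) ℚ.+ seq b n ℚ.* (seq l₂ n ℚ.- seq r₂ n)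
    ℚ.+ seq c n ℚ.* (seq l₃ n ℚ.- seq r₃ n) ℚ.+ seq d n ℚ.* (seq l₄ n ℚ.- seq r₄ n)) → x ≈ y
by-ℝ₄ a b c d h₁ h₂ h₃ h₄ eq = small⇒≈ (small-≡ (λ n → sym (eq n))
  (small-+ (small-+ (small-+ (small-* a (≈⇒small h₁)) (small-* b (≈⇒small h₂)))
    (small-* c (≈⇒small h₃))) (small-* d (≈⇒small h₄))))

≈-sym : ∀ {x y} → x ≈ y → y ≈ x
≈-sym {x} {y} h = by-ℝ₁ (fromℚ (ℚ.- 1ℚ)) h (λ n → lemma (seq x n) (seq y n))
  where
  lemma : ∀ x y → y ℚ.- x ≡ ℚ.- 1ℚ ℚ.* (x ℚ.- y)
  lemma = solve-∀ ring

≈-trans : ∀ {x y z} → x ≈ y → y ≈ z → x ≈ z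
≈-trans {x} {y} {z} h h′ = by-ℝ₂ 1ℝ 1ℝ h h′ (λ n → lemma (seq x n) (seq y n) (seq z n))
  where
  lemma : ∀ x y z → x ℚ.- z ≡ 1ℚ ℚ.* (x ℚ.- y) ℚ.+ 1ℚ ℚ.* (y ℚ.- z)
  lemma = solve-∀ ring

+-cong : ∀ {x x′ y y′} → x ≈ x′ → y ≈ y′ → x + y ≈ x′ + y′
+-cong {x} {x′} {y} {y′} h h′ = by-ℝ₂ 1ℝ 1ℝ h h′ (λ n → lemma (seq x n) (seq x′ n) (seq y n) (seq y′ n))
  where
  lemma : ∀ x x′ y y′ → (x ℚ.+ y) ℚ.- (x′ ℚ.+ y′) ≡ 1ℚ ℚ.* (x ℚ.- x′) ℚ.+ 1ℚ ℚ.* (y ℚ.- y′)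
  lemma = solve-∀ ring

neg-cong : ∀ {x x′} → x ≈ x′ → - x ≈ - x′
neg-cong {x} {x′} h = by-ℝ₁ (fromℚ (ℚ.- 1ℚ)) h (λ n → lemma (seq x n) (seq x′ n))
  where
  lemma : ∀ x x′ → (ℚ.- x) ℚ.- (ℚ.- x′) ≡ ℚ.- 1ℚ ℚ.* (x ℚ.- x′)
  lemma = solve-∀ ring

*-cong : ∀ {x x′ y y′} → x ≈ x′ → y ≈ y′ → x * y ≈ x′ * y′
*-cong {x} {x′} {y} {y′} h h′ = by-ℝ₂ y x′ h h′ (λ n → lemma (seq x n) (seq x′ n) (seq y n) (seq y′ n))
  where
  lemma : ∀ x x′ y y′ → (x ℚ.* y) ℚ.- (x′ ℚ.* y′) ≡ y ℚ.* (x ℚ.- x′) ℚ.+ x′ ℚ.* (y ℚ.- y′)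
  lemma = solve-∀ ring

-cong : ∀ {x x′ y y′} → x ≈ x′ → y ≈ y′ → x - y ≈ x′ - y′
-cong h h′ = +-cong h (neg-cong h′)

inv-right : ∀ x (x#0 : x # 0ℝ) → x * inv x x#0 ≈ 1ℝ
inv-right x x#0 = let γ , 0<γ , sep = separated x x#0 in
  eventually≡⇒≈ (map-eventually (λ n → invℚ-inverse (seq x n) 0<γ) sep)

-- The ring solver cannot see through `invℚ`, so inverses are identified only by their defining
-- equation.
inv-unique : ∀ {x y} (x#0 : x # 0ℝ) → x * y ≈ 1ℝ → inv x x#0 ≈ y
inv-unique {x} {y} x#0 h = by-ℝ₂ y (- inv x x#0) (inv-right x x#0) h
  (λ n → lemma (seq x n) (seq y n) (seq (inv x x#0) n))
  where
  lemma : ∀ x y i → i ℚ.- y ≡ y ℚ.* (x ℚ.* i ℚ.- 1ℚ) ℚ.+ (ℚ.- i) ℚ.* (x ℚ.* y ℚ.- 1ℚ)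
  lemma = solve-∀ ring

eval : Poly → ℝ → ℝ
eval X       x = x
eval (con a) x = fromℚ a
eval (e ⊞ f) x = eval e x + eval f x
eval (e ⊟ f) x = eval e x - eval f x
eval (e ⊠ f) x = eval e x * eval f x

seq-eval : ∀ e x n → seq (eval e x) n ≡ ⟦ e ⟧ (seq x n)
seq-eval X       x n = refl
seq-eval (con a) x n = refl
seq-eval (e ⊞ f) x n = cong₂ ℚ._+_ (seq-eval e x n) (seq-eval f x n)
seq-eval (e ⊟ f) x n = cong₂ ℚ._-_ (seq-eval e x n) (seq-eval f x n)
seq-eval (e ⊠ f) x n = cong₂ ℚ._*_ (seq-eval e x n) (seq-eval f x n)

eval-cong : ∀ e {x y} → x ≈ y → eval e x ≈ eval e y
eval-cong X       h = h
eval-cong (con a) h = ≈-refl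
eval-cong (e ⊞ f) h = +-cong (eval-cong e h) (eval-cong f h)
eval-cong (e ⊟ f) h = -cong (eval-cong e h) (eval-cong f h)
eval-cong (e ⊠ f) h = *-cong (eval-cong e h) (eval-cong f h)

-- Convergence read on representatives. The Cauchy index n is chosen after N and may depend on it,
-- which is the order of quantifiers in `wallis`; estimates uniform in the approximant fit in
-- directly.
record Converges (f : ℕ → ℝ) (x : ℝ) : Set where
  constructor converges
  field
    within : ∀ ε → 0ℚ ℚ.< ε →
      Eventually λ N → Eventually λ n → ℚ.∣ seq (f N) n ℚ.- seq x n ∣ ℚ.≤ ε

open Converges

conv-const : ∀ x → Converges (λ _ → x) x
conv-const x = converges λ ε 0<ε → always λ _ → always λ n →
  subst (λ z → ℚ.∣ z ∣ ℚ.≤ ε) (sym (ℚ.+-inverseʳ (seq x n))) (ℚ.<⇒≤ 0<ε)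

∣sum∣≤ : ∀ {u v z ε} → ℚ.∣ u ∣ ℚ.≤ ε ℚ.* ½ → ℚ.∣ v ∣ ℚ.≤ ε ℚ.* ½ → z ≡ u ℚ.+ v → ℚ.∣ z ∣ ℚ.≤ ε
∣sum∣≤ {u} {v} {ε = ε} p q refl = ℚ.≤-trans (ℚ.∣p+q∣≤∣p∣+∣q∣ u v)
  (ℚ.≤-trans (ℚ.+-mono-≤ p q) (ℚ.≤-reflexive (halve ε)))

triangle : ∀ x y z → x ℚ.- z ≡ (x ℚ.- y) ℚ.+ (y ℚ.- z)
triangle = solve-∀ ring

conv-≈ˡ : ∀ {f g x} → (∀ N → f N ≈ g N) → Converges g x → Converges f x
conv-≈ˡ {f} {g} {x} h c = converges λ ε 0<ε → map-eventually
  (λ N ev → map-eventually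
    (λ n (p , q) → ∣sum∣≤ p q (triangle (seq (f N) n) (seq (g N) n) (seq x n)))
    (both (≈⇒small (h N) (ε ℚ.* ½) (half-pos 0<ε)) ev))
  (within c (ε ℚ.* ½) (half-pos 0<ε))

conv-≈ʳ : ∀ {f x y} → x ≈ y → Converges f x → Converges f y
conv-≈ʳ {f} {x} {y} h c = converges λ ε 0<ε → map-eventually
  (λ N ev → map-eventually
    (λ n (p , q) → ∣sum∣≤ q p (triangle (seq (f N) n) (seq x n) (seq y n)))
    (both (≈⇒small h (ε ℚ.* ½) (half-pos 0<ε)) ev))
  (within c (ε ℚ.* ½) (half-pos 0<ε))

conv-+ : ∀ {f g x y} → Converges f x → Converges g y → Converges (λ N → f N + g N) (x + y)
conv-+ {f} {g} {x} {y} c d = converges λ ε 0<ε → map-eventually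
  (λ N (ev , ev′) → map-eventually
    (λ n (p , q) → ∣sum∣≤ p q (lemma (seq (f N) n) (seq (g N) n) (seq x n) (seq y n)))
    (both ev ev′))
  (both (within c (ε ℚ.* ½) (half-pos 0<ε)) (within d (ε ℚ.* ½) (half-pos 0<ε)))
  where
  lemma : ∀ f g x y → (f ℚ.+ g) ℚ.- (x ℚ.+ y) ≡ (f ℚ.- x) ℚ.+ (g ℚ.- y)
  lemma = solve-∀ ring

conv-*ˡ : ∀ a {f x} → Converges f x → Converges (λ N → a * f N) (a * x)
conv-*ˡ a {f} {x} c = converges λ ε 0<ε →
  let K , 0<K , ba = bounded a
      δ , 0<δ , δK≡ε = scaled K 0<ε 0<K
  in map-eventually (λ N ev → map-eventually
       (λ n (p , q) → subst₂ ℚ._≤_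
         (trans (sym (ℚ.∣p*q∣≡∣p∣*∣q∣ (seq a n) (seq (f N) n ℚ.- seq x n)))
           (cong ℚ.∣_∣ (lemma (seq a n) (seq (f N) n) (seq x n))))
         (trans (ℚ.*-comm K δ) δK≡ε)
         (*-mono (ℚ.0≤∣p∣ (seq (f N) n ℚ.- seq x n)) (ℚ.<⇒≤ 0<K) p q))
       (both ba ev)) (within c δ 0<δ)
  where
  lemma : ∀ a f x → a ℚ.* (f ℚ.- x) ≡ a ℚ.* f ℚ.- a ℚ.* x
  lemma = solve-∀ ring

-- f g - x y = (f - x)(g - y) + y (f - x) + x (g - y)
conv-* : ∀ {f g x y} → Converges f x → Converges g y → Converges (λ N → f N * g N) (x * y)
conv-* {f} {g} {x} {y} c d = conv-≈ˡ
  (λ N → pointwise λ n → lemma₁ (seq (f N) n) (seq (g N) n) (seq x n) (seq y n))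
  (conv-≈ʳ (pointwise λ n → lemma₂ (seq x n) (seq y n))
    (conv-+ (conv-+ (conv-+ error (conv-*ˡ y c)) (conv-*ˡ x d)) (conv-const (- (x * y)))))
  where
  lemma₁ : ∀ f g x y → f ℚ.* g
    ≡ ((f ℚ.- x) ℚ.* (g ℚ.- y) ℚ.+ y ℚ.* f) ℚ.+ x ℚ.* g ℚ.+ (ℚ.- (x ℚ.* y))
  lemma₁ = solve-∀ ring
  lemma₂ : ∀ x y → (0ℚ ℚ.+ y ℚ.* x) ℚ.+ x ℚ.* y ℚ.+ (ℚ.- (x ℚ.* y)) ≡ x ℚ.* y
  lemma₂ = solve-∀ ring
  error : Converges (λ N → (f N - x) * (g N - y)) 0ℝ
  error = converges λ ε 0<ε → map-eventually (λ N (ev , ev′) → map-eventually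
      (λ n (p , q) → subst₂ ℚ._≤_
        (trans (sym (ℚ.∣p*q∣≡∣p∣*∣q∣ (seq (f N) n ℚ.- seq x n) (seq (g N) n ℚ.- seq y n)))
          (cong ℚ.∣_∣ (sym (ℚ.+-identityʳ _))))
        (ℚ.*-identityʳ ε)
        (*-mono (ℚ.0≤∣p∣ (seq (g N) n ℚ.- seq y n)) (ℚ.<⇒≤ 0<ε) p q))
      (both ev ev′))
    (both (within c ε 0<ε) (within d 1ℚ (ℚ.positive⁻¹ 1ℚ)))

-- `_<_` asks for a positive rational gap: half of a lower bound of ε is left to the error, the
-- other half becomes the gap.
converges⇒hasSum : ∀ {f s} → Converges (λ N → ∑< N f) s → HasSum f s
converges⇒hasSum {f} {s} c ε 0<ε =
  let γ , 0<γ , low = lower ε 0<ε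
  in map-eventually (λ N ev → mk< (γ ℚ.* ½) (half-pos 0<γ) (map-eventually
       (λ n (p , q) → ≤-by ((seq ε n ℚ.- γ) ℚ.+ (γ ℚ.* ½ ℚ.- ℚ.∣ seq (∑< N f) n ℚ.- seq s n ∣))
         (0≤-diff p ⊹ 0≤-diff q)
         (lemma (seq ε n) γ ℚ.∣ seq (∑< N f) n ℚ.- seq s n ∣))
       (both low ev)))
     (within c (γ ℚ.* ½) (half-pos 0<γ))
  where
  lemma : ∀ e g a → (e ℚ.- a) ℚ.- g ℚ.* ½ ≡ (e ℚ.- g) ℚ.+ (g ℚ.* ½ ℚ.- a)
  lemma = solve-∀ ring

-- Square roots, and the limit of κ.

small-dominated : ∀ {u v} → Eventually (λ n → ℚ.∣ u n ∣ ℚ.≤ ℚ.∣ v n ∣) → Small v → Small u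
small-dominated dom sv ε 0<ε = map-eventually (λ n (p , q) → ℚ.≤-trans p q) (both dom (sv ε 0<ε))

1/suc : ℕ → ℚ
1/suc n = ℤ.+ 1 ℚ./ suc n

small-1/suc : Small 1/suc
small-1/suc ε 0<ε = let N , p = /-archimedean 1 0<ε in N , λ n le →
  subst (ℚ._≤ ε) (sym (ℚ.0≤p⇒∣p∣≡p (0≤/ 1 n))) (ℚ.<⇒≤ (p n le))

1/suc≤1 : ∀ n → 1/suc n ℚ.≤ 1ℚ
1/suc≤1 n = /-mono-≤ 1 n 1 0 (ℕ.*-monoʳ-≤ 1 (ℕ.s≤s ℕ.z≤n))

-- From r² ≤ q ≤ (r + δ)² with δ = 1/(n + 1) the error is at most (2r + 1)δ, and the approximations
-- r are bounded. Positivity of x undoes the absolute value built into `√`.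
√-square : ∀ {x} → 0ℝ < x → √ x * √ x ≈ x
√-square {x} 0<x =
  let γ , 0<γ , low = lower x 0<x
  in small⇒≈ (small-dominated (map-eventually (λ n le → dominated n (ℚ.≤-trans (ℚ.<⇒≤ 0<γ) le)) low)
       (small-* (fromℚ 2 * √ x + 1ℝ) small-1/suc))
  where
  dominated : ∀ n → 0ℚ ℚ.≤ seq x n → ℚ.∣ seq (√ x) n ℚ.* seq (√ x) n ℚ.- seq x n ∣
    ℚ.≤ ℚ.∣ (2 ℚ.* seq (√ x) n ℚ.+ 1ℚ) ℚ.* 1/suc n ∣
  dominated n 0≤x = ℚ.≤-trans (∣∣-≤
    (ℚ.≤-trans (≤-by (0ℚ ℚ.+ (q ℚ.- r ℚ.* r)) (ℚ.≤-refl ⊹ 0≤-diff r²≤q) (lemma₁ q r)) 0≤B)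
    (≤-by (((r ℚ.+ δ) ℚ.* (r ℚ.+ δ) ℚ.- q) ℚ.+ (1ℚ ℚ.- δ) ℚ.* δ)
      (0≤-diff q≤[r+δ]² ⊹ 0≤-diff (1/suc≤1 n) ⊛ 0≤/ 1 n) (lemma₂ q r δ)))
    (p≤∣p∣ B)
    where
    q r δ B : ℚ
    q = seq x n
    r = √approx q n
    δ = 1/suc n
    B = (2 ℚ.* r ℚ.+ 1ℚ) ℚ.* δ
    0≤B : 0ℚ ℚ.≤ B
    0≤B = (0≤ι 2 ⊛ √approx-nonNeg q n ⊹ 0≤ι 1) ⊛ 0≤/ 1 n
    r²≤q : r ℚ.* r ℚ.≤ q
    r²≤q = subst (r ℚ.* r ℚ.≤_) (ℚ.0≤p⇒∣p∣≡p 0≤x) (√approx-lower q n)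
    q≤[r+δ]² : q ℚ.≤ (r ℚ.+ δ) ℚ.* (r ℚ.+ δ)
    q≤[r+δ]² = subst (ℚ._≤ (r ℚ.+ δ) ℚ.* (r ℚ.+ δ)) (ℚ.0≤p⇒∣p∣≡p 0≤x) (ℚ.<⇒≤ (√approx-upper q n))
    lemma₁ : ∀ q r → 0ℚ ℚ.- (r ℚ.* r ℚ.- q) ≡ 0ℚ ℚ.+ (q ℚ.- r ℚ.* r)
    lemma₁ = solve-∀ ring
    lemma₂ : ∀ q r δ → (2 ℚ.* r ℚ.+ 1ℚ) ℚ.* δ ℚ.- ℚ.- (r ℚ.* r ℚ.- q)
      ≡ ((r ℚ.+ δ) ℚ.* (r ℚ.+ δ) ℚ.- q) ℚ.+ (1ℚ ℚ.- δ) ℚ.* δ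
    lemma₂ = solve-∀ ring

0<√ : ∀ {x} → 0ℝ < x → 0ℝ < √ x
0<√ {x} 0<x =
  let γ , 0<γ , low = lower x 0<x
      K , 0<K , bnd = bounded (√ x)
      g , 0<g , gK≡γ/2 = scaled K (half-pos 0<γ) 0<K
  in fromLower (√ x) g 0<g (map-eventually
       (λ n ((low , bnd) , near) → *-cancel-≤ K 0<K (ℚ.≤-trans
         (ℚ.≤-trans (ℚ.≤-reflexive (trans (ℚ.*-comm K g) gK≡γ/2))
           (≤-by ((seq x n ℚ.- γ) ℚ.+ (γ ℚ.* ½ ℚ.- (ℚ.- (seq (√ x) n ℚ.* seq (√ x) n ℚ.- seq x n))))
             (0≤-diff low ⊹ 0≤-diff (-≤-∣∣ near)) (lemma (seq x n) γ (seq (√ x) n ℚ.* seq (√ x) n))))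
         (*-mono (√approx-nonNeg (seq x n) n) (ℚ.<⇒≤ 0<K) (≤-∣∣ bnd) ℚ.≤-refl)))
       (both (both low bnd) (≈⇒small (√-square 0<x) (γ ℚ.* ½) (half-pos 0<γ))))
  where
  lemma : ∀ x g r → r ℚ.- g ℚ.* ½ ≡ (x ℚ.- g) ℚ.+ (g ℚ.* ½ ℚ.- (ℚ.- (r ℚ.- x)))
  lemma = solve-∀ ring

0<inv : ∀ {x} (0<x : 0ℝ < x) → 0ℝ < inv x (pos⇒#0 0<x)
0<inv {x} 0<x =
  let γ , 0<γ , low = lower x 0<x
      K , 0<K , bnd = bounded x
      g , 0<g , gK≡1 = scaled K (ℚ.positive⁻¹ 1ℚ) 0<K
  in fromLower (inv x (pos⇒#0 0<x)) g 0<g (map-eventually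
       (λ n (low , bnd) → let 0<xₙ = ℚ.<-≤-trans 0<γ low in
         *-cancel-≤ K 0<K (ℚ.≤-trans
           (ℚ.≤-reflexive (trans (ℚ.*-comm K g) (trans gK≡1 (sym (invℚ-pos 0<xₙ)))))
           (*-mono (ℚ.<⇒≤ (0<invℚ 0<xₙ)) (ℚ.<⇒≤ 0<K) (≤-∣∣ bnd) ℚ.≤-refl)))
       (both low bnd))

square-injective : ∀ {x y} → 0ℝ < x → 0ℝ < y → x * x ≈ y * y → x ≈ y
square-injective {x} {y} 0<x 0<y h = by-ℝ₂ i (- (x - y)) h (inv-right (x + y) s#0)
  (λ n → lemma (seq x n) (seq y n) (seq i n))
  where
  s#0 = pos⇒#0 (0<+ 0<x 0<y)
  i : ℝ
  i = inv (x + y) s#0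
  lemma : ∀ x y i → x ℚ.- y
    ≡ i ℚ.* (x ℚ.* x ℚ.- y ℚ.* y) ℚ.+ (ℚ.- (x ℚ.+ ℚ.- y)) ℚ.* ((x ℚ.+ y) ℚ.* i ℚ.- 1ℚ)
  lemma = solve-∀ ring

-- |x - t| ≤ |x² - t²|/g when x ≥ 0 and t ≥ g > 0.
conv-square-root : ∀ {f t} → (∀ N n → 0ℚ ℚ.≤ seq (f N) n) → 0ℝ < t →
  Converges (λ N → f N * f N) (t * t) → Converges f t
conv-square-root {f} {t} 0≤f 0<t c =
  let g , 0<g , low = lower t 0<t
  in converges λ ε 0<ε → map-eventually (λ N ev → map-eventually
       (λ n (near , low) → *-cancel-≤ g 0<g (bound (seq (f N) n) (seq t n) (0≤f N n) 0<g low near))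
       (both ev low)) (within c (g ℚ.* ε) (*-pos 0<g 0<ε))
  where
  bound : ∀ x t {g ε} → 0ℚ ℚ.≤ x → 0ℚ ℚ.< g → g ℚ.≤ t → ℚ.∣ x ℚ.* x ℚ.- t ℚ.* t ∣ ℚ.≤ g ℚ.* ε →
    g ℚ.* ℚ.∣ x ℚ.- t ∣ ℚ.≤ g ℚ.* ε
  bound x t {g} {ε} 0≤x 0<g g≤t near = begin
    g ℚ.* ℚ.∣ x ℚ.- t ∣  ≤⟨ *-mono (ℚ.0≤∣p∣ (x ℚ.- t)) 0≤x+t g≤x+t ℚ.≤-refl ⟩
    (x ℚ.+ t) ℚ.* ℚ.∣ x ℚ.- t ∣  ≡⟨ cong (ℚ._* ℚ.∣ x ℚ.- t ∣) (sym (ℚ.0≤p⇒∣p∣≡p 0≤x+t)) ⟩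
    ℚ.∣ x ℚ.+ t ∣ ℚ.* ℚ.∣ x ℚ.- t ∣  ≡⟨ sym (ℚ.∣p*q∣≡∣p∣*∣q∣ (x ℚ.+ t) (x ℚ.- t)) ⟩
    ℚ.∣ (x ℚ.+ t) ℚ.* (x ℚ.- t) ∣  ≡⟨ cong ℚ.∣_∣ (lemma₁ x t) ⟩
    ℚ.∣ x ℚ.* x ℚ.- t ℚ.* t ∣  ≤⟨ near ⟩
    g ℚ.* ε  ∎
    where
    open ℚ.≤-Reasoning
    0≤x+t : 0ℚ ℚ.≤ x ℚ.+ t
    0≤x+t = 0≤x ⊹ ℚ.≤-trans (ℚ.<⇒≤ 0<g) g≤t
    g≤x+t : g ℚ.≤ x ℚ.+ t
    g≤x+t = ≤-by (x ℚ.+ (t ℚ.- g)) (0≤x ⊹ 0≤-diff g≤t) (lemma₂ x t g)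
      where
      lemma₂ : ∀ x t g → (x ℚ.+ t) ℚ.- g ≡ x ℚ.+ (t ℚ.- g)
      lemma₂ = solve-∀ ring
    lemma₁ : ∀ x t → (x ℚ.+ t) ℚ.* (x ℚ.- t) ≡ x ℚ.* x ℚ.- t ℚ.* t
    lemma₁ = solve-∀ ring

conv-even : ∀ {f x} → Converges f x → Converges (λ N → f (N ℕ.* 2)) x
conv-even c = converges λ ε 0<ε → let N₀ , p = within c ε 0<ε in
  N₀ , λ N N₀≤N → p (N ℕ.* 2) (ℕ.≤-trans N₀≤N (ℕ.m≤m*n N 2))

π#0 : π # 0ℝ
π#0 = pos⇒#0 0<π

conv-aπ : Converges (λ N → fromℚ (a N) * π) (fromℚ 2)
conv-aπ = converges wallis

-- (κπ)² is half of the product of two Wallis sequences, each tending to 2 after multiplication by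
-- π, so its limit is 2.
conv-κπ : Converges (λ N → fromℚ (κ N) * π) (√ 2)
conv-κπ = conv-square-root (λ N n → 0≤κ N ⊛ 0≤πsum n) (0<√ (0<fromℕ 1))
  (conv-≈ʳ (≈-sym (≈-trans (√-square (0<fromℕ 1)) (pointwise λ _ → refl)))
    (conv-≈ˡ (λ N → pointwise λ n → sym (halved (a (N ℕ.* 2)) (a N) (κ N) (πsum n) (2κ² N)))
      (conv-*ˡ (fromℚ ½) (conv-* (conv-even conv-aπ) conv-aπ))))
  where
  halved : ∀ A B K p → 2 ℚ.* (K ℚ.* K) ≡ A ℚ.* B →
    ½ ℚ.* ((A ℚ.* p) ℚ.* (B ℚ.* p)) ≡ (K ℚ.* p) ℚ.* (K ℚ.* p)
  halved A B K p h = trans (lemma₁ A B p) (trans (cong (λ z → ½ ℚ.* (z ℚ.* (p ℚ.* p))) (sym h)) (lemma₂ K p))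
    where
    lemma₁ : ∀ A B p → ½ ℚ.* ((A ℚ.* p) ℚ.* (B ℚ.* p)) ≡ ½ ℚ.* (A ℚ.* B ℚ.* (p ℚ.* p))
    lemma₁ = solve-∀ ring
    lemma₂ : ∀ K p → ½ ℚ.* (2 ℚ.* (K ℚ.* K) ℚ.* (p ℚ.* p)) ≡ (K ℚ.* p) ℚ.* (K ℚ.* p)
    lemma₂ = solve-∀ ring

conv-κ : Converges (λ N → fromℚ (κ N)) (inv π π#0 * √ 2)
conv-κ = conv-≈ˡ (λ N → by-ℝ₁ (- fromℚ (κ N)) (inv-right π π#0)
    (λ n → lemma (κ N) (πsum n) (seq (inv π π#0) n)))
  (conv-*ˡ (inv π π#0) conv-κπ)
  where
  lemma : ∀ k p i → k ℚ.- i ℚ.* (k ℚ.* p) ≡ (ℚ.- k) ℚ.* (p ℚ.* i ℚ.- 1ℚ)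
  lemma = solve-∀ ring

-- The series at a fixed real k.

seq-∑< : ∀ N f n → seq (∑< N f) n ≡ ∑ N (λ i → seq (f i) n)
seq-∑< zero    f n = refl
seq-∑< (suc N) f n = cong (ℚ._+ seq (f N) n) (seq-∑< N f n)

boundaryP : ℕ → Poly
boundaryP N = con (16 ℚ.* ι N ℚ.* ι N ℚ.* c N) ⊠ (con (ι N ℚ.+ 1) ⊠ dP ⊠ p₋P N ⊟ con (ι N) ⊠ pP N)

⟦boundaryP⟧ : ∀ N x → ⟦ boundaryP N ⟧ x ≡ boundary N x
⟦boundaryP⟧ N x = cong₂
  (λ u v → 16 ℚ.* ι N ℚ.* ι N ℚ.* c N ℚ.* ((ι N ℚ.+ 1) ℚ.* d x ℚ.* u ℚ.- ι N ℚ.* v))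
  (⟦p₋P⟧ N x) (⟦pP⟧ N x)

0<1-x : ∀ x → x < 1ℝ → 0ℝ < 1 - x
0<1-x x (mk< g 0<g ev) = fromLower (1 - x) g 0<g ev

module Curve (k : ℝ) (0<k : 0ℝ < k) (k<1 : k < 1ℝ) where

  u w s i θ q : ℝ
  u = 1 + 3 * k
  0<u : 0ℝ < u
  0<u = 0<1+3k k 0<k
  w = inv u (pos⇒#0 0<u)
  s = √ u
  0<s : 0ℝ < s
  0<s = 0<√ 0<u
  i = inv s (pos⇒#0 0<s)
  -- This is (1 + k)/√(1 + 3k), as 1 + k = (u + 2)/3. In this form 9θ² = (s - 2/s)² + 8 holds for
  -- every positive rational s, so 9(1 - θ²) ≤ 1 is exact although s only approximates √u.
  θ = (s + 2 * i) * ⅓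
  q = k * (1 - k) * w

  s² : s * s ≈ u
  s² = √-square 0<u

  si : s * i ≈ 1ℝ
  si = inv-right s (pos⇒#0 0<s)

  uw : u * w ≈ 1ℝ
  uw = inv-right u (pos⇒#0 0<u)

  0<i : 0ℝ < i
  0<i = 0<inv 0<s

  0<θ : 0ℝ < θ
  0<θ = 0<* (0<+ 0<s (0<* (0<fromℕ 1) 0<i)) (0<fromℚ lit<)

  0<q : 0ℝ < q
  0<q = 0<* (0<* 0<k (0<1-x k k<1)) (0<inv 0<u)

  w≈i² : w ≈ i * i
  w≈i² = inv-unique (pos⇒#0 0<u) (by-ℝ₂ (- (i * i)) (s * i + 1) s² si
    (λ n → lemma (seq u n) (seq s n) (seq i n)))
    where
    lemma : ∀ u s i → u ℚ.* (i ℚ.* i) ℚ.- 1ℚ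
      ≡ (ℚ.- (i ℚ.* i)) ℚ.* (s ℚ.* s ℚ.- u) ℚ.+ (s ℚ.* i ℚ.+ 1) ℚ.* (s ℚ.* i ℚ.- 1ℚ)
    lemma = solve-∀ ring

  1-θ²≈q : 1 - θ * θ ≈ q
  1-θ²≈q = by-ℝ₄ (fromℚ (ℚ.- (ℤ.+ 1 ℚ./ 9))) (fromℚ (ℚ.- (ℤ.+ 4 ℚ./ 9))) (fromℚ (ℤ.+ 4 ℚ./ 9))
    ((u - 5) * fromℚ (ℤ.+ 1 ℚ./ 9))
    s² si w≈i² uw (λ n → lemma (seq k n) (seq s n) (seq i n) (seq w n))
    where
    lemma : ∀ k s i w →
      (1 ℚ.+ (ℚ.- ((s ℚ.+ 2 ℚ.* i) ℚ.* (ℤ.+ 1 ℚ./ 3) ℚ.* ((s ℚ.+ 2 ℚ.* i) ℚ.* (ℤ.+ 1 ℚ./ 3)))))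
        ℚ.- k ℚ.* (1 ℚ.+ (ℚ.- k)) ℚ.* w
      ≡ (ℚ.- (ℤ.+ 1 ℚ./ 9)) ℚ.* (s ℚ.* s ℚ.- (1 ℚ.+ 3 ℚ.* k)) ℚ.+ (ℚ.- (ℤ.+ 4 ℚ./ 9)) ℚ.* (s ℚ.* i ℚ.- 1ℚ)
        ℚ.+ (ℤ.+ 4 ℚ./ 9) ℚ.* (w ℚ.- i ℚ.* i)
        ℚ.+ ((1 ℚ.+ 3 ℚ.* k) ℚ.+ (ℚ.- 5)) ℚ.* (ℤ.+ 1 ℚ./ 9) ℚ.* ((1 ℚ.+ 3 ℚ.* k) ℚ.* w ℚ.- 1ℚ)
    lemma = solve-∀ ring

  L : ℝ
  L = inv π π#0 * √ 2

  conv-θΨ : Converges (λ N → θ * eval (ΨP N) (1 - θ * θ)) L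
  conv-θΨ = conv-≈ˡ (λ N → pointwise λ n → lemma₁ (seq θ n ℚ.* seq (eval (ΨP N) (1 - θ * θ)) n) (κ N))
    (conv-≈ʳ (pointwise λ n → ℚ.+-identityˡ (seq L n)) (conv-+ difference conv-κ))
    where
    lemma₁ : ∀ x y → x ≡ (x ℚ.+ (ℚ.- y)) ℚ.+ y
    lemma₁ = solve-∀ ring
    difference : Converges (λ N → θ * eval (ΨP N) (1 - θ * θ) - fromℚ (κ N)) 0ℝ
    difference =
      let γ , 0<γ , s≥γ = lower s 0<s
          η , 0<η , q≥η = lower q 0<q
      in converges λ ε 0<ε → map-eventually
        (λ N estimate → map-eventually
          (λ n ((s≥γ , q≥η) , near) → close (seq s n) γ η ε 0<γ 0<η s≥γ (seq q n) q≥η near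
            N n refl estimate)
          -- The approximants of 1 - θ² and of q differ. Half of the lower bound η pays for the
          -- difference, and η/2 is left as the bound required by `θ-limit`.
          (both (both s≥γ q≥η) (≈⇒small 1-θ²≈q (η ℚ.* ½) (half-pos 0<η))))
        (θ-limit ε (η ℚ.* ½) 0<ε (half-pos 0<η))
      where
      close : ∀ s₀ γ η ε → 0ℚ ℚ.< γ → 0ℚ ℚ.< η → γ ℚ.≤ s₀ → ∀ q₀ → η ℚ.≤ q₀ →
        let θ₀ = (s₀ ℚ.+ 2 ℚ.* invℚ s₀) ℚ.* (ℤ.+ 1 ℚ./ 3) in
        ℚ.∣ (1 ℚ.- θ₀ ℚ.* θ₀) ℚ.- q₀ ∣ ℚ.≤ η ℚ.* ½ →
        ∀ N n → s₀ ≡ seq s n →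
        (∀ θ → 0 ℚ.≤ θ → θ ℚ.≤ 1 → 8 ℚ.≤ 9 ℚ.* (θ ℚ.* θ) → η ℚ.* ½ ℚ.≤ 1 ℚ.- θ ℚ.* θ →
          ℚ.∣ θ ℚ.* Ψ N (1 ℚ.- θ ℚ.* θ) ℚ.- κ N ∣ ℚ.≤ ε) →
        ℚ.∣ (seq θ n ℚ.* seq (eval (ΨP N) (1 - θ * θ)) n ℚ.- κ N) ℚ.- 0ℚ ∣ ℚ.≤ ε
      close s₀ γ η ε 0<γ 0<η γ≤s q₀ η≤q near N n refl estimate = subst (λ z → ℚ.∣ z ∣ ℚ.≤ ε)
        (trans (cong (λ z → θ₀ ℚ.* z ℚ.- κ N) (sym (trans (seq-eval (ΨP N) (1 - θ * θ) n) (⟦ΨP⟧ N (1 ℚ.- θ₀ ℚ.* θ₀)))))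
          (sym (ℚ.+-identityʳ _)))
        (estimate θ₀ 0≤θ θ≤1 8≤9θ² η/2≤)
        where
        i₀ θ₀ : ℚ
        i₀ = invℚ s₀
        θ₀ = (s₀ ℚ.+ 2 ℚ.* i₀) ℚ.* (ℤ.+ 1 ℚ./ 3)
        0<s₀ = ℚ.<-≤-trans 0<γ γ≤s
        0≤θ : 0 ℚ.≤ θ₀
        0≤θ = (ℚ.<⇒≤ 0<s₀ ⊹ 0≤ι 2 ⊛ ℚ.<⇒≤ (0<invℚ 0<s₀)) ⊛ 0≤/ 1 2
        η/2≤ : η ℚ.* ½ ℚ.≤ 1 ℚ.- θ₀ ℚ.* θ₀
        η/2≤ = ≤-by ((q₀ ℚ.- η) ℚ.+ (η ℚ.* ½ ℚ.- (ℚ.- ((1 ℚ.- θ₀ ℚ.* θ₀) ℚ.- q₀))))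
          (0≤-diff η≤q ⊹ 0≤-diff (-≤-∣∣ near)) (lemma₂ (1 ℚ.- θ₀ ℚ.* θ₀) q₀ η)
          where
          lemma₂ : ∀ t q h → t ℚ.- h ℚ.* ½ ≡ (q ℚ.- h) ℚ.+ (h ℚ.* ½ ℚ.- (ℚ.- (t ℚ.- q)))
          lemma₂ = solve-∀ ring
        θ≤1 : θ₀ ℚ.≤ 1
        θ≤1 = square-cancel-≤ lit≤ (≤-by (1 ℚ.- θ₀ ℚ.* θ₀) (ℚ.≤-trans (ℚ.<⇒≤ (half-pos 0<η)) η/2≤) refl)
        8≤9θ² : 8 ℚ.≤ 9 ℚ.* (θ₀ ℚ.* θ₀)
        8≤9θ² = ≤-by ((s₀ ℚ.- 2 ℚ.* i₀) ℚ.* (s₀ ℚ.- 2 ℚ.* i₀)) (0≤-square (s₀ ℚ.- 2 ℚ.* i₀))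
          (by-1 8 (invℚ-pos 0<s₀) (lemma₃ s₀ i₀))
          where
          lemma₃ : ∀ s i → 9 ℚ.* ((s ℚ.+ 2 ℚ.* i) ℚ.* (ℤ.+ 1 ℚ./ 3) ℚ.* ((s ℚ.+ 2 ℚ.* i) ℚ.* (ℤ.+ 1 ℚ./ 3))) ℚ.- 8
            ℚ.- (s ℚ.- 2 ℚ.* i) ℚ.* (s ℚ.- 2 ℚ.* i) ≡ 8 ℚ.* (s ℚ.* i ℚ.- 1)
          lemma₃ = solve-∀ ring

  1/θ : ℝ
  1/θ = inv θ (pos⇒#0 0<θ)

  conv-Ψ : Converges (λ N → eval (ΨP N) q) (1/θ * L)
  conv-Ψ = conv-≈ˡ
    (λ N → ≈-trans (eval-cong (ΨP N) (≈-sym 1-θ²≈q))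
      (by-ℝ₁ (- eval (ΨP N) (1 - θ * θ)) (inv-right θ (pos⇒#0 0<θ))
        (λ n → lemma (seq θ n) (seq 1/θ n) (seq (eval (ΨP N) (1 - θ * θ)) n))))
    (conv-*ˡ 1/θ conv-θΨ)
    where
    lemma : ∀ t i z → z ℚ.- i ℚ.* (t ℚ.* z) ≡ (ℚ.- z) ℚ.* (t ℚ.* i ℚ.- 1ℚ)
    lemma = solve-∀ ring

  conv-boundary : Converges (λ N → eval (boundaryP N) q) 0ℝ
  conv-boundary =
    let γ , 0<γ , k≥γ = lower k 0<k
        η , 0<η , q≥η = lower q 0<q
    in converges λ ε 0<ε → map-eventually
      (λ N estimate → map-eventually
        (λ n (γ≤k , η≤q) → subst (λ z → ℚ.∣ z ∣ ℚ.≤ ε)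
          (trans (sym (trans (seq-eval (boundaryP N) q n) (⟦boundaryP⟧ N (seq q n)))) (sym (ℚ.+-identityʳ _)))
          (estimate (seq q n) η≤q (Parameter.9q≤1 (ℚ.<-≤-trans 0<γ γ≤k))))
        (both k≥γ q≥η))
      (boundary-limit ε η 0<ε 0<η)

  p : ℕ → ℝ
  p n = eval (pP n) q

  term : ℕ → ℝ
  term n = coefficient n * p n *
    (C₃ k 0<k * fromℕ n ^ 3 + C₂ k * fromℕ n ^ 2 + C₁ k * fromℕ n + C₀ k)

  M scaleℝ : ℝ
  M = u ^ 2 * (1 + 3 * k ^ 2)
  scaleℝ = u ^ 4 * inv ((1 + k) ^ 2) (pos⇒#0 (0<^ 2 (0<1+k k 0<k)))

  -- The rational identity holds wherever the approximant of k is positive, hence from some index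
  -- on, and this suffices for equality of reals.
  partial-sum≈ : ∀ N → ∑< N term ≈ 3 * M * eval (ΨP N) q + scaleℝ * eval (boundaryP N) q
  partial-sum≈ N =
    let γ , 0<γ , k≥γ = lower k 0<k
    in eventually≡⇒≈ (map-eventually (λ n γ≤k → begin
      seq (∑< N term) n
        ≡⟨ seq-∑< N term n ⟩
      ∑ N (λ m → seq (term m) n)
        ≡⟨ ∑-cong N (λ m → cong (λ z → c m ℚ.* z ℚ.* cubic (seq k n) m)
             (trans (seq-eval (pP m) q n) (⟦pP⟧ m (seq q n)))) ⟩
      ∑ N (λ m → c m ℚ.* P m (seq q n) ℚ.* cubic (seq k n) m)
        ≡⟨ Parameter.partial-sum (ℚ.<-≤-trans 0<γ γ≤k) N ⟩
      3 ℚ.* seq M n ℚ.* Ψ N (seq q n) ℚ.+ seq scaleℝ n ℚ.* boundary N (seq q n)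
        ≡⟨ cong₂ (λ y z → 3 ℚ.* seq M n ℚ.* y ℚ.+ seq scaleℝ n ℚ.* z)
             (sym (trans (seq-eval (ΨP N) q n) (⟦ΨP⟧ N (seq q n))))
             (sym (trans (seq-eval (boundaryP N) q n) (⟦boundaryP⟧ N (seq q n)))) ⟩
      seq (3 * M * eval (ΨP N) q + scaleℝ * eval (boundaryP N) q) n ∎) k≥γ)
    where
    open ≡-Reasoning
    cubic : ℚ → ℕ → ℚ
    cubic x m = cubic₃ x ℚ.* ι m ↑ 3 ℚ.+ cubic₂ x ℚ.* ι m ↑ 2 ℚ.+ cubic₁ x ℚ.* ι m ℚ.+ cubic₀ x

  1/[1+k] : ℝ
  1/[1+k] = inv (1 + k) (pos⇒#0 (0<1+k k 0<k))

  1/π : ℝ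
  1/π = inv π π#0

  [1+k]⁻¹ : (1 + k) * 1/[1+k] ≈ 1ℝ
  [1+k]⁻¹ = inv-right (1 + k) (pos⇒#0 (0<1+k k 0<k))

  √u⁵ : u ^[5/2] ≈ u * u * s
  √u⁵ = square-injective (0<√ (0<^ 5 0<u)) (0<* (0<* 0<u 0<u) 0<s)
    (≈-trans (√-square (0<^ 5 0<u)) (by-ℝ₁ (- (u * u * (u * u))) s² (λ n → lemma (seq u n) (seq s n))))
    where
    lemma : ∀ u s → u ℚ.* (u ℚ.* (u ℚ.* (u ℚ.* (u ℚ.* 1ℚ)))) ℚ.- u ℚ.* u ℚ.* s ℚ.* (u ℚ.* u ℚ.* s)
      ≡ (ℚ.- (u ℚ.* u ℚ.* (u ℚ.* u))) ℚ.* (s ℚ.* s ℚ.- u)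
    lemma = solve-∀ ring

  1/θ≈ : 1/θ ≈ s * 1/[1+k]
  1/θ≈ = inv-unique (pos⇒#0 0<θ) (by-ℝ₃ (fromℚ (ℤ.+ 1 ℚ./ 3) * 1/[1+k]) (fromℚ (ℤ.+ 2 ℚ./ 3) * 1/[1+k]) 1ℝ
    s² si [1+k]⁻¹ (λ n → lemma (seq k n) (seq s n) (seq i n) (seq 1/[1+k] n)))
    where
    lemma : ∀ k s i j → (s ℚ.+ 2 ℚ.* i) ℚ.* (ℤ.+ 1 ℚ./ 3) ℚ.* (s ℚ.* j) ℚ.- 1ℚ
      ≡ (ℤ.+ 1 ℚ./ 3) ℚ.* j ℚ.* (s ℚ.* s ℚ.- (1 ℚ.+ 3 ℚ.* k)) ℚ.+ (ℤ.+ 2 ℚ./ 3) ℚ.* j ℚ.* (s ℚ.* i ℚ.- 1ℚ)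
        ℚ.+ 1ℚ ℚ.* ((1 ℚ.+ k) ℚ.* j ℚ.- 1ℚ)
    lemma = solve-∀ ring

  1/[[1+k]π] : inv ((1 + k) * π) (pos⇒#0 (0<* (0<1+k k 0<k) 0<π)) ≈ 1/[1+k] * 1/π
  1/[[1+k]π] = inv-unique (pos⇒#0 (0<* (0<1+k k 0<k) 0<π))
    (by-ℝ₂ (π * 1/π) 1ℝ [1+k]⁻¹ (inv-right π π#0)
      (λ n → lemma (seq (1 + k) n) (seq π n) (seq 1/[1+k] n) (seq 1/π n)))
    where
    lemma : ∀ x p j i → x ℚ.* p ℚ.* (j ℚ.* i) ℚ.- 1ℚ
      ≡ p ℚ.* i ℚ.* (x ℚ.* j ℚ.- 1ℚ) ℚ.+ 1ℚ ℚ.* (p ℚ.* i ℚ.- 1ℚ)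
    lemma = solve-∀ ring

  value≈ : 3 * M * (1/θ * L) + scaleℝ * 0ℝ ≈ value k 0<k
  value≈ = ≈-trans
    (≈-trans (+-cong (*-cong {3 * M} ≈-refl (*-cong 1/θ≈ (≈-refl {L}))) ≈-refl)
      (pointwise λ n → lemma (seq u n) (seq (1 + 3 * k ^ 2) n) (seq s n) (seq 1/[1+k] n) (seq 1/π n) (seq (√ 2) n) (seq scaleℝ n)))
    (≈-sym (*-cong (*-cong (*-cong {3 * √ 2} ≈-refl √u⁵) (≈-refl {1 + 3 * k ^ 2})) 1/[[1+k]π]))
    where
    lemma : ∀ u v s j i t z → 3 ℚ.* (u ℚ.* (u ℚ.* 1ℚ) ℚ.* v) ℚ.* (s ℚ.* j ℚ.* (i ℚ.* t)) ℚ.+ z ℚ.* 0ℚ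
      ≡ 3 ℚ.* t ℚ.* (u ℚ.* u ℚ.* s) ℚ.* v ℚ.* (j ℚ.* i)
    lemma = solve-∀ ring

  hasSum : HasSum term (value k 0<k)
  hasSum = converges⇒hasSum (conv-≈ˡ partial-sum≈ (conv-≈ʳ value≈
    (conv-+ (conv-*ˡ (3 * M) conv-Ψ) (conv-*ˡ scaleℝ conv-boundary))))

-- Identification of Pₙ(x) zⁿ with the polynomial in q.

seq-^ : ∀ x n m → seq (x ^ n) m ≡ seq x m ↑ n
seq-^ x zero    m = refl
seq-^ x (suc n) m = cong (seq x m ℚ.*_) (seq-^ x n m)

seq-legendre : ∀ n x m → seq (legendre n x) m ≡ legendreℚ n (seq x m)
seq-legendre n x m = trans (seq-∑< (suc n) _ m)
  (∑-cong (suc n) λ j → cong (e n j ℚ.*_) (seq-^ ((1 - x) * fromℚ ½) j m))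

-- `rec` on reals, built from real operations so that it respects `_≈_`: xz and z² agree with σ(q)
-- and d(q) as reals only, not term by term.
recℝ : ℝ → ℝ → ℕ → ℝ
recℝ s d zero          = 1ℝ
recℝ s d (suc zero)    = s
recℝ s d (suc (suc n)) =
  (fromℚ (2 ℚ.* ι n ℚ.+ 3) * s * recℝ s d (suc n) - fromℚ (ι n ℚ.+ 1) * d * recℝ s d n) * fromℚ (invℚ (ι n ℚ.+ 2))

seq-recℝ : ∀ s d n m → seq (recℝ s d n) m ≡ rec (seq s m) (seq d m) n
seq-recℝ s d zero          m = refl
seq-recℝ s d (suc zero)    m = refl
seq-recℝ s d (suc (suc n)) m = cong₂
  (λ x y → ((2 ℚ.* ι n ℚ.+ 3) ℚ.* seq s m ℚ.* x ℚ.- (ι n ℚ.+ 1) ℚ.* seq d m ℚ.* y) ℚ.* invℚ (ι n ℚ.+ 2))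
  (seq-recℝ s d (suc n) m) (seq-recℝ s d n m)

recℝ-cong : ∀ {s s′ d d′} n → s ≈ s′ → d ≈ d′ → recℝ s d n ≈ recℝ s′ d′ n
recℝ-cong zero          hs hd = ≈-refl
recℝ-cong (suc zero)    hs hd = hs
recℝ-cong (suc (suc n)) hs hd = *-cong (-cong
  (*-cong (*-cong {fromℚ (2 ℚ.* ι n ℚ.+ 3)} ≈-refl hs) (recℝ-cong (suc n) hs hd))
  (*-cong (*-cong {fromℚ (ι n ℚ.+ 1)} ≈-refl hd) (recℝ-cong n hs hd))) ≈-refl

legendre*^≈ : ∀ n x z → legendre n x * z ^ n ≈ recℝ (x * z) (z * z) n
legendre*^≈ n x z = pointwise λ m → trans
  (cong₂ ℚ._*_ (seq-legendre n x m) (seq-^ z n m))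
  (trans (legendre-homogeneous n (seq x m) (seq z m)) (sym (seq-recℝ (x * z) (z * z) n m)))

qℝ : (k : ℝ) → 0ℝ < k → ℝ
qℝ k 0<k = k * (1 - k) * inv (1 + 3 * k) (pos⇒#0 (0<1+3k k 0<k))

module _ (k : ℝ) (0<k : 0ℝ < k) where

  private
    w q E 1/E : ℝ
    w = inv (1 + 3 * k) (pos⇒#0 (0<1+3k k 0<k))
    q = qℝ k 0<k
    E = (1 + 3 * k) ^ 2
    1/E = inv E (pos⇒#0 (0<^ 2 (0<1+3k k 0<k)))

    uw : (1 + 3 * k) * w ≈ 1ℝ
    uw = inv-right (1 + 3 * k) (pos⇒#0 (0<1+3k k 0<k))

    1/E≈ : 1/E ≈ w * w
    1/E≈ = inv-unique (pos⇒#0 (0<^ 2 (0<1+3k k 0<k)))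
      (by-ℝ₁ ((1 + 3 * k) * w + 1) uw (λ n → lemma (seq k n) (seq w n)))
      where
      lemma : ∀ k w → (1 ℚ.+ 3 ℚ.* k) ℚ.* ((1 ℚ.+ 3 ℚ.* k) ℚ.* 1ℚ) ℚ.* (w ℚ.* w) ℚ.- 1ℚ
        ≡ ((1 ℚ.+ 3 ℚ.* k) ℚ.* w ℚ.+ 1) ℚ.* ((1 ℚ.+ 3 ℚ.* k) ℚ.* w ℚ.- 1ℚ)
      lemma = solve-∀ ring

    1-q≈ : fromℚ 1 - q ≈ (1 + k) * (1 + k) * w
    1-q≈ = by-ℝ₁ (fromℚ (ℚ.- 1)) uw (λ n → lemma (seq k n) (seq w n))
      where
      lemma : ∀ k w → (1 ℚ.+ (ℚ.- (k ℚ.* (1 ℚ.+ (ℚ.- k)) ℚ.* w))) ℚ.- (1 ℚ.+ k) ℚ.* (1 ℚ.+ k) ℚ.* w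
        ≡ (ℚ.- 1) ℚ.* ((1 ℚ.+ 3 ℚ.* k) ℚ.* w ℚ.- 1ℚ)
      lemma = solve-∀ ring

    1-7q≈ : fromℚ 1 - fromℚ 7 * q ≈ (1 - 4 * k + 7 * k ^ 2) * w
    1-7q≈ = by-ℝ₁ (fromℚ (ℚ.- 1)) uw (λ n → lemma (seq k n) (seq w n))
      where
      lemma : ∀ k w → (1 ℚ.+ (ℚ.- (7 ℚ.* (k ℚ.* (1 ℚ.+ (ℚ.- k)) ℚ.* w))))
          ℚ.- (1 ℚ.+ (ℚ.- (4 ℚ.* k)) ℚ.+ 7 ℚ.* (k ℚ.* (k ℚ.* 1ℚ))) ℚ.* w
        ≡ (ℚ.- 1) ℚ.* ((1 ℚ.+ 3 ℚ.* k) ℚ.* w ℚ.- 1ℚ)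
      lemma = solve-∀ ring

    1-9q≈ : fromℚ 1 - fromℚ 9 * q ≈ (1 - 3 * k) * (1 - 3 * k) * w
    1-9q≈ = by-ℝ₁ (fromℚ (ℚ.- 1)) uw (λ n → lemma (seq k n) (seq w n))
      where
      lemma : ∀ k w → (1 ℚ.+ (ℚ.- (9 ℚ.* (k ℚ.* (1 ℚ.+ (ℚ.- k)) ℚ.* w))))
          ℚ.- (1 ℚ.+ (ℚ.- (3 ℚ.* k))) ℚ.* (1 ℚ.+ (ℚ.- (3 ℚ.* k))) ℚ.* w
        ≡ (ℚ.- 1) ℚ.* ((1 ℚ.+ 3 ℚ.* k) ℚ.* w ℚ.- 1ℚ)
      lemma = solve-∀ ring

    1-3q≈ : fromℚ 1 - fromℚ 3 * q ≈ (1 + 3 * k ^ 2) * w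
    1-3q≈ = by-ℝ₁ (fromℚ (ℚ.- 1)) uw (λ n → lemma (seq k n) (seq w n))
      where
      lemma : ∀ k w → (1 ℚ.+ (ℚ.- (3 ℚ.* (k ℚ.* (1 ℚ.+ (ℚ.- k)) ℚ.* w))))
          ℚ.- (1 ℚ.+ 3 ℚ.* (k ℚ.* (k ℚ.* 1ℚ))) ℚ.* w
        ≡ (ℚ.- 1) ℚ.* ((1 ℚ.+ 3 ℚ.* k) ℚ.* w ℚ.- 1ℚ)
      lemma = solve-∀ ring

  base²≈ : base k 0<k * base k 0<k ≈ eval dP q
  base²≈ = ≈-trans
    (by-ℝ₁ (B * B * (1/E + w * w)) 1/E≈ (λ n → lemma (seq k n) (seq w n) (seq 1/E n)))
    (≈-sym (*-cong (*-cong 1-9q≈ 1-q≈) (*-cong 1-3q≈ 1-3q≈)))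
    where
    B : ℝ
    B = (1 + k) * (1 - 3 * k) * (1 + 3 * k ^ 2)
    lemma : ∀ k w i → let b = (1 ℚ.+ k) ℚ.* (1 ℚ.+ (ℚ.- (3 ℚ.* k))) ℚ.* (1 ℚ.+ 3 ℚ.* (k ℚ.* (k ℚ.* 1ℚ))) in
      b ℚ.* i ℚ.* (b ℚ.* i)
      ℚ.- (1 ℚ.+ (ℚ.- (3 ℚ.* k))) ℚ.* (1 ℚ.+ (ℚ.- (3 ℚ.* k))) ℚ.* w ℚ.* ((1 ℚ.+ k) ℚ.* (1 ℚ.+ k) ℚ.* w)
        ℚ.* ((1 ℚ.+ 3 ℚ.* (k ℚ.* (k ℚ.* 1ℚ))) ℚ.* w ℚ.* ((1 ℚ.+ 3 ℚ.* (k ℚ.* (k ℚ.* 1ℚ))) ℚ.* w))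
      ≡ b ℚ.* b ℚ.* (i ℚ.+ w ℚ.* w) ℚ.* (i ℚ.- w ℚ.* w)
    lemma = solve-∀ ring

  argument*base≈ : ∀ k#⅓ → argument k 0<k k#⅓ * base k 0<k ≈ eval σP q
  argument*base≈ k#⅓ = ≈-trans
    (by-ℝ₂ (A * (1 + k) * 1/E) (A * (1 + k)) (inv-right D D#0) 1/E≈
      (λ n → lemma (seq k n) (seq (1 - 4 * k + 7 * k ^ 2) n) (seq (1 - 3 * k) n) (seq (1 + 3 * k ^ 2) n)
        (seq w n) (seq 1/E n) (seq (inv D D#0) n)))
    (≈-sym (*-cong 1-q≈ 1-7q≈))
    where
    A D : ℝ
    A = (1 + k) * (1 - 4 * k + 7 * k ^ 2)
    D = (1 - 3 * k) * (1 + 3 * k ^ 2)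
    D#0 : D # 0ℝ
    D#0 = #-*-pos (1-3k#0 k k#⅓) (0<1+3k² k 0<k)
    lemma : ∀ k a x y w i j → (1 ℚ.+ k) ℚ.* a ℚ.* j ℚ.* ((1 ℚ.+ k) ℚ.* x ℚ.* y ℚ.* i)
      ℚ.- (1 ℚ.+ k) ℚ.* (1 ℚ.+ k) ℚ.* w ℚ.* (a ℚ.* w)
      ≡ (1 ℚ.+ k) ℚ.* a ℚ.* (1 ℚ.+ k) ℚ.* i ℚ.* (x ℚ.* y ℚ.* j ℚ.- 1ℚ)
        ℚ.+ (1 ℚ.+ k) ℚ.* a ℚ.* (1 ℚ.+ k) ℚ.* (i ℚ.- w ℚ.* w)
    lemma = solve-∀ ring

  -- The right side has no pole, so it continues the product to k = 1/3 and is independent of the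
  -- proof of apartness.
  product≈ : ∀ n k#⅓ → product n k 0<k k#⅓ ≈ eval (pP n) q
  product≈ n k#⅓ = ≈-trans (legendre*^≈ n (argument k 0<k k#⅓) (base k 0<k))
    (≈-trans (recℝ-cong n (argument*base≈ k#⅓) base²≈)
      (pointwise λ m → trans (seq-recℝ (eval σP q) (eval dP q) n m)
        (sym (trans (seq-eval (pP n) q m) (⟦pP⟧ n (seq q m))))))

  qℝ≈1/9 : k ≈ ⅓ → q ≈ fromℚ (ℤ.+ 1 ℚ./ 9)
  qℝ≈1/9 k≈⅓ = by-ℝ₂ (- ((k - ⅓) * w)) (fromℚ (ℤ.+ 1 ℚ./ 9)) k≈⅓ uw (λ n → lemma (seq k n) (seq w n))
    where
    lemma : ∀ k w → k ℚ.* (1 ℚ.+ (ℚ.- k)) ℚ.* w ℚ.- (ℤ.+ 1 ℚ./ 9)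
      ≡ (ℚ.- ((k ℚ.+ (ℚ.- (ℤ.+ 1 ℚ./ 3))) ℚ.* w)) ℚ.* (k ℚ.- (ℤ.+ 1 ℚ./ 3))
        ℚ.+ (ℤ.+ 1 ℚ./ 9) ℚ.* ((1 ℚ.+ 3 ℚ.* k) ℚ.* w ℚ.- 1ℚ)
    lemma = solve-∀ ring

-- The limit of the products at k = 1/3.

-- By Taylor's formula the difference quotient is the derivative plus (y - x) times `curve`, where
-- |y - x| is crudely bounded by 2. The extra 1 makes the constant positive, so that ε can be
-- divided by it.
lipschitz : ∀ e → ∃ λ Λ → 0ℚ ℚ.< Λ × (∀ x y → InUnit x → InUnit y →
  ℚ.∣ ⟦ e ⟧ y ℚ.- ⟦ e ⟧ x ∣ ℚ.≤ ℚ.∣ y ℚ.- x ∣ ℚ.* Λ)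
lipschitz e = let B , ∂≤ = ∂-bound e ; C , curve≤ = curve-bound e in
  ℚ.∣ B ∣ ℚ.+ 2 ℚ.* ℚ.∣ C ∣ ℚ.+ 1
  , nonNeg+pos (ℚ.0≤∣p∣ B ⊹ 0≤ι 2 ⊛ ℚ.0≤∣p∣ C) (0<ι 1)
  , λ x y i j → ℚ.≤-trans
      (ℚ.≤-reflexive (trans (cong ℚ.∣_∣ (trans (cong (ℚ._- ⟦ e ⟧ x) (taylor e x y))
          (lemma (⟦ e ⟧ x) ((y ℚ.- x) ℚ.* (∂ e x ℚ.+ (y ℚ.- x) ℚ.* curve e x y)))))
        (ℚ.∣p*q∣≡∣p∣*∣q∣ (y ℚ.- x) (∂ e x ℚ.+ (y ℚ.- x) ℚ.* curve e x y))))
      (*-monoˡ ℚ.∣ y ℚ.- x ∣ (ℚ.0≤∣p∣ (y ℚ.- x)) (ℚ.≤-trans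
        (∣+∣≤ {∂ e x} (ℚ.≤-trans (∂≤ x i) (p≤∣p∣ B))
          (∣*∣≤ {y ℚ.- x} (∣-∣≤ {y} (unit-∣∣ j) (unit-∣∣ i)) (ℚ.≤-trans (curve≤ x y i j) (p≤∣p∣ C))))
        (≤-by 1 lit≤ (lemma₂ ℚ.∣ B ∣ ℚ.∣ C ∣))))
  where
  lemma : ∀ a b → (a ℚ.+ b) ℚ.- a ≡ b
  lemma = solve-∀ ring
  lemma₂ : ∀ b c → (b ℚ.+ 2 ℚ.* c ℚ.+ 1) ℚ.- (b ℚ.+ (1 ℚ.+ 1) ℚ.* c) ≡ 1
  lemma₂ = solve-∀ ring

module Near⅓ {h δ} (0<h : 0ℚ ℚ.< h) (h≤1 : h ℚ.≤ 1) (δ≤1 : δ ℚ.≤ 1)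
  (near : ℚ.∣ h ℚ.- (ℤ.+ 1 ℚ./ 3) ∣ ℚ.≤ δ) where
  open Parameter 0<h using (q; 0≤k; uq; 9q≤1)

  private
    1/9 t : ℚ
    1/9 = ℤ.+ 1 ℚ./ 9
    t = h ℚ.- (ℤ.+ 1 ℚ./ 3)

  0≤q : 0 ℚ.≤ q
  0≤q = 0≤k ⊛ 0≤-diff h≤1 ⊛ ℚ.<⇒≤ (0<invℚ (Parameter.0<1+3k 0<h))

  q-inUnit : InUnit q
  q-inUnit = 0≤q , *-cancel-≤ 9 lit< (ℚ.≤-trans 9q≤1 lit≤)

  -- (1 + 3h)(1/9 - q) = (h - 1/3)²: q is stationary at the fold. With t = h - 1/3, the cap |t| ≤ δ
  -- ≤ 1 gives t² ≤ |t| ≤ δ.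
  q-near : ℚ.∣ q ℚ.- 1/9 ∣ ℚ.≤ δ
  q-near = ∣∣-≤
    (ℚ.≤-trans (≤-by (1/9 ℚ.- q) 0≤1/9-q (lemma₁ q)) 0≤δ)
    (≤-by ((δ ℚ.- ℚ.∣ t ∣) ℚ.+ ℚ.∣ t ∣ ℚ.* (1 ℚ.- ℚ.∣ t ∣) ℚ.+ 3 ℚ.* h ℚ.* (1/9 ℚ.- q))
      (0≤-diff near ⊹ ℚ.0≤∣p∣ t ⊛ 0≤-diff (ℚ.≤-trans near δ≤1) ⊹ 0≤ι 3 ⊛ 0≤k ⊛ 0≤1/9-q)
      (by-2 1 1 uq ∣t∣²≡t² (lemma₂ h q δ ℚ.∣ t ∣)))
    where
    0≤δ : 0 ℚ.≤ δ
    0≤δ = ℚ.≤-trans (ℚ.0≤∣p∣ t) near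
    0≤1/9-q : 0 ℚ.≤ 1/9 ℚ.- q
    0≤1/9-q = 0≤-diff {q} {1/9} (*-cancel-≤ 9 lit< (ℚ.≤-trans 9q≤1 lit≤))
    ∣t∣²≡t² : ℚ.∣ t ∣ ℚ.* ℚ.∣ t ∣ ≡ t ℚ.* t
    ∣t∣²≡t² = trans (sym (ℚ.∣p*q∣≡∣p∣*∣q∣ t t)) (ℚ.0≤p⇒∣p∣≡p (0≤-square t))
    lemma₁ : ∀ q → 0ℚ ℚ.- (q ℚ.- (ℤ.+ 1 ℚ./ 9)) ≡ (ℤ.+ 1 ℚ./ 9) ℚ.- q
    lemma₁ = solve-∀ ring
    lemma₂ : ∀ h q δ m → δ ℚ.- (ℚ.- (q ℚ.- (ℤ.+ 1 ℚ./ 9)))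
      ℚ.- ((δ ℚ.- m) ℚ.+ m ℚ.* (1 ℚ.- m) ℚ.+ 3 ℚ.* h ℚ.* ((ℤ.+ 1 ℚ./ 9) ℚ.- q))
      ≡ 1 ℚ.* ((1 ℚ.+ 3 ℚ.* h) ℚ.* q ℚ.- h ℚ.* (1 ℚ.- h))
        ℚ.+ 1 ℚ.* (m ℚ.* m ℚ.- (h ℚ.- (ℤ.+ 1 ℚ./ 3)) ℚ.* (h ℚ.- (ℤ.+ 1 ℚ./ 3)))
    lemma₂ = solve-∀ ring

isProduct : ∀ n k (0<k : 0ℝ < k) → IsProduct n k 0<k (eval (pP n) (qℝ k 0<k))
isProduct n k 0<k = (λ k#⅓ → ≈-sym (product≈ k 0<k n k#⅓)) , limit
  where
  1/9 : ℚ
  1/9 = ℤ.+ 1 ℚ./ 9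
  limit : k ≈ ⅓ → HasLimit (λ h → 0ℝ < h × h < 1ℝ × h # ⅓)
    (λ h (0<h , _ , h#⅓) → product n h 0<h h#⅓) ⅓ (eval (pP n) (qℝ k 0<k))
  limit k≈⅓ ε 0<ε =
    let γ , 0<γ , ε≥γ = lower ε 0<ε
        Λ , 0<Λ , lip = lipschitz (pP n)
        -- Three quarters of γ cover the steps from the product to its polynomial at h, from there
        -- to the value at q = 1/9, and from that value to the polynomial at k. The last quarter is
        -- the gap demanded by `_<_`.
        η = γ ℚ.* ½ ℚ.* ½
        0<η = half-pos (half-pos 0<γ)
        δ₁ , 0<δ₁ , δ₁Λ≡η = scaled Λ 0<η 0<Λ
        δ = δ₁ ℚ.⊓ 1
        0<δ = 0<⊓ δ₁ 0<δ₁
    in fromℚ δ , 0<fromℚ 0<δ , λ where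
      h (0<h , mk< g 0<g h<1 , h#⅓) (mk< g′ 0<g′ h-near) →
        let β , 0<β , h≥β = lower h 0<h in
        mk< η 0<η (map-eventually
          (λ m ((((γ≤ε , β≤h) , g≤1-h) , g′≤) , (p , t)) →
            combine γ (seq ε m) (seq (product n h 0<h h#⅓) m) (seq (eval (pP n) (qℝ h 0<h)) m)
              (⟦ pP n ⟧ 1/9) (seq (eval (pP n) (qℝ k 0<k)) m) γ≤ε p
              (middle Λ δ δ₁ η (seq h m) lip (ℚ.<⇒≤ 0<Λ) (ℚ.p⊓q≤p δ₁ 1) (ℚ.p⊓q≤q δ₁ 1) δ₁Λ≡η
                (ℚ.<-≤-trans 0<β β≤h)
                (≤-by _ (ℚ.≤-trans (ℚ.<⇒≤ 0<g) g≤1-h) refl)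
                (≤-by _ (ℚ.≤-trans (ℚ.<⇒≤ 0<g′) g′≤) refl)
                (seq (eval (pP n) (qℝ h 0<h)) m) (seq-eval (pP n) (qℝ h 0<h) m))
              t)
          (both (both (both (both ε≥γ h≥β) h<1) h-near)
            (both (≈⇒small (product≈ h 0<h n h#⅓) η 0<η)
              (≈⇒small (≈-trans (pointwise {fromℚ (⟦ pP n ⟧ 1/9)} (λ m → sym (seq-eval (pP n) (fromℚ 1/9) m)))
                (eval-cong (pP n) (≈-sym (qℝ≈1/9 k 0<k k≈⅓)))) η 0<η))))
    where
    0<⊓ : ∀ p → 0ℚ ℚ.< p → 0ℚ ℚ.< p ℚ.⊓ 1
    0<⊓ p 0<p with ℚ.⊓-sel p 1
    ... | inj₁ eq = subst (0ℚ ℚ.<_) (sym eq) 0<p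
    ... | inj₂ eq = subst (0ℚ ℚ.<_) (sym eq) lit<
    middle : ∀ Λ δ δ₁ η h → (∀ x y → InUnit x → InUnit y →
        ℚ.∣ ⟦ pP n ⟧ y ℚ.- ⟦ pP n ⟧ x ∣ ℚ.≤ ℚ.∣ y ℚ.- x ∣ ℚ.* Λ) → 0ℚ ℚ.≤ Λ →
      δ ℚ.≤ δ₁ → δ ℚ.≤ 1 → δ₁ ℚ.* Λ ≡ η → 0ℚ ℚ.< h → h ℚ.≤ 1 → ℚ.∣ h ℚ.- (ℤ.+ 1 ℚ./ 3) ∣ ℚ.≤ δ →
      ∀ v → v ≡ ⟦ pP n ⟧ (qOf h) → ℚ.∣ v ℚ.- ⟦ pP n ⟧ 1/9 ∣ ℚ.≤ η
    middle Λ δ δ₁ η h lip 0≤Λ δ≤δ₁ δ≤1 refl 0<h h≤1 near v refl = ℚ.≤-trans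
      (lip 1/9 (qOf h) (lit≤ , lit≤) (Near⅓.q-inUnit 0<h h≤1 δ≤1 near))
      (*-monoʳ Λ 0≤Λ (ℚ.≤-trans (Near⅓.q-near 0<h h≤1 δ≤1 near) δ≤δ₁))
    combine : ∀ γ ε a b v t → γ ℚ.≤ ε → ℚ.∣ a ℚ.- b ∣ ℚ.≤ γ ℚ.* ½ ℚ.* ½ → ℚ.∣ b ℚ.- v ∣ ℚ.≤ γ ℚ.* ½ ℚ.* ½ →
      ℚ.∣ v ℚ.- t ∣ ℚ.≤ γ ℚ.* ½ ℚ.* ½ → γ ℚ.* ½ ℚ.* ½ ℚ.≤ ε ℚ.- ℚ.∣ a ℚ.- t ∣
    combine γ ε a b v t γ≤ε p q r = ≤-by
      ((ε ℚ.- γ) ℚ.+ (γ ℚ.* ½ ℚ.* ½ ℚ.+ γ ℚ.* ½ ℚ.* ½ ℚ.+ γ ℚ.* ½ ℚ.* ½ ℚ.- ℚ.∣ a ℚ.- t ∣))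
      (0≤-diff γ≤ε ⊹ 0≤-diff (subst (λ z → ℚ.∣ z ∣ ℚ.≤ γ ℚ.* ½ ℚ.* ½ ℚ.+ γ ℚ.* ½ ℚ.* ½ ℚ.+ γ ℚ.* ½ ℚ.* ½)
        (telescope a b v t) (∣+∣≤ {(a ℚ.- b) ℚ.+ (b ℚ.- v)} (∣+∣≤ {a ℚ.- b} p q) r)))
      (lemma ε γ ℚ.∣ a ℚ.- t ∣)
      where
      telescope : ∀ a b v t → ((a ℚ.- b) ℚ.+ (b ℚ.- v)) ℚ.+ (v ℚ.- t) ≡ a ℚ.- t
      telescope = solve-∀ ring
      lemma : ∀ ε γ z → (ε ℚ.- z) ℚ.- γ ℚ.* ½ ℚ.* ½
        ≡ (ε ℚ.- γ) ℚ.+ (γ ℚ.* ½ ℚ.* ½ ℚ.+ γ ℚ.* ½ ℚ.* ½ ℚ.+ γ ℚ.* ½ ℚ.* ½ ℚ.- z)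
      lemma = solve-∀ ring

-- One polynomial in q(k) meets both clauses of `IsProduct`, so the witness is given without
-- deciding whether k is apart from 1/3 or equal to it.
theorem3 : (k : ℝ) (0<k : 0ℝ < k) (k<1 : k < 1ℝ) →
    ∃ λ (p : ℕ → ℝ) →
    (∀ n → IsProduct n k 0<k (p n)) ×
    HasSum
    (λ n → coefficient n * p n *
    (C₃ k 0<k * fromℕ n ^ 3 + C₂ k * fromℕ n ^ 2 + C₁ k * fromℕ n + C₀ k))
    (value k 0<k)
theorem3 k 0<k k<1 = Curve.p k 0<k k<1 , (λ n → isProduct n k 0<k) , Curve.hasSum k 0<k k<1
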